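{- Let $p>7$ be a prime and let $X$ be a connected cubic vertex-transitive graph of order $12p$. If $\mathrm{Aut}(X)$ is solvable, then either $\mathrm{Aut}(X)$ has a normal Sylow $p$-subgroup, or $X\cong X(3p,2)$.
   Context: All graphs are finite, simple, undirected and connected. For an integer $n\ge 2$, $X(n,2)$ is the cubic graph of order $4n$ with vertex set $\{x_k^0,x_k^1 : k\in\mathbb{Z}_{2n}\}$ and edges $x_{2i}^r\sim x_{2i+1}^r$ for $i\in\mathbb{Z}_n$, $r\in\mathbb{Z}_2$, and $x_{2i+1}^r\sim x_{2i+2}^s$ for $i\in\mathbb{Z}_n$, $r,s\in\mathbb{Z}_2$. -}

module Defs where

open import Level using (Level; suc; zero)
open import Data.Nat as ℕ using (ℕ; _+_; _*_; _^_; _%_; _/_; _≡ᵇ_)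
open import Data.Nat.Divisibility using (_∣_)
open import Data.Bool using (Bool; true; false; _∧_; _∨_; not; if_then_else_)
open import Data.Fin using (Fin; toℕ)
import Data.Fin as Fin
open import Data.Fin.Permutation using (Permutation; Permutation′; _⟨$⟩ʳ_; _⟨$⟩ˡ_; _≈_; id; flip; _∘ₚ_)
open import Data.Product using (Σ; ∃; _×_; _,_)
open import Relation.Binary.PropositionalEquality using (_≡_; _≢_)
open import Relation.Nullary using (¬_)
open import Function using (_∘_)

Graph : ℕ → Set
Graph n = Fin n → Fin n → Bool

IsSimple : ∀ {n} → Graph n → Set
IsSimple {n} X = (∀ u v → X u v ≡ X v u) × (∀ u → X u u ≡ false)

countTrue : ∀ {n} → (Fin n → Bool) → ℕ
countTrue {ℕ.zero} f = 0
countTrue {ℕ.suc n} f = (if f Fin.zero then 1 else 0) + countTrue (f ∘ Fin.suc)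

degree : ∀ {n} → Graph n → Fin n → ℕ
degree X u = countTrue (X u)

Cubic : ∀ {n} → Graph n → Set
Cubic X = ∀ u → degree X u ≡ 3

data Reach {n} (X : Graph n) (u : Fin n) : Fin n → Set where
  here : Reach X u u
  step : ∀ {v w} → Reach X u v → X v w ≡ true → Reach X u w

Connected : ∀ {n} → Graph n → Set
Connected X = ∀ u v → Reach X u v

Perm : ℕ → Set
Perm n = Permutation′ n

PermSet : ℕ → Set₁
PermSet n = Perm n → Set

Aut : ∀ {n} → Graph n → PermSet n
Aut X σ = ∀ u v → X (σ ⟨$⟩ʳ u) (σ ⟨$⟩ʳ v) ≡ X u v

VertexTransitive : ∀ {n} → Graph n → Set
VertexTransitive X = ∀ u v → Σ _ λ σ → Aut X σ × (σ ⟨$⟩ʳ u ≡ v)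

IsSubgroup : ∀ {n} → PermSet n → Set
IsSubgroup {n} H =
  (∀ σ τ → σ ≈ τ → H σ → H τ) ×
  H id ×
  (∀ σ τ → H σ → H τ → H (σ ∘ₚ τ)) ×
  (∀ σ → H σ → H (flip σ))

_⊆_ : ∀ {n} → PermSet n → PermSet n → Set
H ⊆ K = ∀ σ → H σ → K σ

_⊴_ : ∀ {n} → PermSet n → PermSet n → Set
H ⊴ K = IsSubgroup H × (H ⊆ K) × (∀ g h → K g → H h → H (flip g ∘ₚ (h ∘ₚ g)))

commutator : ∀ {n} → Perm n → Perm n → Perm n
commutator a b = flip a ∘ₚ (flip b ∘ₚ (a ∘ₚ b))

-- K is solvable: there is a subnormal series 1 = G₀ ⊴ G₁ ⊴ … ⊴ Gₖ = K
-- with every factor G_{i+1}/G_i abelian (all commutators of G_{i+1} in G_i)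
data Solvable {n} : PermSet n → Set₁ where
  trivial : ∀ {K} → (∀ σ → K σ → σ ≈ id) → Solvable K
  extend  : ∀ {K} (H : PermSet n) → H ⊴ K →
            (∀ a b → K a → K b → H (commutator a b)) →
            Solvable H → Solvable K

HasOrder : ∀ {n} → PermSet n → ℕ → Set
HasOrder {n} H m = Σ (Fin m → Perm n) λ xs →
  (∀ i → H (xs i)) ×
  (∀ i j → xs i ≈ xs j → i ≡ j) ×
  (∀ σ → H σ → Σ (Fin m) λ i → σ ≈ xs i)

HasNormalSylow : ∀ {n} → ℕ → PermSet n → Set₁
HasNormalSylow {n} p K = Σ (PermSet n) λ P → P ⊴ K ×
  Σ ℕ λ a → Σ ℕ λ m → HasOrder P (p ^ a) × HasOrder K (p ^ a * m) × ¬ (p ∣ m)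

_≅_ : ∀ {m n} → Graph m → Graph n → Set
_≅_ {m} {n} X Y = Σ (Permutation m n) λ f → ∀ u v → Y (f ⟨$⟩ʳ u) (f ⟨$⟩ʳ v) ≡ X u v

-- The graph X(n,2) on 4n vertices.  Vertex x_k^r (k ∈ ℤ_{2n}, r ∈ ℤ₂)
-- is encoded as the element 2k + r of Fin (4 * n).

module _ (n : ℕ) where
  succMod : ℕ → ℕ → Bool
  succMod k k' = (ℕ.suc k ≡ᵇ k') ∨ ((ℕ.suc k ≡ᵇ 2 * n) ∧ (k' ≡ᵇ 0))

  isEven : ℕ → Bool
  isEven k = k % 2 ≡ᵇ 0

  -- directed edge relation: x_{2i}^r → x_{2i+1}^r,  x_{2i+1}^r → x_{2i+2}^s
  edgeX : ℕ → ℕ → ℕ → ℕ → Bool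
  edgeX k r k' r' = (isEven k ∧ succMod k k' ∧ (r ≡ᵇ r'))
                  ∨ (not (isEven k) ∧ succMod k k')

  adjℕ : ℕ → ℕ → Bool
  adjℕ a b = edgeX (a / 2) (a % 2) (b / 2) (b % 2)
           ∨ edgeX (b / 2) (b % 2) (a / 2) (a % 2)

  X[_,2] : Graph (4 * n)
  X[_,2] u v = adjℕ (toℕ u) (toℕ v)

{-# OPTIONS --safe #-}
module Submission where

-- Let A = Aut X be solvable.  An element of prime order r > 3 fixing a vertex fixes its three neighbours, hence is trivial by
-- connectedness, so the prime divisors of |A| are at most 2, 3 and p.  A normal r-subgroup of A has vertex orbits of equal
-- size, a power of r dividing 12p; hence a normal 3-subgroup has order at most 9, and a normal p-subgroup order at most p.
-- A normal 2-subgroup Q has orbits ("blocks") of size at most 4.  If Q is not semiregular, some element of Q fixes a vertex v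
-- but moves a neighbour of v, so v has two neighbours in one block.  The third neighbour of v lies in another block and all
-- three lie outside the block of v, as otherwise two blocks would contain all 12p vertices; the third neighbour therefore
-- pairs off the blocks, impossible if they have size 4 (their number 3p is odd), while blocks of size 2 give X = X(3p,2).
-- If Q is semiregular then |Q| ≤ 4.  So if X is not X(3p,2), an element g of order p centralises every normal 2- or
-- 3-subgroup, which has too few elements for an orbit of length p.  By induction along a normal series with abelian factors,
-- g then centralises every normal subgroup without elements of order p: if [L,L] ≤ M ≤ L and g centralises M, then g
-- centralises C_L(M), which is nilpotent of class at most 2, and [g,L] ≤ C_L(M), so g centralises L by coprime action.
-- Consequently the elements of order p in the first term of the series containing any commute, and together with 1 they form
-- a normal subgroup of order p.
--
-- Having a normal Sylow p-subgroup generated by one element and being isomorphic to X(3p,2) are both decidable, so it suffices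
-- to refute that both fail; this is why arbitrary subsets of A may be assumed decidable along the way (¬¬-Decidable).
open import Defs
open import Algebra.Bundles using (Group)
open import Algebra.Core using (Op₁; Op₂)
import Algebra.Properties.Group as GroupProperties
import Algebra.Properties.Monoid.Mult as Mult
open import Algebra.Structures using (IsGroup)
open import Data.Bool.Base using (Bool; true; false; not; _∧_; _∨_; T; if_then_else_)
import Data.Bool.Properties as Bool
open import Data.Empty using (⊥; ⊥-elim)
open import Data.Fin.Base as Fin using (Fin; zero; suc; toℕ; fromℕ<; combine; remQuot; finToFun; funToFin)
open import Data.Fin.Patterns using (0F; 1F; 2F)
open import Data.Fin.Permutation as Perm using (permutation; _⟨$⟩ʳ_; _⟨$⟩ˡ_; _≈_; flip; _∘ₚ_)
open import Data.Fin.Properties as Fin using (any?; all?; injective⇒≤)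
open import Data.List.Base as List using (List; []; _∷_)
open import Data.List.Membership.Propositional using (_∈_)
import Data.List.Properties as List
open import Data.List.Relation.Unary.All as ListAll using ([]; _∷_) renaming (All to ListAll)
open import Data.List.Relation.Unary.Any using (here; there)
open import Data.Nat.Base as ℕ using (ℕ; zero; suc; _+_; _*_; _∸_; _^_; _≤_; _<_; z≤n; s≤s; _≡ᵇ_; >-nonZero; nonTrivial⇒n>1)
open import Data.Nat.Coprimality as Coprime using (Coprime; coprime-divisor; prime⇒coprime; coprime-Bézout)
open import Data.Nat.Divisibility using (_∣_; divides; ∣-trans; ∣⇒≤; m∣m*n; n∣m*n; ∣1⇒≡1; ∣m+n∣m⇒∣n; *-cancelˡ-∣)
open import Data.Nat.DivMod using (_/_; _%_; m≡m%n+[m/n]*n; m%n<n; [m+kn]%n≡m%n; m<n⇒m%n≡m; m<n⇒m/n≡0; m*n/n≡m; +-distrib-/-∣ʳ; m<n*o⇒m/o<n)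
open import Data.Nat.GCD using (module Bézout)
open import Data.Nat.ListAction using (product)
open import Data.Nat.Primality using (Prime; ¬prime[0]; ¬prime[1]; prime[2]; prime?; prime⇒nonZero; prime⇒nonTrivial; prime⇒irreducible; euclidsLemma)
open import Data.Nat.Primality.Factorisation using (PrimeFactorisation; factorise)
open import Data.Nat.Properties as ℕ using (≤-antisym)
open import Data.Product.Base using (∃; _×_; _,_; proj₁; proj₂)
open import Data.Sum.Base as Sum using (_⊎_; inj₁; inj₂; [_,_]′)
open import Data.Unit.Base using (tt)
open import Data.Vec.Base using (Vec; []; _∷_; _∷ʳ_; toList; replicate)
import Data.Vec.Properties as Vec
open import Data.Vec.Relation.Unary.All as All using (All; []; _∷_)
open import Function.Base using (_∘_; id)
open import Function.Bundles using (mk⇔)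
open import Level using (0ℓ)
open import Relation.Binary.Core using (Rel)
open import Relation.Binary.Definitions as Rel using (tri<; tri≈; tri>)
open import Relation.Binary.PropositionalEquality
open import Relation.Binary.Structures using (IsEquivalence)
open import Relation.Nullary using (¬_; Dec; yes; no; does; contradiction)
open import Relation.Nullary.Decidable using (_×-dec_; _⊎-dec_; ¬?; decidable-stable; ¬¬-excluded-middle; from-yes; from-no; map′)
open import Relation.Unary using (Pred; Decidable) renaming (_⊆_ to _⊑_)
open import Algebra.Properties.CommutativeMonoid.Sum ℕ.+-0-commutativeMonoid using (sum; sum-cong-≗; ∑-comm)
open import Algebra.Properties.Semiring.Sum ℕ.+-*-semiring using (*-distribʳ-sum)

-- Counting in finite sets

private variable
  m n k : ℕ
  P Q : Pred (Fin n) 0ℓ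

# : {P : Pred (Fin n) 0ℓ} → Decidable P → ℕ
# P? = countTrue (λ i → does (P? i))

-- A bijection of `Fin k` with the subset. Membership proofs need not be unique, but `elem-index`
-- and `elem-injective` make `index` independent of them.
record Enumeration {n} (P : Pred (Fin n) 0ℓ) (k : ℕ) : Set where
  field
    elem           : Fin k → Fin n
    elem∈          : ∀ j → P (elem j)
    elem-injective : ∀ {i j} → elem i ≡ elem j → i ≡ j
    index          : ∀ i → P i → Fin k
    elem-index     : ∀ i (Pi : P i) → elem (index i Pi) ≡ i

enumerate : {P : Pred (Fin n) 0ℓ} (P? : Decidable P) → Enumeration P (# P?)
enumerate {zero} P? = record
  { elem = λ () ; elem∈ = λ () ; elem-injective = λ { {()} } ; index = λ () ; elem-index = λ () }
enumerate {suc n} {P} P? with P? zero | enumerate {P = P ∘ suc} (P? ∘ suc)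
... | yes P0 | e = record
  { elem           = λ { zero → zero ; (suc j) → suc (elem j) }
  ; elem∈          = λ { zero → P0 ; (suc j) → elem∈ j }
  ; elem-injective = λ { {zero} {zero} _ → refl
                       ; {suc i} {suc j} eq → cong suc (elem-injective (Fin.suc-injective eq)) }
  ; index          = λ { zero _ → zero ; (suc i) Pi → suc (index i Pi) }
  ; elem-index     = λ { zero _ → refl ; (suc i) Pi → cong suc (elem-index i Pi) }
  } where open Enumeration e
... | no ¬P0 | e = record
  { elem           = suc ∘ elem
  ; elem∈          = elem∈
  ; elem-injective = λ eq → elem-injective (Fin.suc-injective eq)
  ; index          = λ { zero P0 → contradiction P0 ¬P0 ; (suc i) Pi → index i Pi }
  ; elem-index     = λ { zero P0 → contradiction P0 ¬P0 ; (suc i) Pi → cong suc (elem-index i Pi) }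
  } where open Enumeration e

#-family : (P? : Decidable P) (f : Fin k → Fin n) → (∀ j → P (f j)) →
           (∀ {i j} → f i ≡ f j → i ≡ j) → k ≤ # P?
#-family P? f f∈ f-inj = injective⇒≤ {f = λ j → index (f j) (f∈ j)} λ {i} {j} eq →
  f-inj (trans (sym (elem-index (f i) (f∈ i))) (trans (cong elem eq) (elem-index (f j) (f∈ j))))
  where open Enumeration (enumerate P?)

#-injection-into : (P? : Decidable P) (f : ∀ i → P i → Fin k) →
                   (∀ {i j} Pi Pj → f i Pi ≡ f j Pj → i ≡ j) → # P? ≤ k
#-injection-into P? f f-inj = injective⇒≤ {f = λ j → f (elem j) (elem∈ j)}
  (λ eq → elem-injective (f-inj _ _ eq))
  where open Enumeration (enumerate P?)

#-injection : (P? : Decidable P) (Q? : Decidable Q) (f : Fin m → Fin n) → (∀ {i} → P i → Q (f i)) →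
              (∀ {i j} → P i → P j → f i ≡ f j → i ≡ j) → # P? ≤ # Q?
#-injection P? Q? f f∈ f-inj = #-family Q? (f ∘ elem) (f∈ ∘ elem∈)
  (λ eq → elem-injective (f-inj (elem∈ _) (elem∈ _) eq))
  where open Enumeration (enumerate P?)

#-mono : (P? : Decidable P) (Q? : Decidable Q) → (∀ {i} → P i → Q i) → # P? ≤ # Q?
#-mono P? Q? P⊆Q = #-injection P? Q? id P⊆Q (λ _ _ → id)

#-cong : (P? : Decidable P) (Q? : Decidable Q) → (∀ {i} → P i → Q i) → (∀ {i} → Q i → P i) → # P? ≡ # Q?
#-cong P? Q? P⊆Q Q⊆P = ≤-antisym (#-mono P? Q? P⊆Q) (#-mono Q? P? Q⊆P)

#-cover : (P? : Decidable P) (f : Fin k → Fin n) → (∀ i → P i → ∃ λ j → f j ≡ i) → # P? ≤ k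
#-cover P? f cover = #-injection-into P? (λ i Pi → proj₁ (cover i Pi)) λ Pi Pj eq →
  trans (sym (proj₂ (cover _ Pi))) (trans (cong f eq) (proj₂ (cover _ Pj)))

#-all : (P? : Decidable P) → (∀ (i : Fin n) → P i) → # P? ≡ n
#-all P? all = ≤-antisym (#-cover P? id (λ i _ → i , refl)) (#-family P? id all id)

#-empty : (P? : Decidable P) → (∀ (i : Fin n) → ¬ P i) → # P? ≡ 0
#-empty P? none = ℕ.n≤0⇒n≡0 (#-injection-into P? (λ i Pi → ⊥-elim (none i Pi)) (λ Pi _ _ → ⊥-elim (none _ Pi)))

#-unique : (P? : Decidable P) (i : Fin n) → P i → (∀ j → P j → j ≡ i) → # P? ≡ 1
#-unique P? i Pi unique = ≤-antisym
  (#-cover P? (λ _ → i) (λ j Pj → zero , sym (unique j Pj)))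
  (#-family P? (λ _ → i) (λ _ → Pi) (λ { {zero} {zero} _ → refl }))

#>0 : (P? : Decidable P) (i : Fin n) → P i → 0 < # P?
#>0 P? i Pi = #-family {k = 1} P? (λ _ → i) (λ _ → Pi) (λ { {zero} {zero} _ → refl })

private
  indicator : Bool → ℕ
  indicator b = if b then 1 else 0

  countTrue≡sum : (f : Fin n → Bool) → countTrue f ≡ sum (λ i → indicator (f i))
  countTrue≡sum {zero}  f = refl
  countTrue≡sum {suc n} f = cong (indicator (f zero) +_) (countTrue≡sum (f ∘ suc))

#-fibres : (f : Fin m → Fin n) (P? : Decidable P) (Q? : Decidable Q) (s : ℕ) → (∀ {i} → P i → Q (f i)) →
           (∀ {j} → Q j → # (λ i → P? i ×-dec (f i Fin.≟ j)) ≡ s) → # P? ≡ # Q? * s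
#-fibres {m} {n} {P} {Q} f P? Q? s f∈ fibre = begin
  # P?                                                  ≡⟨ countTrue≡sum (does ∘ P?) ⟩
  sum (λ i → indicator (does (P? i)))                           ≡⟨ sum-cong-≗ row ⟩
  sum (λ i → sum (λ j → indicator (does (both i j))))           ≡⟨ ∑-comm {m} {n} (λ i j → indicator (does (both i j))) ⟩
  sum (λ j → sum (λ i → indicator (does (both i j))))           ≡⟨ sum-cong-≗ column ⟩
  sum (λ j → indicator (does (Q? j)) * s)                       ≡⟨ *-distribʳ-sum s (λ j → indicator (does (Q? j))) ⟨
  sum (λ j → indicator (does (Q? j))) * s                       ≡⟨ cong (_* s) (countTrue≡sum (does ∘ Q?)) ⟨
  # Q? * s                                              ∎
  where
  open ≡-Reasoning
  -- The 0-1 matrix of a double count: row `i` sums to 1 or 0 according to `P i`, column `j` to `s`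
  -- or 0 according to `Q j`.
  both : ∀ i j → Dec (P i × f i ≡ j)
  both i j = P? i ×-dec (f i Fin.≟ j)
  row : ∀ i → indicator (does (P? i)) ≡ sum (λ j → indicator (does (both i j)))
  row i = trans (size (P? i)) (countTrue≡sum (λ j → does (both i j)))
    where
    size : (d : Dec (P i)) → indicator (does d) ≡ # (λ j → d ×-dec (f i Fin.≟ j))
    size (yes Pi) = sym (#-unique (λ j → yes Pi ×-dec (f i Fin.≟ j)) (f i) (Pi , refl) (λ j eq → sym (proj₂ eq)))
    size (no ¬Pi) = sym (#-empty {P = λ j → P i × f i ≡ j} (λ j → no ¬Pi ×-dec (f i Fin.≟ j)) (λ j eq → ¬Pi (proj₁ eq)))
  column : ∀ j → sum (λ i → indicator (does (both i j))) ≡ indicator (does (Q? j)) * s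
  column j = trans (sym (countTrue≡sum (λ i → does (both i j)))) (size (Q? j))
    where
    size : (d : Dec (Q j)) → # (λ i → both i j) ≡ indicator (does d) * s
    size (yes Qj) = trans (fibre Qj) (sym (ℕ.+-identityʳ s))
    size (no ¬Qj) = #-empty (λ i → both i j) (λ { i (Pi , refl) → ¬Qj (f∈ Pi) })

#-remove : (P? : Decidable P) (i : Fin n) → P i → # P? ≡ suc (# (λ j → P? j ×-dec ¬? (j Fin.≟ i)))
#-remove {n} {P} P? i Pi = ≤-antisym
  (#-injection-into P? (λ j Pj → f j Pj (j Fin.≟ i)) (λ {j} {k} Pj Pk → f-inj Pj Pk (j Fin.≟ i) (k Fin.≟ i)))
  (#-family P? g g∈ g-inj)
  where
  P∖i? : Decidable (λ j → P j × j ≢ i)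
  P∖i? j = P? j ×-dec ¬? (j Fin.≟ i)
  open Enumeration (enumerate P∖i?)
  f : ∀ j → P j → Dec (j ≡ i) → Fin (suc (# P∖i?))
  f j Pj (yes _)  = zero
  f j Pj (no j≢i) = suc (index j (Pj , j≢i))
  f-inj : ∀ {j k} Pj Pk d e → f j Pj d ≡ f k Pk e → j ≡ k
  f-inj Pj Pk (yes refl) (yes refl) _ = refl
  f-inj Pj Pk (no j≢i) (no k≢i) eq =
    trans (sym (elem-index _ (Pj , j≢i))) (trans (cong elem (Fin.suc-injective eq)) (elem-index _ (Pk , k≢i)))
  g : Fin (suc (# P∖i?)) → Fin n
  g zero    = i
  g (suc j) = elem j
  g∈ : ∀ j → P (g j)
  g∈ zero    = Pi
  g∈ (suc j) = proj₁ (elem∈ j)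
  g-inj : ∀ {j k} → g j ≡ g k → j ≡ k
  g-inj {zero}  {zero}  _  = refl
  g-inj {zero}  {suc k} eq = contradiction (sym eq) (proj₂ (elem∈ k))
  g-inj {suc j} {zero}  eq = contradiction eq (proj₂ (elem∈ j))
  g-inj {suc j} {suc k} eq = cong suc (elem-injective eq)

#-⊎ : (P? : Decidable P) (Q? : Decidable Q) → # (λ i → P? i ⊎-dec Q? i) ≤ # P? + # Q?
#-⊎ {n} {P} {Q} P? Q? = #-injection-into (λ i → P? i ⊎-dec Q? i) f f-inj
  where
  module P = Enumeration (enumerate P?)
  module Q = Enumeration (enumerate Q?)
  f : ∀ i → P i ⊎ Q i → Fin (# P? + # Q?)
  f i (inj₁ Pi) = P.index i Pi Fin.↑ˡ # Q?
  f i (inj₂ Qi) = # P? Fin.↑ʳ Q.index i Qi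
  ↑ˡ≢↑ʳ : ∀ (i : Fin (# P?)) (j : Fin (# Q?)) → i Fin.↑ˡ # Q? ≢ # P? Fin.↑ʳ j
  ↑ˡ≢↑ʳ i j eq with trans (sym (Fin.splitAt-↑ˡ (# P?) i (# Q?))) (trans (cong (Fin.splitAt (# P?)) eq) (Fin.splitAt-↑ʳ (# P?) (# Q?) j))
  ... | ()
  f-inj : ∀ {i j} Pi Pj → f i Pi ≡ f j Pj → i ≡ j
  f-inj (inj₁ Pi) (inj₁ Pj) eq = trans (sym (P.elem-index _ Pi))
    (trans (cong P.elem (Fin.↑ˡ-injective (# Q?) _ _ eq)) (P.elem-index _ Pj))
  f-inj (inj₂ Qi) (inj₂ Qj) eq = trans (sym (Q.elem-index _ Qi))
    (trans (cong Q.elem (Fin.↑ʳ-injective (# P?) _ _ eq)) (Q.elem-index _ Qj))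
  f-inj (inj₁ Pi) (inj₂ Qj) eq = contradiction eq (↑ˡ≢↑ʳ _ _)
  f-inj (inj₂ Qi) (inj₁ Pj) eq = contradiction (sym eq) (↑ˡ≢↑ʳ _ _)

#-⊎-disjoint : (P? : Decidable P) (Q? : Decidable Q) → (∀ {i} → P i → ¬ Q i) →
               # (λ i → P? i ⊎-dec Q? i) ≡ # P? + # Q?
#-⊎-disjoint {n} {P} {Q} P? Q? disjoint = ≤-antisym (#-⊎ P? Q?)
  (#-family (λ i → P? i ⊎-dec Q? i) (g ∘ Fin.splitAt (# P?)) (g∈ ∘ Fin.splitAt (# P?))
    (λ {i} {j} eq → trans (sym (Fin.join-splitAt (# P?) (# Q?) i))
      (trans (cong (Fin.join (# P?) (# Q?)) (g-inj (Fin.splitAt (# P?) i) (Fin.splitAt (# P?) j) eq)) (Fin.join-splitAt (# P?) (# Q?) j))))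
  where
  module P = Enumeration (enumerate P?)
  module Q = Enumeration (enumerate Q?)
  g : Fin (# P?) ⊎ Fin (# Q?) → Fin n
  g (inj₁ i) = P.elem i
  g (inj₂ j) = Q.elem j
  g∈ : ∀ s → P (g s) ⊎ Q (g s)
  g∈ (inj₁ i) = inj₁ (P.elem∈ i)
  g∈ (inj₂ j) = inj₂ (Q.elem∈ j)
  g-inj : ∀ s s′ → g s ≡ g s′ → s ≡ s′
  g-inj (inj₁ i) (inj₁ j) eq = cong inj₁ (P.elem-injective eq)
  g-inj (inj₂ i) (inj₂ j) eq = cong inj₂ (Q.elem-injective eq)
  g-inj (inj₁ i) (inj₂ j) eq = contradiction (subst Q (sym eq) (Q.elem∈ j)) (disjoint (P.elem∈ i))
  g-inj (inj₂ i) (inj₁ j) eq = contradiction (subst Q eq (Q.elem∈ i)) (disjoint (P.elem∈ j))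

-- If two distinct points had the same image, `f` would remain onto after deleting one of them, and
-- fewer than `n` points would cover `n`.
surjective⇒injective : (f : Fin n → Fin n) → (∀ j → ∃ λ i → f i ≡ j) → ∀ {i j} → f i ≡ f j → i ≡ j
surjective⇒injective {n} f surj {x} {y} eq with x Fin.≟ y
... | yes x≡y = x≡y
... | no  x≢y = contradiction
  (#-cover All? (f ∘ elem) (λ j _ → let i , fi≡j = surj j in cover i fi≡j (i Fin.≟ y)))
  (ℕ.<⇒≱ (ℕ.≤-reflexive (sym (#-remove All? y refl))))
  where
  All? : Decidable {A = Fin n} (λ i → i ≡ i)
  All? i = yes refl
  open Enumeration (enumerate (λ i → All? i ×-dec ¬? (i Fin.≟ y)))
  cover : ∀ i {j} → f i ≡ j → Dec (i ≡ y) → ∃ λ k → f (elem k) ≡ j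
  cover i fi≡j (no i≢y)    = index i (refl , i≢y) , trans (cong f (elem-index i (refl , i≢y))) fi≡j
  cover i fi≡j (yes refl)  = index x (refl , x≢y) , trans (cong f (elem-index x (refl , x≢y))) (trans eq fi≡j)

private
  -- The least element of a predicate, or zero if there is none: the default makes the value depend
  -- on the predicate only up to logical equivalence.
  least : {P : Pred (Fin (suc n)) 0ℓ} → Decidable P → Fin (suc n)
  least {zero}  P? = zero
  least {suc n} {P} P? with P? zero | any? {P = P ∘ suc} (P? ∘ suc)
  ... | yes _ | _     = zero
  ... | no _  | yes _ = suc (least {P = P ∘ suc} (P? ∘ suc))
  ... | no _  | no _  = zero

  least-satisfies : {P : Pred (Fin (suc n)) 0ℓ} (P? : Decidable P) → ∃ P → P (least P?)
  least-satisfies {zero}  P? (zero , P0) = P0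
  least-satisfies {suc n} {P} P? (i , Pi) with P? zero | any? {P = P ∘ suc} (P? ∘ suc)
  ... | yes P0 | _      = P0
  ... | no _   | yes ex = least-satisfies {P = P ∘ suc} (P? ∘ suc) ex
  least-satisfies {suc n} P? (zero , P0)   | no ¬P0 | no _   = contradiction P0 ¬P0
  least-satisfies {suc n} P? (suc i , Pi)  | no _   | no ¬ex = contradiction (i , Pi) ¬ex

  least-cong : {P Q : Pred (Fin (suc n)) 0ℓ} (P? : Decidable P) (Q? : Decidable Q) →
               (∀ {i} → P i → Q i) → (∀ {i} → Q i → P i) → least P? ≡ least Q?
  least-cong {zero}  P? Q? _ _ = refl
  least-cong {suc n} {P} {Q} P? Q? P⊆Q Q⊆P
    with P? zero | any? {P = P ∘ suc} (P? ∘ suc) | Q? zero | any? {P = Q ∘ suc} (Q? ∘ suc)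
  ... | yes _  | _      | yes _  | _      = refl
  ... | yes P0 | _      | no ¬Q0 | _      = contradiction (P⊆Q P0) ¬Q0
  ... | no ¬P0 | _      | yes Q0 | _      = contradiction (Q⊆P Q0) ¬P0
  ... | no _   | yes _  | no _   | yes _  = cong suc (least-cong {P = P ∘ suc} {Q = Q ∘ suc} (P? ∘ suc) (Q? ∘ suc) P⊆Q Q⊆P)
  ... | no _   | yes ex | no _   | no ¬ex = contradiction (proj₁ ex , P⊆Q (proj₂ ex)) ¬ex
  ... | no _   | no ¬ex | no _   | yes ex = contradiction (proj₁ ex , Q⊆P (proj₂ ex)) ¬ex
  ... | no _   | no _   | no _   | no _   = refl

#-classes : {R : Rel (Fin n) 0ℓ} → IsEquivalence R → (R? : Rel.Decidable R) →
            (P? : Decidable P) → (∀ {i j} → R i j → P i → P j) →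
            ∀ d → (∀ {i} → P i → # (R? i) ≡ d) → d ∣ # P?
#-classes {zero}  isEq R? P? closed d size = divides 0 refl
#-classes {suc n} {P} {R} isEq R? P? closed d size = divides (# IsRep?) (#-fibres rep P? IsRep? d rep∈ fibre)
  where
  open IsEquivalence isEq renaming (refl to R-refl; sym to R-sym; trans to R-trans)
  -- `least` depends on the class only, so equivalent elements share a representative; the fibres of
  -- `rep` over the representatives in `P` are whole classes, each of size `d`.
  rep : Fin (suc n) → Fin (suc n)
  rep i = least (R? i)
  rep-R : ∀ i → R i (rep i)
  rep-R i = least-satisfies (R? i) (i , R-refl)
  rep-cong : ∀ {i j} → R i j → rep i ≡ rep j
  rep-cong Rij = least-cong (R? _) (R? _) (R-trans (R-sym Rij)) (R-trans Rij)
  IsRep : Pred (Fin (suc n)) 0ℓ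
  IsRep j = P j × rep j ≡ j
  IsRep? : Decidable IsRep
  IsRep? j = P? j ×-dec (rep j Fin.≟ j)
  rep∈ : ∀ {i} → P i → IsRep (rep i)
  rep∈ {i} Pi = closed (rep-R i) Pi , sym (rep-cong (rep-R i))
  fibre : ∀ {j} → IsRep j → # (λ i → P? i ×-dec (rep i Fin.≟ j)) ≡ d
  fibre {j} (Pj , rep-j) = trans
    (#-cong (λ i → P? i ×-dec (rep i Fin.≟ j)) (R? j) (λ { {i} (_ , refl) → R-sym (rep-R i) })
                     (λ Rji → closed Rji Pj , trans (sym (rep-cong Rji)) rep-j))
    (size Pj)

-- Primes and iterated maps

prime⇒≥2 : ∀ {r} → Prime r → 2 ≤ r
prime⇒≥2 {r} pr = nonTrivial⇒n>1 r {{prime⇒nonTrivial pr}}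

prime>0 : ∀ {r} → Prime r → 0 < r
prime>0 pr = ℕ.<-trans (s≤s z≤n) (prime⇒≥2 pr)

prime∣prime⇒≡ : ∀ {q r} → Prime q → Prime r → q ∣ r → q ≡ r
prime∣prime⇒≡ pq pr q∣r with prime⇒irreducible pr q∣r
... | inj₁ refl = contradiction (prime⇒≥2 pq) (ℕ.<⇒≱ (s≤s (s≤s z≤n)))
... | inj₂ q≡r  = q≡r

coprime-^ : ∀ {m n} k → Coprime m n → Coprime m (n ^ k)
coprime-^ zero    c (_ , d∣1) = ∣1⇒≡1 d∣1
coprime-^ {m} {n} (suc k) c {d} (d∣m , d∣n^) =
  coprime-^ k c (d∣m , coprime-divisor {d} {n} (λ { (e∣d , e∣n) → c (∣-trans e∣d d∣m , e∣n) }) d∣n^)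

primes-coprime : ∀ {q r} → Prime q → Prime r → q ≢ r → Coprime q r
primes-coprime pq pr q≢r {d} (d∣q , d∣r) with prime⇒irreducible pq d∣q | prime⇒irreducible pr d∣r
... | inj₁ d≡1  | _         = d≡1
... | inj₂ _    | inj₁ d≡1  = d≡1
... | inj₂ refl | inj₂ refl = contradiction refl q≢r

<prime⇒coprime-^ : ∀ {r i} k → Prime r → 0 < i → i < r → Coprime i (r ^ k)
<prime⇒coprime-^ k pr 0<i i<r = coprime-^ k (Coprime.sym (prime⇒coprime pr {{>-nonZero 0<i}} i<r))

∣^⇒∣ : ∀ {q m} k → Prime q → q ∣ m ^ k → q ∣ m
∣^⇒∣ zero    pq q∣1 = contradiction (prime⇒≥2 pq) (ℕ.<⇒≱ (subst (_< 2) (sym (∣1⇒≡1 q∣1)) (s≤s (s≤s z≤n))))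
∣^⇒∣ {m = m} (suc k) pq q∣m^ with euclidsLemma m (m ^ k) pq q∣m^
... | inj₁ q∣m  = q∣m
... | inj₂ q∣m^ = ∣^⇒∣ k pq q∣m^

-- All entries of the prime factorisation equal `r`, so their number is the exponent.
only-prime-divisor⇒power : ∀ {r} n → 0 < n → (∀ {q} → Prime q → q ∣ n → q ≡ r) → ∃ λ j → n ≡ r ^ j
only-prime-divisor⇒power {r} n 0<n only = List.length factors , trans isFactorisation
  (product-constant factors (λ q∈ → only (ListAll.lookup factorsPrime q∈) (subst (_ ∣_) (sym isFactorisation) (∈⇒∣product q∈))))
  where
  open PrimeFactorisation (factorise n {{>-nonZero 0<n}})
  ∈⇒∣product : ∀ {q as} → q ∈ as → q ∣ product as
  ∈⇒∣product {as = a ∷ as} (here refl) = m∣m*n (product as)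
  ∈⇒∣product {as = a ∷ as} (there q∈)  = ∣-trans (∈⇒∣product q∈) (n∣m*n a)
  product-constant : ∀ as → (∀ {q} → q ∈ as → q ≡ r) → product as ≡ r ^ List.length as
  product-constant []       _   = refl
  product-constant (a ∷ as) all = cong₂ _*_ (all (here refl)) (product-constant as (all ∘ there))

^-∣ : ∀ r {i j} → i ≤ j → r ^ i ∣ r ^ j
^-∣ r {i} {j} i≤j = divides (r ^ (j ∸ i)) (trans (cong (r ^_) (sym (ℕ.m∸n+n≡m i≤j))) (ℕ.^-distribˡ-+-* r (j ∸ i) i))

power-divisor-bound : ∀ {r j m} → Prime r → ∀ i → r ^ j ∣ m → ¬ (r ^ suc i ∣ m) → r ^ j ≤ r ^ i
power-divisor-bound {r} {j} pr i r^j∣m r^i+1∤m with ℕ._≤?_ j i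
... | yes j≤i = ℕ.^-monoʳ-≤ r {{prime⇒nonZero pr}} j≤i
... | no  j≰i = contradiction (∣-trans (^-∣ r (ℕ.≰⇒> j≰i)) r^j∣m) r^i+1∤m

module _ {A : Set} where

  iter : (A → A) → ℕ → A → A
  iter f zero    x = x
  iter f (suc n) x = f (iter f n x)

  module _ (f : A → A) where

    iter-+ : ∀ m n x → iter f (m + n) x ≡ iter f m (iter f n x)
    iter-+ zero    n x = refl
    iter-+ (suc m) n x = cong f (iter-+ m n x)

    iter-suc : ∀ n x → f (iter f n x) ≡ iter f n (f x)
    iter-suc zero    x = refl
    iter-suc (suc n) x = cong f (iter-suc n x)

    iter-fixed : ∀ {x} n → f x ≡ x → iter f n x ≡ x
    iter-fixed zero    fx = refl
    iter-fixed (suc n) fx = trans (cong f (iter-fixed n fx)) fx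

    iter-* : ∀ {x n} k → iter f n x ≡ x → iter f (k * n) x ≡ x
    iter-* zero    eq = refl
    iter-* {x} {n} (suc k) eq = trans (iter-+ n (k * n) x) (trans (cong (iter f n) (iter-* k eq)) eq)

    -- By Bézout some multiple of one period exceeds a multiple of the other by one, so a single
    -- step already returns to `x`.
    iter-coprime : ∀ {x a b} → Coprime a b → iter f a x ≡ x → iter f b x ≡ x → f x ≡ x
    iter-coprime {x} {a} {b} c eqa eqb with coprime-Bézout c
    ... | Bézout.+- u v eq = trans (cong f (sym (iter-* v eqb))) (trans (cong (λ e → iter f e x) eq) (iter-* u eqa))
    ... | Bézout.-+ u v eq = trans (cong f (sym (iter-* u eqa))) (trans (cong (λ e → iter f e x) eq) (iter-* v eqb))

    iter-closed : (P : Pred A 0ℓ) → (∀ {x} → P x → P (f x)) → ∀ n {x} → P x → P (iter f n x)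
    iter-closed P closed zero    Px = Px
    iter-closed P closed (suc n) Px = closed (iter-closed P closed n Px)

    module _ (f-injective : ∀ {x y} → f x ≡ f y → x ≡ y) where

      iter-cancel : ∀ i {l x} → iter f i x ≡ iter f (i + l) x → iter f l x ≡ x
      iter-cancel zero    eq = sym eq
      iter-cancel (suc i) eq = iter-cancel i (f-injective eq)

      private
        -- Two equal iterates among the first `r` give a period between 0 and `r`. It is coprime to
        -- the period `r ^ k`, which forces `x` to be fixed.
        collision : ∀ {r} k {x} → Prime r → iter f (r ^ k) x ≡ x → (i j : Fin r) → toℕ i < toℕ j →
                    iter f (toℕ i) x ≡ iter f (toℕ j) x → f x ≡ x
        collision k {x} pr period i j i<j eq = iter-coprime
          (<prime⇒coprime-^ k pr (ℕ.m<n⇒0<n∸m i<j) (ℕ.≤-<-trans (ℕ.m∸n≤m (toℕ j) (toℕ i)) (Fin.toℕ<n j)))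
          (iter-cancel (toℕ i) (trans eq (cong (λ e → iter f e x) (sym (ℕ.m+[n∸m]≡n (ℕ.<⇒≤ i<j))))))
          period

      iter-injective : ∀ {r} k {x} → Prime r → iter f (r ^ k) x ≡ x → f x ≢ x →
                       ∀ {i j : Fin r} → iter f (toℕ i) x ≡ iter f (toℕ j) x → i ≡ j
      iter-injective k pr period moved {i} {j} eq with ℕ.<-cmp (toℕ i) (toℕ j)
      ... | tri< i<j _ _ = ⊥-elim (moved (collision k pr period i j i<j eq))
      ... | tri≈ _ i≡j _ = Fin.toℕ-injective i≡j
      ... | tri> _ _ j<i = ⊥-elim (moved (collision k pr period j i j<i (sym eq)))

-- Used in the contrapositive: a map of `r`-power order fixes every point of an invariant set with
-- fewer than `r` elements.
moved-orbit-≤ : ∀ {n r} {P : Pred (Fin n) 0ℓ} (f : Fin n → Fin n) (f-injective : ∀ {x y} → f x ≡ f y → x ≡ y) →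
                (P? : Decidable P) → (∀ {x} → P x → P (f x)) → Prime r →
                ∀ k {x} → P x → iter f (r ^ k) x ≡ x → f x ≢ x → r ≤ # P?
moved-orbit-≤ {P = P} f f-inj P? closed pr k {x} Px period moved =
  #-family P? (λ i → iter f (toℕ i) x) (λ i → iter-closed f P closed (toℕ i) Px)
    (iter-injective f f-inj k pr period moved)

-- As `r` is prime, every point of the set lies on a cycle of length exactly `r`. The relation of
-- lying on the same cycle bounds the exponent by `r`, which keeps it decidable.
fixed-point-free⇒∣ : ∀ {n r} {P : Pred (Fin n) 0ℓ} (f : Fin n → Fin n) → Prime r → (∀ x → iter f r x ≡ x) →
                     (P? : Decidable P) → (∀ {x} → P x → P (f x)) → (∀ {x} → P x → f x ≢ x) → r ∣ # P?
fixed-point-free⇒∣ {n} {r} {P} f pr period P? closed free =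
  #-classes R-isEquivalence R? P? R-closed r size
  where
  instance _ = prime⇒nonZero pr
  R : Fin n → Fin n → Set
  R x y = ∃ λ (i : Fin r) → iter f (toℕ i) x ≡ y
  R? : ∀ x y → Dec (R x y)
  R? x y = any? (λ i → iter f (toℕ i) x Fin.≟ y)
  iter-% : ∀ m x → iter f m x ≡ iter f (m % r) x
  iter-% m x = begin
    iter f m x                            ≡⟨ cong (λ e → iter f e x) (m≡m%n+[m/n]*n m r) ⟩
    iter f (m % r + m / r * r) x          ≡⟨ iter-+ f (m % r) (m / r * r) x ⟩
    iter f (m % r) (iter f (m / r * r) x) ≡⟨ cong (iter f (m % r)) (iter-* f (m / r) (period x)) ⟩
    iter f (m % r) x                      ∎
    where open ≡-Reasoning
  R-intro : ∀ m {x y} → iter f m x ≡ y → R x y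
  R-intro m {x} eq = fromℕ< (m%n<n m r) ,
    trans (cong (λ e → iter f e x) (Fin.toℕ-fromℕ< (m%n<n m r))) (trans (sym (iter-% m x)) eq)
  R-isEquivalence : IsEquivalence R
  R-isEquivalence = record
    { refl  = R-intro 0 refl
    ; sym   = λ { {x} (i , refl) → R-intro (r ∸ toℕ i)
                (trans (sym (iter-+ f (r ∸ toℕ i) (toℕ i) x))
                  (trans (cong (λ e → iter f e x) (ℕ.m∸n+n≡m (ℕ.<⇒≤ (Fin.toℕ<n i)))) (period x))) }
    ; trans = λ { {x} (i , refl) (j , refl) → R-intro (toℕ j + toℕ i) (iter-+ f (toℕ j) (toℕ i) x) } }
  R-closed : ∀ {x y} → R x y → P x → P y
  R-closed (i , refl) Px = iter-closed f P closed (toℕ i) Px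
  1+r-1 : suc (r ∸ 1) ≡ r
  1+r-1 = ℕ.m+[n∸m]≡n (prime>0 pr)
  -- The iterate `r ∸ 1` is inverse to `f`.
  f-injective : ∀ {x y} → f x ≡ f y → x ≡ y
  f-injective {x} {y} eq = trans (sym (undo x)) (trans (cong (iter f (r ∸ 1)) eq) (undo y))
    where
    undo : ∀ x → iter f (r ∸ 1) (f x) ≡ x
    undo x = trans (sym (iter-+ f (r ∸ 1) 1 x)) (trans (cong (λ e → iter f e x) (trans (ℕ.+-comm (r ∸ 1) 1) 1+r-1)) (period x))
  size : ∀ {x} → P x → # (R? x) ≡ r
  size {x} Px = ≤-antisym
    (#-cover (R? x) (λ i → iter f (toℕ i) x) (λ _ R → R))
    (#-family (R? x) (λ i → iter f (toℕ i) x) (λ i → i , refl)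
      (iter-injective f f-injective 1 pr (trans (cong (λ e → iter f e x) (ℕ.*-identityʳ r)) (period x)) (free Px)))

-- Finite groups

-- Elements are numbered by `Fin N` and compared by `≡`, so equality is decidable and the group can
-- be searched and counted.
module FiniteGroup {N : ℕ} {_∙_ : Op₂ (Fin N)} {ε : Fin N} {_⁻¹ : Op₁ (Fin N)}
                   (isGroup : IsGroup _≡_ _∙_ ε _⁻¹) where

  group : Group 0ℓ 0ℓ
  group = record { isGroup = isGroup }

  open IsGroup isGroup using (assoc; identityˡ; identityʳ; inverseˡ; inverseʳ)
  open GroupProperties group
  private module Multiple = Mult (Group.monoid group)
  open ≡-Reasoning

  infixl 9 _↑_
  _↑_ : Fin N → ℕ → Fin N
  x ↑ n = n Multiple.× x

  ↑-+ : ∀ x m n → x ↑ (m + n) ≡ (x ↑ m) ∙ (x ↑ n)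
  ↑-+ = Multiple.×-homo-+

  ↑-* : ∀ x m n → x ↑ (m * n) ≡ x ↑ n ↑ m
  ↑-* x m n = sym (Multiple.×-assocˡ x m n)

  ↑-*′ : ∀ x m n → x ↑ (m * n) ≡ x ↑ m ↑ n
  ↑-*′ x m n = trans (cong (x ↑_) (ℕ.*-comm m n)) (↑-* x n m)

  ε-↑ : ∀ n → ε ↑ n ≡ ε
  ε-↑ zero    = refl
  ε-↑ (suc n) = trans (identityˡ (ε ↑ n)) (ε-↑ n)

  ↑-∣ : ∀ {x m n} → m ∣ n → x ↑ m ≡ ε → x ↑ n ≡ ε
  ↑-∣ {x} {m} (divides q refl) eq = trans (↑-* x q m) (trans (cong (_↑ q) eq) (ε-↑ q))

  ↑-Bézout : ∀ {x m n} u v → 1 + v * n ≡ u * m → x ↑ n ≡ ε → x ≡ x ↑ m ↑ u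
  ↑-Bézout {x} {m} {n} u v eq x↑n = begin
    x              ≡⟨ identityʳ x ⟨
    x ∙ ε          ≡⟨ cong (x ∙_) (↑-∣ (n∣m*n v) x↑n) ⟨
    x ↑ (1 + v * n) ≡⟨ cong (x ↑_) eq ⟩
    x ↑ (u * m)    ≡⟨ ↑-* x u m ⟩
    x ↑ m ↑ u      ∎

  ↑-coprime : ∀ {x m n} → Coprime m n → x ↑ m ≡ ε → x ↑ n ≡ ε → x ≡ ε
  ↑-coprime {x} {m} {n} c x↑m x↑n with coprime-Bézout c
  ... | Bézout.+- u v eq = trans (↑-Bézout u v eq x↑n) (trans (cong (_↑ u) x↑m) (ε-↑ u))
  ... | Bézout.-+ u v eq = trans (↑-Bézout v u eq x↑m) (trans (cong (_↑ v) x↑n) (ε-↑ v))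

  Commute : Fin N → Fin N → Set
  Commute x y = x ∙ y ≡ y ∙ x

  commute-∙ : ∀ {x y z} → Commute x y → Commute x z → Commute x (y ∙ z)
  commute-∙ {x} {y} {z} xy xz = begin
    x ∙ (y ∙ z) ≡⟨ assoc x y z ⟨
    (x ∙ y) ∙ z ≡⟨ cong (_∙ z) xy ⟩
    (y ∙ x) ∙ z ≡⟨ assoc y x z ⟩
    y ∙ (x ∙ z) ≡⟨ cong (y ∙_) xz ⟩
    y ∙ (z ∙ x) ≡⟨ assoc y z x ⟨
    (y ∙ z) ∙ x ∎

  commute-↑ : ∀ {x y} n → Commute x y → Commute x (y ↑ n)
  commute-↑ {x} zero    xy = trans (identityʳ x) (sym (identityˡ x))
  commute-↑     (suc n) xy = commute-∙ xy (commute-↑ n xy)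

  ∙-↑ : ∀ {x y} n → Commute x y → (x ∙ y) ↑ n ≡ (x ↑ n) ∙ (y ↑ n)
  ∙-↑ zero xy = sym (identityˡ ε)
  ∙-↑ {x} {y} (suc n) xy = begin
    (x ∙ y) ∙ ((x ∙ y) ↑ n)        ≡⟨ cong ((x ∙ y) ∙_) (∙-↑ n xy) ⟩
    (x ∙ y) ∙ ((x ↑ n) ∙ (y ↑ n))  ≡⟨ assoc x y _ ⟩
    x ∙ (y ∙ ((x ↑ n) ∙ (y ↑ n)))  ≡⟨ cong (x ∙_) (assoc y (x ↑ n) (y ↑ n)) ⟨
    x ∙ ((y ∙ (x ↑ n)) ∙ (y ↑ n))  ≡⟨ cong (λ z → x ∙ (z ∙ (y ↑ n))) (commute-↑ n (sym xy)) ⟩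
    x ∙ (((x ↑ n) ∙ y) ∙ (y ↑ n))  ≡⟨ cong (x ∙_) (assoc (x ↑ n) y (y ↑ n)) ⟩
    x ∙ ((x ↑ n) ∙ (y ∙ (y ↑ n)))  ≡⟨ assoc x (x ↑ n) _ ⟨
    (x ∙ (x ↑ n)) ∙ (y ∙ (y ↑ n))  ∎

  conj : Fin N → Fin N → Fin N
  conj a x = (a ⁻¹) ∙ (x ∙ a)

  ⁻¹-∙-cancelˡ : ∀ a x → (a ⁻¹) ∙ (a ∙ x) ≡ x
  ⁻¹-∙-cancelˡ = \\-leftDividesʳ

  ∙-⁻¹-cancelˡ : ∀ a x → a ∙ ((a ⁻¹) ∙ x) ≡ x
  ∙-⁻¹-cancelˡ = \\-leftDividesˡ

  conj-def : ∀ a x → a ∙ conj a x ≡ x ∙ a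
  conj-def a x = ∙-⁻¹-cancelˡ a (x ∙ a)

  -- Most identities for conjugates below are proved by checking this defining equation, which keeps
  -- inverses out of the calculations.
  conj-unique : ∀ {a x y} → a ∙ y ≡ x ∙ a → y ≡ conj a x
  conj-unique {a} {x} {y} eq = trans (sym (⁻¹-∙-cancelˡ a y)) (cong ((a ⁻¹) ∙_) eq)

  conj-∙ : ∀ a x y → conj a (x ∙ y) ≡ conj a x ∙ conj a y
  conj-∙ a x y = sym (conj-unique (begin
    a ∙ (conj a x ∙ conj a y) ≡⟨ assoc a (conj a x) (conj a y) ⟨
    (a ∙ conj a x) ∙ conj a y ≡⟨ cong (_∙ conj a y) (conj-def a x) ⟩
    (x ∙ a) ∙ conj a y        ≡⟨ assoc x a (conj a y) ⟩
    x ∙ (a ∙ conj a y)        ≡⟨ cong (x ∙_) (conj-def a y) ⟩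
    x ∙ (y ∙ a)               ≡⟨ assoc x y a ⟨
    (x ∙ y) ∙ a               ∎))

  conj-ε : ∀ a → conj a ε ≡ ε
  conj-ε a = sym (conj-unique (trans (identityʳ a) (sym (identityˡ a))))

  conj-↑ : ∀ a x n → conj a (x ↑ n) ≡ conj a x ↑ n
  conj-↑ a x zero    = conj-ε a
  conj-↑ a x (suc n) = trans (conj-∙ a x (x ↑ n)) (cong (conj a x ∙_) (conj-↑ a x n))

  conj-⁻¹ : ∀ a x → conj a (x ⁻¹) ≡ conj a x ⁻¹
  conj-⁻¹ a x = inverseʳ-unique (conj a x) (conj a (x ⁻¹))
    (trans (sym (conj-∙ a x (x ⁻¹))) (trans (cong (conj a) (inverseʳ x)) (conj-ε a)))

  conj-conj : ∀ a b x → conj b (conj a x) ≡ conj (a ∙ b) x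
  conj-conj a b x = conj-unique (begin
    (a ∙ b) ∙ conj b (conj a x)   ≡⟨ assoc a b _ ⟩
    a ∙ (b ∙ conj b (conj a x))   ≡⟨ cong (a ∙_) (conj-def b (conj a x)) ⟩
    a ∙ (conj a x ∙ b)            ≡⟨ assoc a (conj a x) b ⟨
    (a ∙ conj a x) ∙ b            ≡⟨ cong (_∙ b) (conj-def a x) ⟩
    (x ∙ a) ∙ b                   ≡⟨ assoc x a b ⟩
    x ∙ (a ∙ b)                   ∎)

  conj-by-ε : ∀ x → conj ε x ≡ x
  conj-by-ε x = sym (conj-unique (trans (identityˡ x) (sym (identityʳ x))))

  conj-inverse : ∀ a x → conj a (conj (a ⁻¹) x) ≡ x
  conj-inverse a x = trans (conj-conj (a ⁻¹) a x) (trans (cong (λ b → conj b x) (inverseˡ a)) (conj-by-ε x))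

  conj-inverse′ : ∀ a x → conj (a ⁻¹) (conj a x) ≡ x
  conj-inverse′ a x = trans (conj-conj a (a ⁻¹) x) (trans (cong (λ b → conj b x) (inverseʳ a)) (conj-by-ε x))

  iter-conj : ∀ a n x → iter (conj a) n x ≡ conj (a ↑ n) x
  iter-conj a zero    x = sym (conj-by-ε x)
  iter-conj a (suc n) x = begin
    conj a (iter (conj a) n x)  ≡⟨ cong (conj a) (iter-conj a n x) ⟩
    conj a (conj (a ↑ n) x)     ≡⟨ conj-conj (a ↑ n) a x ⟩
    conj ((a ↑ n) ∙ a) x        ≡⟨ cong (λ b → conj b x) (sym (commute-↑ {a} n refl)) ⟩
    conj (a ∙ (a ↑ n)) x        ∎

  ⁻¹-↑ : ∀ x n → (x ⁻¹) ↑ n ≡ (x ↑ n) ⁻¹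
  ⁻¹-↑ x n = inverseʳ-unique (x ↑ n) ((x ⁻¹) ↑ n)
    (trans (sym (∙-↑ n (trans (inverseʳ x) (sym (inverseˡ x))))) (trans (cong (_↑ n) (inverseʳ x)) (ε-↑ n)))

  commute⇒conj : ∀ {a x} → Commute a x → conj a x ≡ x
  commute⇒conj ax = sym (conj-unique ax)

  conj⇒commute : ∀ {a x} → conj a x ≡ x → Commute a x
  conj⇒commute {a} {x} eq = trans (cong (a ∙_) (sym eq)) (conj-def a x)

  commute-conj : ∀ a {x y} → Commute x y → Commute (conj a x) (conj a y)
  commute-conj a {x} {y} xy = trans (sym (conj-∙ a x y)) (trans (cong (conj a) xy) (conj-∙ a y x))

  ⟦_,_⟧ : Fin N → Fin N → Fin N
  ⟦ x , y ⟧ = (x ⁻¹) ∙ ((y ⁻¹) ∙ (x ∙ y))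

  commutator-def : ∀ x y → x ∙ y ≡ y ∙ (x ∙ ⟦ x , y ⟧)
  commutator-def x y = begin
    x ∙ y                        ≡⟨ ∙-⁻¹-cancelˡ y (x ∙ y) ⟨
    y ∙ ((y ⁻¹) ∙ (x ∙ y))       ≡⟨ cong (y ∙_) (∙-⁻¹-cancelˡ x _) ⟨
    y ∙ (x ∙ ⟦ x , y ⟧)          ∎

  conj-commutator : ∀ x y → conj y x ≡ x ∙ ⟦ x , y ⟧
  conj-commutator x y = sym (conj-unique (sym (commutator-def x y)))

  ⟦⟧≡ε⇒commute : ∀ {x y} → ⟦ x , y ⟧ ≡ ε → Commute x y
  ⟦⟧≡ε⇒commute {x} {y} eq = trans (commutator-def x y) (cong (y ∙_) (trans (cong (x ∙_) eq) (identityʳ x)))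

  -- In this form the commutator visibly lies in every normal subgroup that contains `y`.
  ⟦⟧-as-conj : ∀ x y → ⟦ x , y ⟧ ≡ (conj x y ⁻¹) ∙ y
  ⟦⟧-as-conj x y = begin
    (x ⁻¹) ∙ ((y ⁻¹) ∙ (x ∙ y))  ≡⟨ cong ((x ⁻¹) ∙_) (sym (assoc (y ⁻¹) x y)) ⟩
    (x ⁻¹) ∙ (((y ⁻¹) ∙ x) ∙ y)  ≡⟨ sym (assoc (x ⁻¹) ((y ⁻¹) ∙ x) y) ⟩
    conj x (y ⁻¹) ∙ y            ≡⟨ cong (_∙ y) (conj-⁻¹ x y) ⟩
    (conj x y ⁻¹) ∙ y            ∎

  -- Power laws in nilpotency class 2, with `c` the commutator of `x` and `y`.

  module _ {x y c : Fin N} (xy : x ∙ y ≡ y ∙ (x ∙ c)) (xc : Commute x c) (yc : Commute y c) where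

    -- The law [x^n, y] = [x, y]^n in multiplied-out form.
    commutator-↑ : ∀ n → (x ↑ n) ∙ y ≡ y ∙ ((x ↑ n) ∙ (c ↑ n))
    commutator-↑ zero = trans (identityˡ y) (sym (trans (cong (y ∙_) (identityˡ ε)) (identityʳ y)))
    commutator-↑ (suc n) = begin
      (x ∙ (x ↑ n)) ∙ y                        ≡⟨ assoc x (x ↑ n) y ⟩
      x ∙ ((x ↑ n) ∙ y)                        ≡⟨ cong (x ∙_) (commutator-↑ n) ⟩
      x ∙ (y ∙ ((x ↑ n) ∙ (c ↑ n)))            ≡⟨ assoc x y _ ⟨
      (x ∙ y) ∙ ((x ↑ n) ∙ (c ↑ n))            ≡⟨ cong (_∙ ((x ↑ n) ∙ (c ↑ n))) xy ⟩
      (y ∙ (x ∙ c)) ∙ ((x ↑ n) ∙ (c ↑ n))      ≡⟨ assoc y (x ∙ c) _ ⟩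
      y ∙ ((x ∙ c) ∙ ((x ↑ n) ∙ (c ↑ n)))      ≡⟨ cong (λ z → y ∙ ((x ∙ c) ∙ z)) (∙-↑ n xc) ⟨
      y ∙ ((x ∙ c) ∙ ((x ∙ c) ↑ n))            ≡⟨ cong (y ∙_) (∙-↑ (suc n) xc) ⟩
      y ∙ ((x ∙ (x ↑ n)) ∙ (c ∙ (c ↑ n)))      ∎

    -- The recursion makes `t` equal to n(n-1)/2. Only its existence is recorded, because later it
    -- matters only that the correction is a power of `c`.
    product-↑ : ∀ n → ∃ λ t → (y ∙ x) ↑ n ≡ (y ↑ n) ∙ ((x ↑ n) ∙ (c ↑ t))
    product-↑ zero = 0 , sym (trans (identityˡ _) (identityˡ ε))
    product-↑ (suc n) with product-↑ n
    ... | t , eq = n + t , (begin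
      (y ∙ x) ∙ ((y ∙ x) ↑ n)                               ≡⟨ shift ⟩
      ((y ∙ x) ↑ n) ∙ (y ∙ x)                               ≡⟨ cong (_∙ (y ∙ x)) eq ⟩
      ((y ↑ n) ∙ ((x ↑ n) ∙ (c ↑ t))) ∙ (y ∙ x)             ≡⟨ assoc (y ↑ n) _ (y ∙ x) ⟩
      (y ↑ n) ∙ (((x ↑ n) ∙ (c ↑ t)) ∙ (y ∙ x))             ≡⟨ cong ((y ↑ n) ∙_) (assoc (x ↑ n) (c ↑ t) (y ∙ x)) ⟩
      (y ↑ n) ∙ ((x ↑ n) ∙ ((c ↑ t) ∙ (y ∙ x)))             ≡⟨ cong (λ z → (y ↑ n) ∙ ((x ↑ n) ∙ z)) central ⟩
      (y ↑ n) ∙ ((x ↑ n) ∙ ((y ∙ x) ∙ (c ↑ t)))             ≡⟨ cong (λ z → (y ↑ n) ∙ ((x ↑ n) ∙ z)) (assoc y x (c ↑ t)) ⟩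
      (y ↑ n) ∙ ((x ↑ n) ∙ (y ∙ (x ∙ (c ↑ t))))             ≡⟨ cong ((y ↑ n) ∙_) (assoc (x ↑ n) y _) ⟨
      (y ↑ n) ∙ (((x ↑ n) ∙ y) ∙ (x ∙ (c ↑ t)))             ≡⟨ cong (λ z → (y ↑ n) ∙ (z ∙ (x ∙ (c ↑ t)))) (commutator-↑ n) ⟩
      (y ↑ n) ∙ ((y ∙ ((x ↑ n) ∙ (c ↑ n))) ∙ (x ∙ (c ↑ t))) ≡⟨ cong ((y ↑ n) ∙_) (assoc y _ _) ⟩
      (y ↑ n) ∙ (y ∙ (((x ↑ n) ∙ (c ↑ n)) ∙ (x ∙ (c ↑ t)))) ≡⟨ assoc (y ↑ n) y _ ⟨
      ((y ↑ n) ∙ y) ∙ (((x ↑ n) ∙ (c ↑ n)) ∙ (x ∙ (c ↑ t))) ≡⟨ cong₂ _∙_ (sym (commute-↑ {y} n refl)) regroup ⟩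
      (y ∙ (y ↑ n)) ∙ ((x ∙ (x ↑ n)) ∙ (c ↑ (n + t)))       ∎)
      where
      shift : (y ∙ x) ∙ ((y ∙ x) ↑ n) ≡ ((y ∙ x) ↑ n) ∙ (y ∙ x)
      shift = commute-↑ {y ∙ x} n refl
      central : Commute (c ↑ t) (y ∙ x)
      central = sym (commute-↑ t (sym (commute-∙ (sym yc) (sym xc))))
      regroup : ((x ↑ n) ∙ (c ↑ n)) ∙ (x ∙ (c ↑ t)) ≡ (x ∙ (x ↑ n)) ∙ (c ↑ (n + t))
      regroup = begin
        ((x ↑ n) ∙ (c ↑ n)) ∙ (x ∙ (c ↑ t)) ≡⟨ assoc (x ↑ n) (c ↑ n) _ ⟩
        (x ↑ n) ∙ ((c ↑ n) ∙ (x ∙ (c ↑ t))) ≡⟨ cong ((x ↑ n) ∙_) (assoc (c ↑ n) x (c ↑ t)) ⟨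
        (x ↑ n) ∙ (((c ↑ n) ∙ x) ∙ (c ↑ t)) ≡⟨ cong (λ z → (x ↑ n) ∙ (z ∙ (c ↑ t))) (sym (commute-↑ n xc)) ⟩
        (x ↑ n) ∙ ((x ∙ (c ↑ n)) ∙ (c ↑ t)) ≡⟨ cong ((x ↑ n) ∙_) (assoc x (c ↑ n) (c ↑ t)) ⟩
        (x ↑ n) ∙ (x ∙ ((c ↑ n) ∙ (c ↑ t))) ≡⟨ assoc (x ↑ n) x _ ⟨
        ((x ↑ n) ∙ x) ∙ ((c ↑ n) ∙ (c ↑ t)) ≡⟨ cong₂ _∙_ (sym (commute-↑ {x} n refl)) (sym (↑-+ c n t)) ⟩
        (x ∙ (x ↑ n)) ∙ (c ↑ (n + t))       ∎

    -- Here `c ↑ m` is the commutator of `x ↑ m` with `y`, which is trivial.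
    commutator-exponent : ∀ {m} → x ↑ m ≡ ε → c ↑ m ≡ ε
    commutator-exponent {m} x↑m = identityʳ-unique′ (begin
      y                            ≡⟨ identityˡ y ⟨
      ε ∙ y                        ≡⟨ cong (_∙ y) x↑m ⟨
      (x ↑ m) ∙ y                  ≡⟨ commutator-↑ m ⟩
      y ∙ ((x ↑ m) ∙ (c ↑ m))      ≡⟨ cong (λ z → y ∙ (z ∙ (c ↑ m))) x↑m ⟩
      y ∙ (ε ∙ (c ↑ m))            ≡⟨ cong (y ∙_) (identityˡ (c ↑ m)) ⟩
      y ∙ (c ↑ m)                  ∎)
      where
      identityʳ-unique′ : ∀ {a b} → a ≡ a ∙ b → b ≡ ε
      identityʳ-unique′ {a} {b} eq = trans (sym (⁻¹-∙-cancelˡ a b)) (trans (cong ((a ⁻¹) ∙_) (sym eq)) (inverseˡ a))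

    -- The `m`-th power of the product is a power of `c`, which a further `m`-th power kills. The
    -- exponent `m * m` is good enough when `m` is a prime power and only that property has to
    -- survive.
    product-exponent : ∀ {m} → x ↑ m ≡ ε → y ↑ m ≡ ε → (y ∙ x) ↑ (m * m) ≡ ε
    product-exponent {m} x↑m y↑m with product-↑ m
    ... | t , eq = begin
      (y ∙ x) ↑ (m * m)                        ≡⟨ ↑-* (y ∙ x) m m ⟩
      (y ∙ x) ↑ m ↑ m                          ≡⟨ cong (_↑ m) eq ⟩
      ((y ↑ m) ∙ ((x ↑ m) ∙ (c ↑ t))) ↑ m      ≡⟨ cong₂ (λ a b → (a ∙ (b ∙ (c ↑ t))) ↑ m) y↑m x↑m ⟩
      (ε ∙ (ε ∙ (c ↑ t))) ↑ m                  ≡⟨ cong (_↑ m) (trans (identityˡ _) (identityˡ _)) ⟩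
      c ↑ t ↑ m                                ≡⟨ ↑-*′ c t m ⟨
      c ↑ (t * m)                              ≡⟨ ↑-∣ (n∣m*n t) (commutator-exponent {m} x↑m) ⟩
      ε                                        ∎

  -- Subgroups, tuples of elements and Cauchy's theorem.

  record Subgroup (H : Pred (Fin N) 0ℓ) : Set where
    field
      ε∈        : H ε
      ∙-closed  : ∀ {x y} → H x → H y → H (x ∙ y)
      ⁻¹-closed : ∀ {x} → H x → H (x ⁻¹)

    ↑-closed : ∀ {x} n → H x → H (x ↑ n)
    ↑-closed zero    Hx = ε∈
    ↑-closed (suc n) Hx = ∙-closed Hx (↑-closed n Hx)

  record NormalSubgroup (H : Pred (Fin N) 0ℓ) : Set where
    field
      subgroup    : Subgroup H
      conj-closed : ∀ {x} a → H x → H (conj a x)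
    open Subgroup subgroup public

  private
    -- Tuples are coded as numbers so that counting in `Fin` applies to sets of tuples.
    decode : ∀ k → Fin (N ^ k) → Vec (Fin N) k
    decode zero    c = []
    decode (suc k) c = proj₁ (remQuot {N} (N ^ k) c) ∷ decode k (proj₂ (remQuot {N} (N ^ k) c))

    encode : ∀ {k} → Vec (Fin N) k → Fin (N ^ k)
    encode []       = zero
    encode (x ∷ xs) = combine x (encode xs)

    decode-encode : ∀ {k} (xs : Vec (Fin N) k) → decode k (encode xs) ≡ xs
    decode-encode [] = refl
    decode-encode {suc k} (x ∷ xs) = cong₂ _∷_
      (cong proj₁ (Fin.remQuot-combine x (encode xs)))
      (trans (cong (decode k ∘ proj₂) (Fin.remQuot-combine x (encode xs))) (decode-encode xs))

    encode-decode : ∀ k (c : Fin (N ^ k)) → encode (decode k c) ≡ c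
    encode-decode zero    zero = refl
    encode-decode (suc k) c = trans
      (cong (combine (proj₁ (remQuot {N} (N ^ k) c))) (encode-decode k _))
      (Fin.combine-remQuot {N} (N ^ k) c)

    rotate : ∀ {k} → Vec (Fin N) (suc k) → Vec (Fin N) (suc k)
    rotate (x ∷ xs) = xs ∷ʳ x

    rotateList : List (Fin N) → List (Fin N)
    rotateList []       = []
    rotateList (x ∷ xs) = xs List.++ (x ∷ [])

    toList-rotate : ∀ {k} (xs : Vec (Fin N) (suc k)) → toList (rotate xs) ≡ rotateList (toList xs)
    toList-rotate (x ∷ xs) = Vec.toList-∷ʳ x xs

    -- Stated for lists, where the induction can shift entries from `xs` to `ys` without casts
    -- between lengths; empty `ys` gives a full turn.
    iter-rotateList : ∀ xs ys → iter rotateList (List.length xs) (xs List.++ ys) ≡ ys List.++ xs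
    iter-rotateList [] ys = sym (List.++-identityʳ ys)
    iter-rotateList (x ∷ xs) ys = begin
      rotateList (iter rotateList (List.length xs) (x ∷ xs List.++ ys))
        ≡⟨ iter-suc rotateList (List.length xs) (x ∷ xs List.++ ys) ⟩
      iter rotateList (List.length xs) ((xs List.++ ys) List.++ (x ∷ []))
        ≡⟨ cong (iter rotateList (List.length xs)) (List.++-assoc xs ys (x ∷ [])) ⟩
      iter rotateList (List.length xs) (xs List.++ (ys List.++ (x ∷ [])))
        ≡⟨ iter-rotateList xs (ys List.++ (x ∷ [])) ⟩
      (ys List.++ (x ∷ [])) List.++ xs
        ≡⟨ List.++-assoc ys (x ∷ []) xs ⟩
      ys List.++ (x ∷ xs) ∎

    toList-iter : ∀ {k} n (xs : Vec (Fin N) (suc k)) → toList (iter rotate n xs) ≡ iter rotateList n (toList xs)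
    toList-iter zero    xs = refl
    toList-iter (suc n) xs = trans (toList-rotate (iter rotate n xs)) (cong rotateList (toList-iter n xs))

    iter-rotate : ∀ {k} (xs : Vec (Fin N) (suc k)) → iter rotate (suc k) xs ≡ xs
    iter-rotate {k} xs = trans (sym (Vec.cast-is-id refl _)) (Vec.toList-injective refl _ _ (begin
      toList (iter rotate (suc k) xs)
        ≡⟨ toList-iter (suc k) xs ⟩
      iter rotateList (suc k) (toList xs)
        ≡⟨ cong₂ (iter rotateList) (Vec.length-toList xs) (List.++-identityʳ (toList xs)) ⟨
      iter rotateList (List.length (toList xs)) (toList xs List.++ [])
        ≡⟨ iter-rotateList (toList xs) [] ⟩
      toList xs ∎))

    rotate-fixed : ∀ {k x} (xs : Vec (Fin N) k) → xs ∷ʳ x ≡ x ∷ xs → xs ≡ replicate k x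
    rotate-fixed []       _  = refl
    rotate-fixed (y ∷ ys) eq with Vec.∷-injective eq
    ... | refl , eq′ = cong (y ∷_) (rotate-fixed ys eq′)

    prod : ∀ {k} → Vec (Fin N) k → Fin N
    prod []       = ε
    prod (x ∷ xs) = x ∙ prod xs

    prod-∷ʳ : ∀ {k} (xs : Vec (Fin N) k) x → prod (xs ∷ʳ x) ≡ prod xs ∙ x
    prod-∷ʳ []       x = trans (identityʳ x) (sym (identityˡ x))
    prod-∷ʳ (y ∷ ys) x = trans (cong (y ∙_) (prod-∷ʳ ys x)) (sym (assoc y (prod ys) x))

    prod-replicate : ∀ k x → prod (replicate k x) ≡ x ↑ k
    prod-replicate zero    x = refl
    prod-replicate (suc k) x = cong (x ∙_) (prod-replicate k x)

  ∙≡ε-swap : ∀ x y → x ∙ y ≡ ε → y ∙ x ≡ ε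
  ∙≡ε-swap x y eq = trans (cong (_∙ x) (inverseʳ-unique x y eq)) (inverseˡ x)

  -- McKay's proof: rotate the r-tuples of elements of H with product ε.
  cauchy : ∀ {H r} → Subgroup H → (H? : Decidable H) → Prime r → r ∣ # H? → ∃ λ x → H x × x ≢ ε × x ↑ r ≡ ε
  cauchy {r = 0} _ _ pr _ = contradiction pr ¬prime[0]
  cauchy {r = 1} _ _ pr _ = contradiction pr ¬prime[1]
  cauchy {H} {suc (suc k)} isSub H? pr r∣H
    with any? (λ x → H? x ×-dec (¬? (x Fin.≟ ε) ×-dec (x ↑ suc (suc k) Fin.≟ ε)))
  ... | yes ex = ex
  -- A tuple fixed by rotation is constant, so a non-identity entry would have order `r`. Without
  -- such an element only the tuple of `ε` is fixed, and `r` divides both the number of all tuples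
  -- and that number minus one.
  ... | no ¬ex = contradiction (∣1⇒≡1 (∣m+n∣m⇒∣n r∣#+1 r∣nonconstant)) λ ()
    where
    open Subgroup isSub
    r = suc (suc k)

    All? : ∀ k → Decidable (λ (c : Fin (N ^ k)) → All H (decode k c))
    All? k c = All.all? H? (decode k c)

    AllP? : Decidable (λ (c : Fin (N ^ r)) → All H (decode r c) × prod (decode r c) ≡ ε)
    AllP? c = All? r c ×-dec (prod (decode r c) Fin.≟ ε)

    prod-closed : ∀ {k} {xs : Vec (Fin N) k} → All H xs → H (prod xs)
    prod-closed []         = ε∈
    prod-closed (hx ∷ hxs) = ∙-closed hx (prod-closed hxs)

    tail : ∀ k → Fin (N ^ suc k) → Fin (N ^ k)
    tail k c = proj₂ (remQuot {N} (N ^ k) c)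

    combine-ext : ∀ k {c d : Fin (N ^ suc k)} → proj₁ (remQuot {N} (N ^ k) c) ≡ proj₁ (remQuot {N} (N ^ k) d) →
                  tail k c ≡ tail k d → c ≡ d
    combine-ext k {c} {d} eq₁ eq₂ = trans (sym (Fin.combine-remQuot {N} (N ^ k) c))
      (trans (cong₂ combine eq₁ eq₂) (Fin.combine-remQuot {N} (N ^ k) d))

    head-combine : ∀ k x (t : Fin (N ^ k)) → proj₁ (remQuot {N} (N ^ k) (combine x t)) ≡ x
    head-combine k x t = cong proj₁ (Fin.remQuot-combine x t)

    tail-combine : ∀ k x (t : Fin (N ^ k)) → tail k (combine x t) ≡ t
    tail-combine k x t = cong proj₂ (Fin.remQuot-combine x t)

    #-AllP : # AllP? ≡ # (All? (suc k))
    #-AllP = ≤-antisym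
      (#-injection AllP? (All? (suc k)) (tail (suc k)) (All.tail ∘ proj₁)
        (λ {c} {d} (_ , pc) (_ , pd) eq → combine-ext (suc k)
          (trans (inverseˡ-unique _ _ pc) (trans (cong (λ t → prod (decode (suc k) t) ⁻¹) eq) (sym (inverseˡ-unique _ _ pd)))) eq))
      (#-injection (All? (suc k)) AllP? prepend
        (λ {t} all → subst₂ (λ x s → All H (x ∷ decode (suc k) s) × x ∙ prod (decode (suc k) s) ≡ ε)
          (sym (head-combine (suc k) _ t)) (sym (tail-combine (suc k) (prod (decode (suc k) t) ⁻¹) t))
          (⁻¹-closed (prod-closed all) ∷ all , inverseˡ _))
        (λ {t} {s} _ _ eq → trans (sym (tail-combine (suc k) _ t)) (trans (cong (tail (suc k)) eq) (tail-combine (suc k) _ s))))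
      where
      prepend : Fin (N ^ suc k) → Fin (N ^ r)
      prepend t = combine (prod (decode (suc k) t) ⁻¹) t

    #-All-suc : ∀ k → # (All? (suc k)) ≡ # (All? k) * # H?
    #-All-suc k = #-fibres (tail k) (All? (suc k)) (All? k) (# H?) All.tail (λ {t} all → ≤-antisym
      (#-injection (λ c → All? (suc k) c ×-dec (tail k c Fin.≟ t)) H? (λ c → proj₁ (remQuot {N} (N ^ k) c))
        (All.head ∘ proj₁) (λ (_ , eq₁) (_ , eq₂) eq → combine-ext k eq (trans eq₁ (sym eq₂))))
      (#-injection H? (λ c → All? (suc k) c ×-dec (tail k c Fin.≟ t)) (λ x → combine x t)
        (λ {x} hx → subst₂ (λ y s → All H (y ∷ decode k s)) (sym (head-combine k x t)) (sym (tail-combine k x t)) (hx ∷ all)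
                  , tail-combine k x t)
        (λ {x} {y} _ _ eq → trans (sym (head-combine k x t)) (trans (cong (λ c → proj₁ (remQuot {N} (N ^ k) c)) eq) (head-combine k y t)))))

    -- The first entry is determined by the others, so there are as many tuples with product `ε` as
    -- tuples in `H` of length `r` minus one. This length is positive, so `# H?` is a factor of
    -- their number.
    r∣# : r ∣ # AllP?
    r∣# = ∣-trans r∣H (subst (# H? ∣_) (sym (trans #-AllP (#-All-suc k))) (n∣m*n (# (All? k))))

    constant : Fin (N ^ r)
    constant = encode (replicate r ε)

    all-constant : ∀ k → All H (replicate k ε)
    all-constant zero    = []
    all-constant (suc k) = ε∈ ∷ all-constant k

    constant∈ : All H (decode r constant) × prod (decode r constant) ≡ ε
    constant∈ = subst (λ xs → All H xs × prod xs ≡ ε) (sym (decode-encode (replicate r ε)))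
      (all-constant r , trans (prod-replicate r ε) (ε-↑ r))

    nonconstant? : Decidable (λ (c : Fin (N ^ r)) → (All H (decode r c) × prod (decode r c) ≡ ε) × c ≢ constant)
    nonconstant? c = AllP? c ×-dec ¬? (c Fin.≟ constant)

    rot : Fin (N ^ r) → Fin (N ^ r)
    rot c = encode (rotate (decode r c))

    iter-rot : ∀ n c → iter rot n c ≡ encode (iter rotate n (decode r c))
    iter-rot zero    c = sym (encode-decode r c)
    iter-rot (suc n) c = cong (encode ∘ rotate)
      (trans (cong (decode r) (iter-rot n c)) (decode-encode (iter rotate n (decode r c))))

    rot-period : ∀ c → iter rot r c ≡ c
    rot-period c = trans (iter-rot r c) (trans (cong encode (iter-rotate (decode r c))) (encode-decode r c))

    all-∷ʳ : ∀ {k x} {xs : Vec (Fin N) k} → All H xs → H x → All H (xs ∷ʳ x)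
    all-∷ʳ []         hx = hx ∷ []
    all-∷ʳ (hy ∷ hys) hx = hy ∷ all-∷ʳ hys hx

    rotate-closed : ∀ (xs : Vec (Fin N) r) → All H xs × prod xs ≡ ε → All H (rotate xs) × prod (rotate xs) ≡ ε
    rotate-closed (x ∷ xs) (hx ∷ hxs , eq) = all-∷ʳ hxs hx , trans (prod-∷ʳ xs x) (∙≡ε-swap x (prod xs) eq)

    fixed⇒constant : ∀ (xs : Vec (Fin N) r) → All H xs × prod xs ≡ ε → rotate xs ≡ xs → xs ≡ replicate r ε
    fixed⇒constant (x ∷ xs) (hx ∷ hxs , eq) fixed with x Fin.≟ ε
    ... | yes refl = cong (x ∷_) (rotate-fixed xs fixed)
    ... | no x≢ε = contradiction (x , hx , x≢ε ,
            trans (cong (x ∙_) (trans (sym (prod-replicate (suc k) x)) (cong prod (sym (rotate-fixed xs fixed))))) eq) ¬ex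

    rot-free : ∀ {c} → (All H (decode r c) × prod (decode r c) ≡ ε) × c ≢ constant → rot c ≢ c
    rot-free {c} (c∈ , c≢) eq = c≢ (trans (sym (encode-decode r c)) (cong encode
      (fixed⇒constant (decode r c) c∈ (trans (sym (decode-encode _)) (cong (decode r) eq)))))

    rot-closed : ∀ {c} → (All H (decode r c) × prod (decode r c) ≡ ε) × c ≢ constant →
                 (All H (decode r (rot c)) × prod (decode r (rot c)) ≡ ε) × rot c ≢ constant
    rot-closed {c} (c∈ , c≢) =
      subst (λ xs → All H xs × prod xs ≡ ε) (sym (decode-encode _)) (rotate-closed (decode r c) c∈) ,
      λ eq → c≢ (begin
        c                             ≡⟨ rot-period c ⟨
        iter rot r c                  ≡⟨ iter-suc rot (suc k) c ⟩
        iter rot (suc k) (rot c)      ≡⟨ cong (iter rot (suc k)) eq ⟩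
        iter rot (suc k) constant     ≡⟨ iter-fixed rot (suc k) rot-constant ⟩
        constant                      ∎)
      where
      replicate-∷ʳ : ∀ n (x : Fin N) → replicate n x ∷ʳ x ≡ x ∷ replicate n x
      replicate-∷ʳ zero    x = refl
      replicate-∷ʳ (suc n) x = cong (x ∷_) (replicate-∷ʳ n x)
      rot-constant : rot constant ≡ constant
      rot-constant = cong encode (trans (cong rotate (decode-encode (replicate r ε))) (replicate-∷ʳ (suc k) ε))

    r∣nonconstant : r ∣ # nonconstant?
    r∣nonconstant = fixed-point-free⇒∣ rot pr rot-period nonconstant? rot-closed rot-free

    r∣#+1 : r ∣ # nonconstant? + 1
    r∣#+1 = subst (r ∣_) (trans (#-remove AllP? constant constant∈) (ℕ.+-comm 1 _)) r∣#

-- Vertex-transitive actions on connected cubic graphs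

-- What the argument uses of the automorphism group, with its elements numbered. The action is on
-- the right, matching the left-to-right composition `_∘ₚ_`.
record CubicAction (n : ℕ) : Set where
  infixl 6 _▹_
  field
    N          : ℕ
    _∙_        : Op₂ (Fin N)
    ε          : Fin N
    _⁻¹        : Op₁ (Fin N)
    isGroup    : IsGroup _≡_ _∙_ ε _⁻¹
    _▹_        : Fin n → Fin N → Fin n
    ▹-ε        : ∀ v → v ▹ ε ≡ v
    ▹-∙        : ∀ v x y → v ▹ (x ∙ y) ≡ v ▹ x ▹ y
    faithful   : ∀ {x} → (∀ v → v ▹ x ≡ v) → x ≡ ε
    transitive : ∀ u v → ∃ λ a → u ▹ a ≡ v
    X          : Graph n
    X-▹        : ∀ u v a → X (u ▹ a) (v ▹ a) ≡ X u v
    X-sym      : ∀ u v → X u v ≡ X v u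
    connected  : Connected X
    cubic      : Cubic X

module CubicActionProperties {n : ℕ} (S : CubicAction n) where

  open CubicAction S public
  open IsGroup isGroup public using (assoc; identityˡ; identityʳ; inverseˡ; inverseʳ)
  open FiniteGroup isGroup public
  open ≡-Reasoning

  ▹-⁻¹ : ∀ v x → v ▹ x ▹ (x ⁻¹) ≡ v
  ▹-⁻¹ v x = trans (sym (▹-∙ v x (x ⁻¹))) (trans (cong (v ▹_) (inverseʳ x)) (▹-ε v))

  ▹-⁻¹′ : ∀ v x → v ▹ (x ⁻¹) ▹ x ≡ v
  ▹-⁻¹′ v x = trans (sym (▹-∙ v (x ⁻¹) x)) (trans (cong (v ▹_) (inverseˡ x)) (▹-ε v))

  ▹-injective : ∀ x {u v} → u ▹ x ≡ v ▹ x → u ≡ v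
  ▹-injective x {u} {v} eq = trans (sym (▹-⁻¹ u x)) (trans (cong (_▹ (x ⁻¹)) eq) (▹-⁻¹ v x))

  ▹-conj : ∀ v x a → v ▹ a ▹ conj a x ≡ v ▹ x ▹ a
  ▹-conj v x a = trans (sym (▹-∙ v a (conj a x))) (trans (cong (v ▹_) (conj-def a x)) (▹-∙ v x a))

  iter-▹ : ∀ x k v → iter (_▹ x) k v ≡ v ▹ (x ↑ k)
  iter-▹ x zero    v = sym (▹-ε v)
  iter-▹ x (suc k) v = begin
    iter (_▹ x) k v ▹ x  ≡⟨ cong (_▹ x) (iter-▹ x k v) ⟩
    v ▹ (x ↑ k) ▹ x      ≡⟨ ▹-∙ v (x ↑ k) x ⟨
    v ▹ ((x ↑ k) ∙ x)    ≡⟨ cong (v ▹_) (sym (commute-↑ {x} k refl)) ⟩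
    v ▹ (x ↑ suc k)      ∎

  iter-▹-period : ∀ {x} k v → x ↑ k ≡ ε → iter (_▹ x) k v ≡ v
  iter-▹-period {x} k v eq = trans (iter-▹ x k v) (trans (cong (v ▹_) eq) (▹-ε v))

  iter-conj-period : ∀ {x} k y → x ↑ k ≡ ε → iter (conj x) k y ≡ y
  iter-conj-period {x} k y eq = trans (iter-conj x k y) (trans (cong (λ z → conj z y) eq) (conj-by-ε y))

  fixes-⁻¹∙ : ∀ {v x y} → v ▹ x ≡ v ▹ y → v ▹ (x ∙ (y ⁻¹)) ≡ v
  fixes-⁻¹∙ {v} {x} {y} eq = trans (▹-∙ v x (y ⁻¹)) (trans (cong (_▹ (y ⁻¹)) eq) (▹-⁻¹ v y))

  Adj : Fin n → Fin n → Set
  Adj u v = X u v ≡ true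

  Adj? : ∀ u v → Dec (Adj u v)
  Adj? u v = X u v Bool.≟ true

  Adj-sym : ∀ {u v} → Adj u v → Adj v u
  Adj-sym {u} {v} uv = trans (X-sym v u) uv

  Adj-▹ : ∀ {u v} a → Adj u v → Adj (u ▹ a) (v ▹ a)
  Adj-▹ a uv = trans (X-▹ _ _ a) uv

  #-Adj : ∀ u → # (Adj? u) ≡ 3
  #-Adj u = trans (countTrue-cong (λ v → does-≟ (X u v))) (cubic u)
    where
    does-≟ : ∀ b → does (b Bool.≟ true) ≡ b
    does-≟ true  = refl
    does-≟ false = refl
    countTrue-cong : ∀ {k} {f g : Fin k → Bool} → (∀ i → f i ≡ g i) → countTrue f ≡ countTrue g
    countTrue-cong {zero}  f≗g = refl
    countTrue-cong {suc k} f≗g = cong₂ _+_ (cong (if_then 1 else 0) (f≗g 0F)) (countTrue-cong (f≗g ∘ suc))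

  record Neighbours (v a b c : Fin n) : Set where
    field
      va : Adj v a
      vb : Adj v b
      vc : Adj v c
      a≢b : a ≢ b
      a≢c : a ≢ c
      b≢c : b ≢ c
      only : ∀ {w} → Adj v w → w ≡ a ⊎ w ≡ b ⊎ w ≡ c

  neighbours : ∀ v → ∃ λ a → ∃ λ b → ∃ λ c → Neighbours v a b c
  neighbours v = elem 0F , elem 1F , elem 2F , record
    { va = elem∈ 0F ; vb = elem∈ 1F ; vc = elem∈ 2F
    ; a≢b = λ eq → contradiction (elem-injective eq) λ ()
    ; a≢c = λ eq → contradiction (elem-injective eq) λ ()
    ; b≢c = λ eq → contradiction (elem-injective eq) λ ()
    ; only = λ vw → which (index _ vw) (elem-index _ vw) }
    where
    open Enumeration (subst (Enumeration (Adj v)) (#-Adj v) (enumerate (Adj? v)))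
    which : ∀ {w} j → elem j ≡ w → w ≡ elem 0F ⊎ w ≡ elem 1F ⊎ w ≡ elem 2F
    which 0F eq = inj₁ (sym eq)
    which 1F eq = inj₂ (inj₁ (sym eq))
    which 2F eq = inj₂ (inj₂ (sym eq))

  reach-invariant : ∀ {P : Pred (Fin n) 0ℓ} {u} → P u → (∀ {v w} → P v → Adj v w → P w) → ∀ w → P w
  reach-invariant {P} {u} Pu P-step w = go (connected u w)
    where
    go : ∀ {w} → Reach X u w → P w
    go here        = Pu
    go (step r vw) = P-step (go r) vw

  fixes-neighbours⇒≡ε : ∀ {x u} → u ▹ x ≡ u → (∀ {v w} → v ▹ x ≡ v → Adj v w → w ▹ x ≡ w) → x ≡ ε
  fixes-neighbours⇒≡ε fixed fixed-step = faithful (reach-invariant fixed fixed-step)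

  -- Three neighbours are too few for a cycle of length `r`, so being fixed spreads along edges to
  -- the whole graph.
  large-prime-fixes⇒≡ε : ∀ {x v r} → Prime r → 3 < r → x ↑ r ≡ ε → v ▹ x ≡ v → x ≡ ε
  large-prime-fixes⇒≡ε {x} {v} {r} pr 3<r x↑r fixed = fixes-neighbours⇒≡ε fixed fixed-step
    where
    fixed-step : ∀ {v w} → v ▹ x ≡ v → Adj v w → w ▹ x ≡ w
    fixed-step {v} {w} fv vw with w ▹ x Fin.≟ w
    ... | yes fw = fw
    ... | no ¬fw = contradiction
      (subst (r ≤_) (#-Adj v) (moved-orbit-≤ (_▹ x) (▹-injective x) (Adj? v)
        (λ {w} vw → subst (λ u → Adj u (w ▹ x)) fv (Adj-▹ x vw)) pr 1 vw
        (iter-▹-period (r ^ 1) w (trans (cong (x ↑_) (ℕ.*-identityʳ r)) x↑r)) ¬fw))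
      (ℕ.<⇒≱ 3<r)

  -- At a fixed vertex with a fixed neighbour only two neighbours remain, and an element of odd
  -- order cannot interchange them. `FixedArc` carries the fixed neighbour along the induction.
  odd-prime-power-fixes-edge⇒≡ε : ∀ {x u v r} k → Prime r → 2 < r → x ↑ (r ^ k) ≡ ε →
                                  Adj u v → u ▹ x ≡ u → v ▹ x ≡ v → x ≡ ε
  odd-prime-power-fixes-edge⇒≡ε {x} {u} {v} {r} k pr 2<r x↑ uv fu fv =
    faithful (λ w → proj₁ (reach-invariant {FixedArc} {u} (fu , v , fv , uv) fixed-step w))
    where
    FixedArc : Pred (Fin n) 0ℓ
    FixedArc w = w ▹ x ≡ w × ∃ λ z → z ▹ x ≡ z × Adj w z
    fixed-step : ∀ {v w} → FixedArc v → Adj v w → FixedArc w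
    fixed-step {v} {w} (fv , z , fz , vz) vw with w ▹ x Fin.≟ w
    ... | yes fw = fw , v , fv , Adj-sym vw
    ... | no ¬fw = contradiction
      (moved-orbit-≤ (_▹ x) (▹-injective x) other?
        (λ {w} (vw , w≢z) → subst (λ u → Adj u (w ▹ x)) fv (Adj-▹ x vw) , λ eq → w≢z (▹-injective x (trans eq (sym fz))))
        pr k (vw , λ { refl → ¬fw fz }) (iter-▹-period (r ^ k) w x↑) ¬fw)
      (ℕ.<⇒≱ (subst (_< r) (ℕ.suc-injective (trans (sym (#-Adj v)) (#-remove (Adj? v) z vz))) 2<r))
      where
      other? : Decidable (λ w → Adj v w × w ≢ z)
      other? w = Adj? v w ×-dec ¬? (w Fin.≟ z)

  module _ {H : Pred (Fin N) 0ℓ} (H? : Decidable H) where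

    Orbit : Fin n → Fin n → Set
    Orbit u v = ∃ λ h → H h × u ▹ h ≡ v

    orbit? : ∀ u v → Dec (Orbit u v)
    orbit? u v = any? (λ h → H? h ×-dec (u ▹ h Fin.≟ v))

    stabiliser? : ∀ u → Decidable (λ h → H h × u ▹ h ≡ u)
    stabiliser? u h = H? h ×-dec (u ▹ h Fin.≟ u)

    -- The fibre of `u ▹_` over `u ▹ g` is the coset of the stabiliser through `g`; right
    -- multiplication by `g` and by its inverse compares the two.
    orbit-stabiliser : Subgroup H → ∀ u → # H? ≡ # (orbit? u) * # (stabiliser? u)
    orbit-stabiliser isSub u = #-fibres (u ▹_) H? (orbit? u) (# (stabiliser? u)) (λ {h} Hh → h , Hh , refl)
      λ { (g , Hg , refl) → ≤-antisym
        (#-injection (λ h → H? h ×-dec (u ▹ h Fin.≟ u ▹ g)) (stabiliser? u) (_∙ (g ⁻¹))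
          (λ (Hh , eq) → ∙-closed Hh (⁻¹-closed Hg) , fixes-⁻¹∙ eq)
          (λ _ _ eq → ∙-cancelʳ (g ⁻¹) _ _ eq))
        (#-injection (stabiliser? u) (λ h → H? h ×-dec (u ▹ h Fin.≟ u ▹ g)) (_∙ g)
          (λ {h} (Hh , eq) → ∙-closed Hh Hg , trans (▹-∙ u h g) (cong (_▹ g) eq))
          (λ _ _ eq → ∙-cancelʳ g _ _ eq)) }
      where
      open Subgroup isSub
      open import Algebra.Properties.Group group using (∙-cancelʳ)

    orbit-isEquivalence : Subgroup H → IsEquivalence Orbit
    orbit-isEquivalence isSub = record
      { refl  = λ {u} → ε , ε∈ , ▹-ε u
      ; sym   = λ { {u} (h , Hh , refl) → h ⁻¹ , ⁻¹-closed Hh , ▹-⁻¹ u h }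
      ; trans = λ { {u} (h , Hh , refl) (g , Hg , refl) → h ∙ g , ∙-closed Hh Hg , ▹-∙ u h g } }
      where open Subgroup isSub

    module _ (isNormal : NormalSubgroup H) where

      open NormalSubgroup isNormal

      orbit-▹ : ∀ {u v} a → Orbit u v → Orbit (u ▹ a) (v ▹ a)
      orbit-▹ {u} a (h , Hh , refl) = conj a h , conj-closed a Hh , ▹-conj u h a

      orbit-size : ∀ u v → # (orbit? u) ≡ # (orbit? v)
      orbit-size u v = ≤-antisym (≤-size u v) (≤-size v u)
        where
        ≤-size : ∀ u v → # (orbit? u) ≤ # (orbit? v)
        ≤-size u v with transitive u v
        ... | a , refl = #-injection (orbit? u) (orbit? v) (_▹ a) (orbit-▹ a) (λ _ _ → ▹-injective a)

      orbit-size-∣ : ∀ u → # (orbit? u) ∣ n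
      orbit-size-∣ u = subst (# (orbit? u) ∣_) (#-all {n} always? (λ _ → refl))
        (#-classes (orbit-isEquivalence subgroup) orbit? always? (λ _ _ → refl) (# (orbit? u)) (λ {v} _ → orbit-size v u))
        where
        always? : Decidable {A = Fin n} (λ _ → true ≡ true)
        always? _ = yes refl

      -- A prime divisor of the orbit size divides the order of `H`, so by Cauchy it is the order of
      -- an element, and element orders in `H` are powers of `r`.
      orbit-size-prime-power : ∀ {r} → Prime r → (∀ {x} → H x → ∃ λ k → x ↑ (r ^ k) ≡ ε) →
                               ∀ u → ∃ λ j → # (orbit? u) ≡ r ^ j
      orbit-size-prime-power {r} pr r-group u =
        only-prime-divisor⇒power (# (orbit? u)) (#>0 (orbit? u) u (ε , ε∈ , ▹-ε u)) only
        where
        only : ∀ {q} → Prime q → q ∣ # (orbit? u) → q ≡ r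
        only {q} pq q∣ with q ℕ.≟ r | cauchy subgroup H? pq
                            (∣-trans q∣ (subst (# (orbit? u) ∣_) (sym (orbit-stabiliser subgroup u)) (m∣m*n _)))
        ... | yes q≡r | _ = q≡r
        ... | no q≢r | x , Hx , x≢ε , x↑q with r-group Hx
        ...   | k , x↑r^k = contradiction (↑-coprime (coprime-^ k (primes-coprime pq pr q≢r)) x↑q x↑r^k) x≢ε

      orbit-size-bound : ∀ {r} i → Prime r → (∀ {x} → H x → ∃ λ k → x ↑ (r ^ k) ≡ ε) → ¬ (r ^ suc i ∣ n) →
                         ∀ u → # (orbit? u) ≤ r ^ i
      orbit-size-bound {r} i pr r-group r^i+1∤n u with orbit-size-prime-power pr r-group u
      ... | j , eq = subst (_≤ r ^ i) (sym eq)
        (power-divisor-bound {j = j} pr i (subst (_∣ n) eq (orbit-size-∣ u)) r^i+1∤n)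

-- Normal 2-subgroups and their blocks

-- The local shape of X(m,2). The blocks are the pairs of a vertex and its `mate`, as x_k^0 and
-- x_k^1; `rung` is the matching between two blocks, and `next` picks a vertex of the block that is
-- completely joined to the block of `v`. That choice is arbitrary, so the laws for `next` hold only
-- up to `~`.
record Ladder {n} (Adj : Fin n → Fin n → Set) : Set where
  field
    mate rung next : Fin n → Fin n

  infix 4 _~_
  _~_ : Fin n → Fin n → Set
  x ~ y = y ≡ x ⊎ y ≡ mate x

  field
    mate-mate : ∀ v → mate (mate v) ≡ v
    mate-≢    : ∀ v → mate v ≢ v
    rung-rung : ∀ v → rung (rung v) ≡ v
    rung-mate : ∀ v → rung (mate v) ≡ mate (rung v)
    next-mate : ∀ v → next (mate v) ~ next v
    next-next : ∀ v → next (next v) ~ v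
    rung-≁    : ∀ v → ¬ (v ~ rung v)
    next-≁    : ∀ v → ¬ (v ~ next v)
    adj-rung  : ∀ v → Adj v (rung v)
    adj-next  : ∀ v {x} → next v ~ x → Adj v x
    adj-only  : ∀ v {x} → Adj v x → x ≡ rung v ⊎ next v ~ x

module BlockStructure {n : ℕ} (S : CubicAction n) where

  open CubicActionProperties S

  swap₁₂ : ∀ {v a b c} → Neighbours v a b c → Neighbours v b a c
  swap₁₂ nb = record
    { va = vb ; vb = va ; vc = vc ; a≢b = a≢b ∘ sym ; a≢c = b≢c ; b≢c = a≢c
    ; only = λ vw → case (only vw) }
    where
    open Neighbours nb
    case : ∀ {w a b c : Fin n} → w ≡ a ⊎ w ≡ b ⊎ w ≡ c → w ≡ b ⊎ w ≡ a ⊎ w ≡ c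
    case (inj₁ eq)        = inj₂ (inj₁ eq)
    case (inj₂ (inj₁ eq)) = inj₁ eq
    case (inj₂ (inj₂ eq)) = inj₂ (inj₂ eq)

  swap₂₃ : ∀ {v a b c} → Neighbours v a b c → Neighbours v a c b
  swap₂₃ nb = record
    { va = va ; vb = vc ; vc = vb ; a≢b = a≢c ; a≢c = a≢b ; b≢c = b≢c ∘ sym
    ; only = λ vw → case (only vw) }
    where
    open Neighbours nb
    case : ∀ {w a b c : Fin n} → w ≡ a ⊎ w ≡ b ⊎ w ≡ c → w ≡ a ⊎ w ≡ c ⊎ w ≡ b
    case (inj₁ eq)        = inj₁ eq
    case (inj₂ (inj₁ eq)) = inj₂ (inj₂ eq)
    case (inj₂ (inj₂ eq)) = inj₂ (inj₁ eq)

  third-neighbour : ∀ {v x y} → Adj v x → Adj v y → x ≢ y → ∃ λ z → Neighbours v x y z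
  third-neighbour {v} {x} {y} vx vy x≢y with neighbours v
  ... | a , b , c , nb with Neighbours.only nb vx | Neighbours.only nb vy
  ... | inj₁ refl        | inj₁ refl        = contradiction refl x≢y
  ... | inj₁ refl        | inj₂ (inj₁ refl) = c , nb
  ... | inj₁ refl        | inj₂ (inj₂ refl) = b , swap₂₃ nb
  ... | inj₂ (inj₁ refl) | inj₁ refl        = c , swap₁₂ nb
  ... | inj₂ (inj₁ refl) | inj₂ (inj₁ refl) = contradiction refl x≢y
  ... | inj₂ (inj₁ refl) | inj₂ (inj₂ refl) = a , swap₂₃ (swap₁₂ nb)
  ... | inj₂ (inj₂ refl) | inj₁ refl        = b , swap₁₂ (swap₂₃ nb)
  ... | inj₂ (inj₂ refl) | inj₂ (inj₁ refl) = a , swap₁₂ (swap₂₃ (swap₁₂ nb))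
  ... | inj₂ (inj₂ refl) | inj₂ (inj₂ refl) = contradiction refl x≢y

  Neighbours-▹ : ∀ {v a b c} x → Neighbours v a b c → Neighbours (v ▹ x) (a ▹ x) (b ▹ x) (c ▹ x)
  Neighbours-▹ {v} {a} {b} {c} x nb = record
    { va = Adj-▹ x va ; vb = Adj-▹ x vb ; vc = Adj-▹ x vc
    ; a≢b = a≢b ∘ ▹-injective x ; a≢c = a≢c ∘ ▹-injective x ; b≢c = b≢c ∘ ▹-injective x
    ; only = λ {w} vw → case w (only (subst (λ u → Adj u (w ▹ (x ⁻¹))) (▹-⁻¹ v x) (Adj-▹ (x ⁻¹) vw))) }
    where
    open Neighbours nb
    move : ∀ w {u} → w ▹ (x ⁻¹) ≡ u → w ≡ u ▹ x
    move w eq = trans (sym (▹-⁻¹′ w x)) (cong (_▹ x) eq)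
    case : ∀ w → w ▹ (x ⁻¹) ≡ a ⊎ w ▹ (x ⁻¹) ≡ b ⊎ w ▹ (x ⁻¹) ≡ c → w ≡ a ▹ x ⊎ w ≡ b ▹ x ⊎ w ≡ c ▹ x
    case w (inj₁ eq)        = inj₁ (move w eq)
    case w (inj₂ (inj₁ eq)) = inj₂ (inj₁ (move w eq))
    case w (inj₂ (inj₂ eq)) = inj₂ (inj₂ (move w eq))

  module _ {Q : Pred (Fin N) 0ℓ} (Q? : Decidable Q) (isNormal : NormalSubgroup Q)
           {d : ℕ} (block-size : ∀ u → # (orbit? Q? u) ≡ d) where

    open NormalSubgroup isNormal

    R : Fin n → Fin n → Set
    R = Orbit Q?

    R? : ∀ u v → Dec (R u v)
    R? = orbit? Q?

    open IsEquivalence (orbit-isEquivalence Q? subgroup) using ()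
      renaming (refl to R-refl; sym to R-sym; trans to R-trans)

    R-▹ : ∀ {u v} a → R u v → R (u ▹ a) (v ▹ a)
    R-▹ = orbit-▹ Q? isNormal

    R-▹⁻ : ∀ {u v} a → R (u ▹ a) (v ▹ a) → R u v
    R-▹⁻ {u} {v} a r = subst₂ R (▹-⁻¹ u a) (▹-⁻¹ v a) (R-▹ (a ⁻¹) r)

    R-by : ∀ {h} u → Q h → R u (u ▹ h)
    R-by {h} u Qh = h , Qh , refl

    -- The blocks adjacent to a block can therefore be read off at any of its vertices.
    block-adjacent : ∀ {u v w} → R u v → Adj v w → ∃ λ w′ → Adj u w′ × R w′ w
    block-adjacent {u} {_} {w} (h , Qh , refl) vw =
      w ▹ (h ⁻¹) ,
      subst (λ x → Adj x (w ▹ (h ⁻¹))) (▹-⁻¹ u h) (Adj-▹ (h ⁻¹) vw) ,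
      subst (R (w ▹ (h ⁻¹))) (▹-⁻¹′ w h) (R-by _ Qh)

    NarrowAt : Fin n → Set
    NarrowAt v = ∃ λ z → ∀ {w} → Adj v w → R v w ⊎ R z w

    -- By transitivity every vertex has its neighbours in its own block and at most one other. If
    -- `z` is a neighbour of `u` outside the block of `u`, the two blocks point only at each other,
    -- and by connectedness they are everything.
    narrow⇒small : ∀ {u} → NarrowAt u → n ≤ d + d
    narrow⇒small {u} narrow = case (any? (λ w → Adj? u w ×-dec ¬? (R? u w)))
      where
      NarrowAt-▹ : ∀ v → NarrowAt v
      NarrowAt-▹ v with transitive u v
      ... | a , refl = z ▹ a , λ {w} vw →
        move w (proj₂ narrow (subst (λ x → Adj x (w ▹ (a ⁻¹))) (▹-⁻¹ u a) (Adj-▹ (a ⁻¹) vw)))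
        where
        z = proj₁ narrow
        move : ∀ w → R u (w ▹ (a ⁻¹)) ⊎ R z (w ▹ (a ⁻¹)) → R (u ▹ a) w ⊎ R (z ▹ a) w
        move w (inj₁ r) = inj₁ (subst (R (u ▹ a)) (▹-⁻¹′ w a) (R-▹ a r))
        move w (inj₂ r) = inj₂ (subst (R (z ▹ a)) (▹-⁻¹′ w a) (R-▹ a r))
      case : Dec (∃ λ w → Adj u w × ¬ R u w) → n ≤ d + d
      case (no ¬out) = subst (_≤ d + d) (#-all (R? u) (reach-invariant {R u} R-refl λ {v} {w} uv vw → closed uv vw))
        (ℕ.≤-trans (ℕ.≤-reflexive (block-size u)) (ℕ.m≤m+n d d))
        where
        closed : ∀ {v w} → R u v → Adj v w → R u w
        closed uv vw with block-adjacent uv vw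
        ... | w′ , uw′ , w′w = R-trans (decidable-stable (R? u w′) (λ ¬r → ¬out (w′ , uw′ , ¬r))) w′w
      case (yes (z , uz , ¬Ruz)) = subst (_≤ d + d)
        (#-all (λ w → R? u w ⊎-dec R? z w) (reach-invariant {λ w → R u w ⊎ R z w} (inj₁ R-refl) closed))
        (ℕ.≤-trans (#-⊎ (R? u) (R? z)) (ℕ.≤-reflexive (cong₂ _+_ (block-size u) (block-size z))))
        where
        near-u : ∀ {w} → Adj u w → R u w ⊎ R z w
        near-u {w} uw with proj₂ narrow uw | proj₂ narrow uz
        ... | inj₁ r  | _        = inj₁ r
        ... | inj₂ _  | inj₁ Ruz = contradiction Ruz ¬Ruz
        ... | inj₂ r  | inj₂ r′  = inj₂ (R-trans (R-sym r′) r)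
        near-z : ∀ {w} → Adj z w → R u w ⊎ R z w
        near-z {w} zw with proj₂ (NarrowAt-▹ z) zw | proj₂ (NarrowAt-▹ z) (Adj-sym uz)
        ... | inj₁ r  | _        = inj₂ r
        ... | inj₂ _  | inj₁ Rzu = contradiction (R-sym Rzu) ¬Ruz
        ... | inj₂ r  | inj₂ r′  = inj₁ (R-trans (R-sym r′) r)
        widen : ∀ {w w′} → R u w′ ⊎ R z w′ → R w′ w → R u w ⊎ R z w
        widen (inj₁ r) r′ = inj₁ (R-trans r r′)
        widen (inj₂ r) r′ = inj₂ (R-trans r r′)
        closed : ∀ {v w} → R u v ⊎ R z v → Adj v w → R u w ⊎ R z w
        closed (inj₁ uv) vw with block-adjacent uv vw
        ... | w′ , uw′ , w′w = widen (near-u uw′) w′w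
        closed (inj₂ zv) vw with block-adjacent zv vw
        ... | w′ , zw′ , w′w = widen (near-z zw′) w′w

    record Forked (v : Fin n) : Set where
      field
        a b c : Fin n
        nb    : Neighbours v a b c
        Rab   : R a b
        ¬Rac  : ¬ R a c
        ¬Rva  : ¬ R v a
        ¬Rvc  : ¬ R v c

    Forked-▹ : ∀ {u} x → Forked u → Forked (u ▹ x)
    Forked-▹ x fk = record
      { a = a ▹ x ; b = b ▹ x ; c = c ▹ x ; nb = Neighbours-▹ x nb
      ; Rab = R-▹ x Rab ; ¬Rac = ¬Rac ∘ R-▹⁻ x ; ¬Rva = ¬Rva ∘ R-▹⁻ x ; ¬Rvc = ¬Rvc ∘ R-▹⁻ x }
      where open Forked fk

    -- By connectedness `x` fixes some `v` and moves a neighbour `w` of it. Then `w` and `w ▹ x` are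
    -- two neighbours of `v` in one block, and any further coincidence among the blocks of `v` and
    -- its neighbours makes `v` narrow.
    moved-edge : ∀ {x u} → Q x → x ≢ ε → u ▹ x ≡ u → ∃ λ v → Forked v ⊎ NarrowAt v
    moved-edge {x} {u} Qx x≢ε fixed with any? (λ v → any? (λ w → (v ▹ x Fin.≟ v) ×-dec (Adj? v w ×-dec ¬? (w ▹ x Fin.≟ w))))
    ... | no ¬moved = contradiction
      (fixes-neighbours⇒≡ε fixed λ {v} {w} fv vw → decidable-stable (w ▹ x Fin.≟ w) λ ¬fw → ¬moved (v , w , fv , vw , ¬fw))
      x≢ε
    ... | yes (v , w , fv , vw , ¬fw) with third-neighbour vw (subst (λ z → Adj z (w ▹ x)) fv (Adj-▹ x vw)) (¬fw ∘ sym)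
    ... | c , nb = v , case (R? w c) (R? v w) (R? v c)
      where
      open Neighbours nb
      Rww : R w (w ▹ x)
      Rww = R-by w Qx
      case : Dec (R w c) → Dec (R v w) → Dec (R v c) → Forked v ⊎ NarrowAt v
      case (yes Rwc) _ _ = inj₂ (w , λ vz → near (only vz))
        where
        near : ∀ {z} → z ≡ w ⊎ z ≡ w ▹ x ⊎ z ≡ c → R v z ⊎ R w z
        near (inj₁ refl)        = inj₂ R-refl
        near (inj₂ (inj₁ refl)) = inj₂ Rww
        near (inj₂ (inj₂ refl)) = inj₂ Rwc
      case (no ¬Rwc) (yes Rvw) _ = inj₂ (c , λ vz → near (only vz))
        where
        near : ∀ {z} → z ≡ w ⊎ z ≡ w ▹ x ⊎ z ≡ c → R v z ⊎ R c z
        near (inj₁ refl)        = inj₁ Rvw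
        near (inj₂ (inj₁ refl)) = inj₁ (R-trans Rvw Rww)
        near (inj₂ (inj₂ refl)) = inj₂ R-refl
      case (no ¬Rwc) (no ¬Rvw) (yes Rvc) = inj₂ (w , λ vz → near (only vz))
        where
        near : ∀ {z} → z ≡ w ⊎ z ≡ w ▹ x ⊎ z ≡ c → R v z ⊎ R w z
        near (inj₁ refl)        = inj₂ R-refl
        near (inj₂ (inj₁ refl)) = inj₂ Rww
        near (inj₂ (inj₂ refl)) = inj₁ Rvc
      case (no ¬Rwc) (no ¬Rvw) (no ¬Rvc) = inj₁ record
        { nb = nb ; Rab = Rww ; ¬Rac = ¬Rwc ; ¬Rva = ¬Rvw ; ¬Rvc = ¬Rvc }

    module ForkedStructure (forked : ∀ v → Forked v) where

      private module F v = Forked (forked v)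

      -- Characterises the third neighbour without reference to the chosen `forked v`; this is what
      -- makes `rung` commute with the action.
      Lone : Fin n → Fin n → Set
      Lone v c = Adj v c × (∀ {w} → Adj v w → R c w → w ≡ c)

      rung : Fin n → Fin n
      rung v = F.c v

      rung-lone : ∀ v → Lone v (rung v)
      rung-lone v = vc , λ vw Rcw → case (only vw) Rcw
        where
        open Forked (forked v)
        open Neighbours nb
        case : ∀ {w} → w ≡ a ⊎ w ≡ b ⊎ w ≡ c → R c w → w ≡ c
        case (inj₁ refl)        Rca = contradiction (R-sym Rca) ¬Rac
        case (inj₂ (inj₁ refl)) Rcb = contradiction (R-trans Rab (R-sym Rcb)) ¬Rac
        case (inj₂ (inj₂ eq))   _   = eq

      lone-unique : ∀ {v c} → Lone v c → rung v ≡ c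
      lone-unique {v} {c′} (vc′ , lone) = case (only vc′)
        where
        open Forked (forked v)
        open Neighbours nb
        case : c′ ≡ a ⊎ c′ ≡ b ⊎ c′ ≡ c → c ≡ c′
        case (inj₁ refl)        = contradiction (sym (lone vb Rab)) a≢b
        case (inj₂ (inj₁ refl)) = contradiction (lone va (R-sym Rab)) a≢b
        case (inj₂ (inj₂ refl)) = refl

      rung-▹ : ∀ v x → rung (v ▹ x) ≡ rung v ▹ x
      rung-▹ v x = lone-unique (Adj-▹ x vc , λ {w} vw Rcw → trans (sym (▹-⁻¹′ w x)) (cong (_▹ x) (lone
        (subst (λ u → Adj u (w ▹ (x ⁻¹))) (▹-⁻¹ v x) (Adj-▹ (x ⁻¹) vw))
        (subst (λ u → R u (w ▹ (x ⁻¹))) (▹-⁻¹ (rung v) x) (R-▹ (x ⁻¹) Rcw)))))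
        where
        vc   = proj₁ (rung-lone v)
        lone : ∀ {w} → Adj v w → R (rung v) w → w ≡ rung v
        lone = proj₂ (rung-lone v)

      -- An equivariant self-map of a transitive set is onto, hence one-to-one.
      rung-injective : ∀ {u v} → rung u ≡ rung v → u ≡ v
      rung-injective = surjective⇒injective rung λ v → let a , eq = transitive (rung v) v in
        v ▹ a , trans (rung-▹ v a) eq

      R-rung : ∀ {u v} → R u v → R (rung u) (rung v)
      R-rung {u} (h , Qh , refl) = subst (R (rung u)) (sym (rung-▹ u h)) (R-by (rung u) Qh)

      adj-rung : ∀ v → Adj v (rung v)
      adj-rung v = proj₁ (rung-lone v)

      -- If `w` is a neighbour of `rung v` in the block of `v`, then `rung v` is a neighbour of `w`
      -- in the block of `rung w`, hence equal to `rung w`, and `w` is `v`. So `v` is the lone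
      -- neighbour of `rung v`.
      rung-rung : ∀ v → rung (rung v) ≡ v
      rung-rung v = lone-unique (Adj-sym (adj-rung v) , λ {w} yw Rvw →
        rung-injective (sym (proj₂ (rung-lone w) (Adj-sym yw) (R-sym (R-rung Rvw)))))

      -- `rung` induces an involution on the blocks that fixes none of them, so the unions of paired
      -- blocks partition the vertices. This excludes blocks of size 4 when 8 does not divide `n`.
      block-pairs : d + d ∣ n
      block-pairs = subst (d + d ∣_) (#-all {n} always? (λ _ → refl))
        (#-classes pair-isEquivalence pair? always? (λ _ _ → refl) (d + d) (λ {v} _ → size v))
        where
        always? : Decidable {A = Fin n} (λ v → v ≡ v)
        always? v = yes refl
        Pair : Fin n → Fin n → Set
        Pair u v = R u v ⊎ R (rung u) v
        pair? : ∀ u v → Dec (Pair u v)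
        pair? u v = R? u v ⊎-dec R? (rung u) v
        Pair-trans : ∀ {u v w} → Pair u v → Pair v w → Pair u w
        Pair-trans (inj₁ uv)  (inj₁ vw)  = inj₁ (R-trans uv vw)
        Pair-trans (inj₁ uv)  (inj₂ v′w) = inj₂ (R-trans (R-rung uv) v′w)
        Pair-trans (inj₂ u′v) (inj₁ vw)  = inj₂ (R-trans u′v vw)
        Pair-trans {u} (inj₂ u′v) (inj₂ v′w) = inj₁ (R-trans (subst (λ x → R x _) (rung-rung u) (R-rung u′v)) v′w)
        Pair-sym : ∀ {u v} → Pair u v → Pair v u
        Pair-sym (inj₁ uv)      = inj₁ (R-sym uv)
        Pair-sym {u} (inj₂ u′v) = inj₂ (R-sym (subst (λ x → R x _) (rung-rung u) (R-rung u′v)))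
        pair-isEquivalence : IsEquivalence Pair
        pair-isEquivalence = record { refl = inj₁ R-refl ; sym = Pair-sym ; trans = Pair-trans }
        size : ∀ v → # (pair? v) ≡ d + d
        size v = trans (#-⊎-disjoint (R? v) (R? (rung v)) λ vw v′w → F.¬Rvc v (R-trans vw (R-sym v′w)))
          (cong₂ _+_ (block-size v) (block-size (rung v)))

      module _ (d≡2 : d ≡ 2) where

        mate-of : ∀ v → ∃ λ w → R v w × w ≢ v × (∀ {x} → R v x → x ≡ v ⊎ x ≡ w)
        mate-of v = elem 0F , proj₁ (elem∈ 0F) , proj₂ (elem∈ 0F) , λ {x} vx → case x vx (x Fin.≟ v)
          where
          v? : Decidable (λ w → R v w × w ≢ v)
          v? w = R? v w ×-dec ¬? (w Fin.≟ v)
          #v? : # v? ≡ 1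
          #v? = ℕ.suc-injective (trans (sym (#-remove (R? v) v R-refl)) (trans (block-size v) d≡2))
          open Enumeration (subst (Enumeration (λ w → R v w × w ≢ v)) #v? (enumerate v?))
          case : ∀ x → R v x → Dec (x ≡ v) → x ≡ v ⊎ x ≡ elem 0F
          case x vx (yes eq)  = inj₁ eq
          case x vx (no x≢v) with index x (vx , x≢v) | elem-index x (vx , x≢v)
          ... | 0F | eq = inj₂ (sym eq)

        mate : Fin n → Fin n
        mate v = proj₁ (mate-of v)

        R-mate : ∀ v → R v (mate v)
        R-mate v = proj₁ (proj₂ (mate-of v))

        mate-≢ : ∀ v → mate v ≢ v
        mate-≢ v = proj₁ (proj₂ (proj₂ (mate-of v)))

        R⇒~ : ∀ {v x} → R v x → x ≡ v ⊎ x ≡ mate v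
        R⇒~ {v} = proj₂ (proj₂ (proj₂ (mate-of v)))

        ~⇒R : ∀ {v x} → x ≡ v ⊎ x ≡ mate v → R v x
        ~⇒R (inj₁ refl)     = R-refl
        ~⇒R {v} (inj₂ refl) = R-mate v

        other⇒mate : ∀ {v x} → R v x → x ≢ v → x ≡ mate v
        other⇒mate vx x≢v with R⇒~ vx
        ... | inj₁ eq = contradiction eq x≢v
        ... | inj₂ eq = eq

        next : Fin n → Fin n
        next v = F.a v

        adj-next : ∀ v {x} → R (next v) x → Adj v x
        adj-next v r with R⇒~ r
        ... | inj₁ refl = Neighbours.va (F.nb v)
        ... | inj₂ refl = subst (Adj v) (other⇒mate (F.Rab v) (Neighbours.a≢b (F.nb v) ∘ sym)) (Neighbours.vb (F.nb v))

        adj-only : ∀ v {x} → Adj v x → x ≡ rung v ⊎ R (next v) x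
        adj-only v vx with Neighbours.only (F.nb v) vx
        ... | inj₁ refl        = inj₂ R-refl
        ... | inj₂ (inj₁ refl) = inj₂ (F.Rab v)
        ... | inj₂ (inj₂ eq)   = inj₁ eq

        -- `next` is a choice inside a block and need not commute with the action, but its block
        -- does: the image of `next u` is a neighbour of `u ▹ h` outside the block of its rung.
        R-next : ∀ {u v} → R u v → R (next u) (next v)
        R-next {u} (h , Qh , refl) with adj-only (u ▹ h) (Adj-▹ h (adj-next u R-refl))
        ... | inj₁ eq = contradiction
          (R-trans (R-by (next u) Qh) (subst (λ z → R z (rung u)) (sym eq) (R-sym (R-rung (R-by u Qh))))) (F.¬Rac u)
        ... | inj₂ r  = R-trans (R-by (next u) Qh) (R-sym r)

        -- Otherwise `v` would be the rung of `next v`, so `next v` would be the rung of `v`.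
        R-next-next : ∀ v → R (next (next v)) v
        R-next-next v with adj-only (next v) (Adj-sym (adj-next v R-refl))
        ... | inj₁ eq = contradiction (subst (R (next v)) (trans (sym (rung-rung (next v))) (cong rung (sym eq))) R-refl) (F.¬Rac v)
        ... | inj₂ r  = r

        ladder : Ladder Adj
        ladder = record
          { mate = mate ; rung = rung ; next = next
          ; mate-mate = λ v → sym (other⇒mate (R-sym (R-mate v)) (mate-≢ v ∘ sym))
          ; mate-≢    = mate-≢
          ; rung-rung = rung-rung
          ; rung-mate = λ v → other⇒mate (R-rung (R-mate v)) (mate-≢ v ∘ rung-injective)
          ; next-mate = λ v → R⇒~ (R-next (R-sym (R-mate v)))
          ; next-next = λ v → R⇒~ (R-next-next v)
          ; rung-≁    = λ v → F.¬Rvc v ∘ ~⇒R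
          ; next-≁    = λ v → F.¬Rva v ∘ ~⇒R
          ; adj-rung  = adj-rung
          ; adj-next  = λ v → adj-next v ∘ ~⇒R
          ; adj-only  = λ v vx → only⇒~ v (adj-only v vx) }
          where
          only⇒~ : ∀ v {x} → x ≡ rung v ⊎ R (next v) x → x ≡ rung v ⊎ (x ≡ next v ⊎ x ≡ mate (next v))
          only⇒~ v (inj₁ eq) = inj₁ eq
          only⇒~ v (inj₂ r)  = inj₂ (R⇒~ r)

  normal-2-subgroup : {Q : Pred (Fin N) 0ℓ} (Q? : Decidable Q) → NormalSubgroup Q →
                      (∀ {x} → Q x → ∃ λ k → x ↑ (2 ^ k) ≡ ε) → 8 < n → ¬ (8 ∣ n) →
                      Ladder Adj ⊎ # Q? ≤ 4
  normal-2-subgroup {Q} Q? isNormal 2-group 8<n 8∤n with any? (λ x → Q? x ×-dec (¬? (x Fin.≟ ε) ×-dec any? (λ u → u ▹ x Fin.≟ u)))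
  -- Semiregular case: elements of `Q` that agree at `u₀` are equal, so `Q` is no larger than an
  -- orbit, whose size is a power of 2 dividing `n`.
  ... | no ¬fix = inj₂ (ℕ.≤-trans
      (#-injection Q? (orbit? Q? u₀) (u₀ ▹_) (λ {h} Qh → h , Qh , refl)
        (λ {x} {y} Qx Qy eq → x∙y⁻¹≈ε⇒x≈y x y (decidable-stable (_ Fin.≟ ε)
          λ ≢ε → ¬fix (x ∙ (y ⁻¹) , ∙-closed Qx (⁻¹-closed Qy) , ≢ε , u₀ , fixes-⁻¹∙ eq))))
      (orbit-size-bound Q? isNormal 2 prime[2] 2-group 8∤n u₀))
    where
    open NormalSubgroup isNormal
    open import Algebra.Properties.Group group using (x∙y⁻¹≈ε⇒x≈y)
    u₀ : Fin n
    u₀ = Fin.fromℕ< (ℕ.≤-<-trans z≤n 8<n)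
  ... | yes (x , Qx , x≢ε , u , fixed) = by-size (orbit-size-prime-power Q? isNormal prime[2] 2-group u)
    where
    open NormalSubgroup isNormal
    d = # (orbit? Q? u)
    size : ∀ v → # (orbit? Q? v) ≡ d
    size v = orbit-size Q? isNormal v u
    d≤4 : d ≤ 4
    d≤4 = orbit-size-bound Q? isNormal 2 prime[2] 2-group 8∤n u
    forked : ∀ v → Forked Q? isNormal size v
    forked v with moved-edge Q? isNormal size Qx x≢ε fixed
    ... | w , inj₂ narrow = contradiction
      (ℕ.≤-trans (narrow⇒small Q? isNormal size narrow) (ℕ.+-mono-≤ d≤4 d≤4)) (ℕ.<⇒≱ 8<n)
    ... | w , inj₁ fk with transitive w v
    ...   | a , refl = Forked-▹ Q? isNormal size a fk
    open ForkedStructure Q? isNormal size forked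
    by-size : (∃ λ j → d ≡ 2 ^ j) → Ladder Adj ⊎ # Q? ≤ 4
    -- One-point blocks would make `x` trivial, blocks of size 4 would pair off into sets of 8, and
    -- larger ones exceed the bound on `d`.
    by-size (0 , d≡1) = contradiction (faithful λ v → sym (unmoved v)) x≢ε
      where
      unmoved : ∀ v → v ≡ v ▹ x
      unmoved v = elems (#-remove (orbit? Q? v) v (ε , ε∈ , ▹-ε v))
        where
        elems : # (orbit? Q? v) ≡ suc _ → v ≡ v ▹ x
        elems eq = decidable-stable (v Fin.≟ v ▹ x) λ ≢ → contradiction
          (#>0 (λ w → orbit? Q? v w ×-dec ¬? (w Fin.≟ v)) (v ▹ x) ((x , Qx , refl) , ≢ ∘ sym))
          (ℕ.<⇒≱ (s≤s (ℕ.≤-reflexive (ℕ.suc-injective (trans (sym eq) (trans (size v) d≡1))))))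
    by-size (1 , d≡2) = inj₁ (ladder d≡2)
    by-size (2 , d≡4) = contradiction (subst (λ e → e + e ∣ n) d≡4 block-pairs) 8∤n
    by-size (suc (suc (suc j)) , d≡) = contradiction
      (ℕ.≤-trans (ℕ.^-monoʳ-≤ 2 {3} {3 + j} (s≤s (s≤s (s≤s z≤n)))) (ℕ.≤-trans (ℕ.≤-reflexive (sym d≡)) d≤4))
      (ℕ.<⇒≱ (ℕ.m<m+n 4 (s≤s z≤n)))

-- Recognising X(m,2)

module LadderCycle {m : ℕ} (X : Graph (4 * m)) (X-sym : ∀ u v → X u v ≡ X v u)
                   (connected : Connected X) (L : Ladder (λ u v → X u v ≡ true)) (v₀ : Fin (4 * m)) where

  open Ladder L

  -- Unlike `isEven`, this computes along the recursion that defines the walk.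
  even : ℕ → Bool
  even zero    = true
  even (suc k) = not (even k)

  isEven≡even : ∀ k → isEven m k ≡ even k
  isEven≡even zero          = refl
  isEven≡even (suc zero)    = refl
  isEven≡even (suc (suc k)) = trans (isEven≡even k) (sym (Bool.not-involutive (even k)))

  even-double : ∀ i k → even (i * 2 + k) ≡ even k
  even-double zero    k = refl
  even-double (suc i) k = trans (Bool.not-involutive (even (i * 2 + k))) (even-double i k)

  even[2m] : even (2 * m) ≡ true
  even[2m] = subst (λ k → even k ≡ true) (trans (ℕ.+-identityʳ (m * 2)) (ℕ.*-comm m 2)) (even-double m 0)

  even-pred : ∀ j {b} → even (suc j) ≡ b → even j ≡ not b
  even-pred j eq = trans (sym (Bool.not-involutive (even j))) (cong not eq)

  ~-refl : ∀ {x} → x ~ x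
  ~-refl = inj₁ refl

  ~-sym : ∀ {x y} → x ~ y → y ~ x
  ~-sym     (inj₁ refl) = inj₁ refl
  ~-sym {x} (inj₂ refl) = inj₂ (sym (mate-mate x))

  ~-trans : ∀ {x y z} → x ~ y → y ~ z → x ~ z
  ~-trans (inj₁ refl) yz          = yz
  ~-trans (inj₂ refl) (inj₁ refl) = inj₂ refl
  ~-trans {x} (inj₂ refl) (inj₂ refl) = inj₁ (mate-mate x)

  side : Bool → Fin (4 * m) → Fin (4 * m)
  side true  = rung
  side false = next

  side-cong : ∀ b {x y} → x ~ y → side b x ~ side b y
  side-cong true      (inj₁ refl) = ~-refl
  side-cong true  {x} (inj₂ refl) = inj₂ (rung-mate x)
  side-cong false     (inj₁ refl) = ~-refl
  side-cong false {x} (inj₂ refl) = ~-sym (next-mate x)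

  side-side : ∀ b x → side b (side b x) ~ x
  side-side true  x = inj₁ (sym (rung-rung x))
  side-side false x = next-next x

  side-≁ : ∀ b x → ¬ (x ~ side b x)
  side-≁ true  = rung-≁
  side-≁ false = next-≁

  -- A walk that alternates `rung` and `next`, starting with `rung`. Its term `a k` will play the
  -- role of x_k^0, with its mate as x_k^1.
  a : ℕ → Fin (4 * m)
  a zero    = v₀
  a (suc k) = side (even k) (a k)

  side-back : ∀ k → side (even k) (a (suc k)) ~ a k
  side-back k = side-side (even k) (a k)

  -- If a k ~ a l with k < l of different parity, then a (k + 1) ~ a (l - 1), so the two indices approach each other
  -- until they are consecutive.
  odd-distance-≁ : ∀ i k → ¬ (a k ~ a (suc (i * 2 + k)))
  odd-distance-≁ zero    k eq = side-≁ (even k) (a k) eq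
  odd-distance-≁ (suc i) k eq = odd-distance-≁ i (suc k) (subst (λ l → a (suc k) ~ a (suc l)) (sym (ℕ.+-suc (i * 2) k))
    (~-trans (side-cong (even k) eq)
      (subst (λ b → side b (a (suc l)) ~ a l) (even-double (suc i) k) (side-back l))))
    where
    l = suc (suc (i * 2 + k))

  -- Indices of equal parity step back along the same kind of edge, so both can be lowered together
  -- until the first is 0.
  even-distance : ∀ i k → a k ~ a (i * 2 + k) → a 0 ~ a (i * 2)
  even-distance i zero    eq = subst (λ l → a 0 ~ a l) (ℕ.+-identityʳ (i * 2)) eq
  even-distance i (suc k) eq = even-distance i k (~-trans (~-sym (side-back k)) (~-trans
    (side-cong (even k) (subst (λ l → a (suc k) ~ a l) (ℕ.+-suc (i * 2) k) eq))
    (subst (λ b → side b (a (suc (i * 2 + k))) ~ a (i * 2 + k)) (even-double i k) (side-back (i * 2 + k)))))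

  parity : ∀ l → ∃ λ i → l ≡ i * 2 ⊎ l ≡ suc (i * 2)
  parity zero    = 0 , inj₁ refl
  parity (suc l) with parity l
  ... | i , inj₁ refl = i , inj₂ refl
  ... | i , inj₂ refl = suc i , inj₁ refl

  vert : ℕ → ℕ → Fin (4 * m)
  vert k r = iter mate r (a k)

  ~⇒vert : ∀ k {x} → a k ~ x → ∃ λ (r : Fin 2) → vert k (toℕ r) ≡ x
  ~⇒vert k (inj₁ refl) = zero , refl
  ~⇒vert k (inj₂ refl) = suc zero , refl

  vert-~ : ∀ k r → a k ~ vert k r
  vert-~ k zero    = ~-refl
  vert-~ k (suc r) = ~-trans (vert-~ k r) (inj₂ refl)

  vert-injective : ∀ k (r s : Fin 2) → vert k (toℕ r) ≡ vert k (toℕ s) → r ≡ s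
  vert-injective k zero       zero       _  = refl
  vert-injective k zero       (suc zero) eq = contradiction (sym eq) (mate-≢ (a k))
  vert-injective k (suc zero) zero       eq = contradiction eq (mate-≢ (a k))
  vert-injective k (suc zero) (suc zero) _  = refl

  collision⇒period : ∀ {k l} → k < l → l ≤ 2 * m → a k ~ a l → ∃ λ h → 0 < h × h * 2 ≤ 2 * m × a 0 ~ a (h * 2)
  collision⇒period {k} {l} k<l l≤2m eq with parity (l ℕ.∸ k)
  ... | i , inj₂ d≡ = contradiction (subst (λ l → a k ~ a l) l≡ eq) (odd-distance-≁ i k)
    where
    l≡ : l ≡ suc (i * 2) + k
    l≡ = trans (sym (ℕ.m∸n+n≡m (ℕ.<⇒≤ k<l))) (cong (_+ k) d≡)
  ... | i , inj₁ d≡ = i , 0<i i d≡ , ℕ.≤-trans (ℕ.≤-reflexive (sym d≡)) (ℕ.≤-trans (ℕ.m∸n≤m l k) l≤2m) ,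
                      even-distance i k (subst (λ l → a k ~ a l) l≡ eq)
    where
    l≡ : l ≡ i * 2 + k
    l≡ = trans (sym (ℕ.m∸n+n≡m (ℕ.<⇒≤ k<l))) (cong (_+ k) d≡)
    0<i : ∀ i → l ℕ.∸ k ≡ i * 2 → 0 < i
    0<i zero    eq = contradiction eq (ℕ.m>n⇒m∸n≢0 k<l)
    0<i (suc i) eq = s≤s z≤n

  4m≡2m*2 : 4 * m ≡ 2 * m * 2
  4m≡2m*2 = trans (ℕ.*-assoc 2 2 m) (ℕ.*-comm 2 (2 * m))

  period : ∃ λ h → 0 < h × h * 2 ≤ 2 * m × a 0 ~ a (h * 2)
  -- The blocks of `a 0` to `a (2 * m)` offer 4m + 2 places for 4m vertices. The two places of one
  -- index hold different vertices, so two different indices share a block.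
  period = collide (Fin.pigeonhole {4 * m} {suc (2 * m) * 2}
             (subst (_< suc (2 * m) * 2) (sym 4m≡2m*2) (ℕ.m≤n+m _ 1)) vertex)
    where
    K : Fin (suc (2 * m) * 2) → Fin (suc (2 * m))
    K c = proj₁ (remQuot 2 c)
    r : Fin (suc (2 * m) * 2) → Fin 2
    r c = proj₂ (remQuot {suc (2 * m)} 2 c)
    vertex : Fin (suc (2 * m) * 2) → Fin (4 * m)
    vertex c = vert (toℕ (K c)) (toℕ (r c))
    vertex-~ : ∀ c d → vertex c ≡ vertex d → a (toℕ (K c)) ~ a (toℕ (K d))
    vertex-~ c d eq = ~-trans (vert-~ (toℕ (K c)) (toℕ (r c)))
      (subst (_~ a (toℕ (K d))) (sym eq) (~-sym (vert-~ (toℕ (K d)) (toℕ (r d)))))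
    bound : ∀ c → toℕ (K c) ≤ 2 * m
    bound c = ℕ.≤-pred (Fin.toℕ<n (K c))
    collide : (∃ λ c → ∃ λ d → c Fin.< d × vertex c ≡ vertex d) → ∃ λ h → 0 < h × h * 2 ≤ 2 * m × a 0 ~ a (h * 2)
    collide (c , d , c<d , eq) with ℕ.<-cmp (toℕ (K c)) (toℕ (K d))
    ... | tri< k<l _ _ = collision⇒period k<l (bound d) (vertex-~ c d eq)
    ... | tri> _ _ l<k = collision⇒period l<k (bound c) (vertex-~ d c (sym eq))
    ... | tri≈ _ k≡l _ = contradiction (cong toℕ c≡d) (ℕ.<⇒≢ c<d)
      where
      Kc≡Kd : K c ≡ K d
      Kc≡Kd = Fin.toℕ-injective k≡l
      c≡d : c ≡ d
      c≡d = trans (sym (Fin.combine-remQuot {suc (2 * m)} 2 c)) (trans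
        (cong₂ combine Kc≡Kd (vert-injective (toℕ (K d)) (r c) (r d) (trans (cong (λ k → vert k (toℕ (r c))) (sym k≡l)) eq)))
        (Fin.combine-remQuot {suc (2 * m)} 2 d))

  -- The blocks met during one period are closed under `rung` and `next`, since each side of `a k`
  -- leads one step forward or one step back; connectedness does the rest.
  ∃-vert : ∀ {h} → 0 < h → a 0 ~ a (h * 2) → ∀ x → ∃ λ k → k < h * 2 × a k ~ x
  ∃-vert {suc h} _ closes x = go (connected v₀ x)
    where
    ℓ = suc h * 2
    Visited : Fin (4 * m) → Set
    Visited x = ∃ λ k → k < ℓ × a k ~ x
    even-ℓ-1 : even (suc (h * 2)) ≡ false
    even-ℓ-1 = (cong not (subst (λ l → even l ≡ true) (ℕ.+-identityʳ (h * 2)) (even-double h 0)))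
    visit-side : ∀ b k → k < ℓ → Visited (side b (a k))
    visit-side b k k<ℓ with b Bool.≟ even k
    ... | yes refl with suc k ℕ.<? ℓ
    ...   | yes k+1<ℓ = suc k , k+1<ℓ , ~-refl
    ...   | no  k+1≮ℓ = 0 , s≤s z≤n , subst (λ l → a 0 ~ a l) (≤-antisym (ℕ.≮⇒≥ k+1≮ℓ) k<ℓ) closes
    visit-side b (suc k) k<ℓ | no b≢ = k , ℕ.<-trans (ℕ.n<1+n k) k<ℓ ,
      subst (λ c → a k ~ side c (a (suc k))) (sym (trans (Bool.¬-not b≢) (Bool.not-involutive (even k))))
        (~-sym (side-back k))
    visit-side true  zero k<ℓ | no b≢ = contradiction refl b≢
    -- Stepping back from index 0 wraps around to the last index; the period is even, so the last
    -- step of the walk is a `next`.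
    visit-side false zero k<ℓ | no b≢ = suc (h * 2) , ℕ.n<1+n _ , ~-sym (~-trans (side-cong false closes)
      (subst (λ c → side c (a ℓ) ~ a (suc (h * 2))) even-ℓ-1 (side-back (suc (h * 2)))))
    visit : ∀ {x y} → Visited x → X x y ≡ true → Visited y
    visit {x} (k , k<ℓ , ak~x) xy with adj-only x xy
    ... | inj₁ refl with visit-side true k k<ℓ
    ...   | l , l<ℓ , al~ = l , l<ℓ , ~-trans al~ (side-cong true ak~x)
    visit {x} (k , k<ℓ , ak~x) xy | inj₂ nx~y with visit-side false k k<ℓ
    ...   | l , l<ℓ , al~ = l , l<ℓ , ~-trans al~ (~-trans (side-cong false ak~x) nx~y)
    go : ∀ {x} → Reach X v₀ x → Visited x
    go here        = 0 , s≤s z≤n , ~-refl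
    go (step r xy) = visit (go r) xy

  -- The `h * 2` blocks of two vertices cover all `4 * m` vertices, so the period cannot be shorter.
  period≡2m : ∀ {h} → 0 < h → h * 2 ≤ 2 * m → a 0 ~ a (h * 2) → h * 2 ≡ 2 * m
  period≡2m {h} 0<h h≤ closes = ≤-antisym h≤ (ℕ.*-cancelʳ-≤ (2 * m) (h * 2) 2 (subst (_≤ h * 2 * 2) 4m≡2m*2
    (subst (_≤ h * 2 * 2) (#-all {4 * m} (λ v → v Fin.≟ v) (λ _ → refl))
      (#-cover (λ v → v Fin.≟ v) vertex λ x _ → cover x (∃-vert 0<h closes x)))))
    where
    vertex : Fin (h * 2 * 2) → Fin (4 * m)
    vertex c = vert (toℕ (proj₁ (remQuot {h * 2} 2 c))) (toℕ (proj₂ (remQuot {h * 2} 2 c)))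
    cover : ∀ x → (∃ λ k → k < h * 2 × a k ~ x) → ∃ λ c → vertex c ≡ x
    cover x (k , k<ℓ , ak~x) with ~⇒vert k ak~x
    ... | r , eq = combine (fromℕ< k<ℓ) r , trans
      (cong₂ (λ i s → vert (toℕ i) (toℕ s)) (cong proj₁ (Fin.remQuot-combine (fromℕ< k<ℓ) r)) (cong proj₂ (Fin.remQuot-combine (fromℕ< k<ℓ) r)))
      (trans (cong (λ k → vert k (toℕ r)) (Fin.toℕ-fromℕ< k<ℓ)) eq)

  abstract
    closes : a 0 ~ a (2 * m)
    closes = go period
      where
      go : (∃ λ h → 0 < h × h * 2 ≤ 2 * m × a 0 ~ a (h * 2)) → a 0 ~ a (2 * m)
      go (h , 0<h , h≤ , eq) = subst (λ l → a 0 ~ a l) (period≡2m 0<h h≤ eq) eq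

    vert-onto : ∀ x → ∃ λ k → k < 2 * m × ∃ λ (r : Fin 2) → vert k (toℕ r) ≡ x
    vert-onto x = go period
      where
      go : (∃ λ h → 0 < h × h * 2 ≤ 2 * m × a 0 ~ a (h * 2)) → ∃ λ k → k < 2 * m × ∃ λ (r : Fin 2) → vert k (toℕ r) ≡ x
      go (h , 0<h , h≤ , eq) = let k , k<ℓ , ak~x = ∃-vert 0<h eq x in k , ℕ.<-≤-trans k<ℓ h≤ , ~⇒vert k ak~x

  -- The inverse of the isomorphism sought: the number 2k + r stands for x_k^r in X(m,2).
  code : Fin (4 * m) → Fin (4 * m)
  code u = vert (toℕ u / 2) (toℕ u % 2)

  %-code : ∀ k (r : Fin 2) → (toℕ r + k * 2) % 2 ≡ toℕ r
  %-code k r = trans ([m+kn]%n≡m%n (toℕ r) k 2) (m<n⇒m%n≡m (Fin.toℕ<n r))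

  /-code : ∀ k (r : Fin 2) → (toℕ r + k * 2) / 2 ≡ k
  /-code k r = trans (+-distrib-/-∣ʳ (toℕ r) (divides k refl)) (cong₂ _+_ (m<n⇒m/n≡0 (Fin.toℕ<n r)) (m*n/n≡m k 2))

  code< : ∀ {k} (r : Fin 2) → k < 2 * m → toℕ r + k * 2 < 4 * m
  code< {k} r k<2m = ℕ.<-≤-trans (ℕ.+-monoˡ-< (k * 2) (Fin.toℕ<n r))
    (subst (suc k * 2 ≤_) (sym 4m≡2m*2) (ℕ.*-monoˡ-≤ 2 k<2m))

  abstract
    code-onto : ∀ x → ∃ λ u → code u ≡ x
    code-onto x = go (vert-onto x)
      where
      go : (∃ λ k → k < 2 * m × ∃ λ (r : Fin 2) → vert k (toℕ r) ≡ x) → ∃ λ u → code u ≡ x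
      go (k , k<2m , r , eq) = fromℕ< (code< r k<2m) , trans
        (cong (λ u → vert (u / 2) (u % 2)) (Fin.toℕ-fromℕ< (code< r k<2m)))
        (trans (cong₂ vert (/-code k r) (%-code k r)) eq)

  code-injective : ∀ {u v} → code u ≡ code v → u ≡ v
  code-injective = surjective⇒injective code code-onto

  ≡ᵇ⇒≡ : ∀ {k l} → (k ≡ᵇ l) ≡ true → k ≡ l
  ≡ᵇ⇒≡ {k} {l} eq = ℕ.≡ᵇ⇒≡ k l (subst T (sym eq) tt)

  ≡ᵇ-refl : ∀ k → (k ≡ᵇ k) ≡ true
  ≡ᵇ-refl zero    = refl
  ≡ᵇ-refl (suc k) = ≡ᵇ-refl k

  side-vert : ∀ b k r → side b (vert k r) ~ side b (a k)
  side-vert b k r = side-cong b (~-sym (vert-~ k r))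

  rung-vert : ∀ k r → rung (vert k r) ≡ iter mate r (rung (a k))
  rung-vert k zero    = refl
  rung-vert k (suc r) = trans (rung-mate (vert k r)) (cong mate (rung-vert k r))

  a-suc-even : ∀ k → even k ≡ true → a (suc k) ≡ rung (a k)
  a-suc-even k ev = cong (λ b → side b (a k)) ev

  a-suc-odd : ∀ k → even k ≡ false → a (suc k) ≡ next (a k)
  a-suc-odd k odd = cong (λ b → side b (a k)) odd

  -- The step that wraps around starts at the odd index 2m - 1, so it is never a rung.
  even-clash : ∀ k → even k ≡ true → suc k ≢ 2 * m
  even-clash k ev eq = contradiction (trans (sym even[2m]) (trans (cong even (sym eq)) (cong not ev))) λ ()

  Succ : ℕ → ℕ → Set
  Succ k l = l ≡ suc k ⊎ (suc k ≡ 2 * m × l ≡ 0)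

  -- The Boolean `edgeX` as a relation, split into the matching edges, which preserve the
  -- superscript, and the complete joins.
  data Edge (k r l s : ℕ) : Set where
    rung-edge : even k ≡ true → Succ k l → r ≡ s → Edge k r l s
    next-edge : even k ≡ false → Succ k l → Edge k r l s

  succMod⇒Succ : ∀ k l → succMod m k l ≡ true → Succ k l
  succMod⇒Succ k l eq = cases (suc k ≡ᵇ l) (suc k ≡ᵇ 2 * m) (l ≡ᵇ 0) refl refl refl eq
    where
    cases : ∀ b c d → (suc k ≡ᵇ l) ≡ b → (suc k ≡ᵇ 2 * m) ≡ c → (l ≡ᵇ 0) ≡ d → b ∨ (c ∧ d) ≡ true → Succ k l
    cases true  _    _    e₁ _  _  _ = inj₁ (sym (≡ᵇ⇒≡ {suc k} {l} e₁))
    cases false true true _  e₂ e₃ _ = inj₂ (≡ᵇ⇒≡ {suc k} {2 * m} e₂ , ≡ᵇ⇒≡ {l} {0} e₃)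

  Succ⇒succMod : ∀ k l → Succ k l → succMod m k l ≡ true
  Succ⇒succMod k l (inj₁ refl)        = cong (_∨ ((suc k ≡ᵇ 2 * m) ∧ (l ≡ᵇ 0))) (≡ᵇ-refl (suc k))
  Succ⇒succMod k l (inj₂ (eq , refl)) = cong (_∧ true) (trans (cong (_≡ᵇ 2 * m) eq) (≡ᵇ-refl (2 * m)))

  edgeX⇒Edge : ∀ k r l s → edgeX m k r l s ≡ true → Edge k r l s
  edgeX⇒Edge k r l s eq = cases (isEven m k) (succMod m k l) (r ≡ᵇ s) (isEven≡even k) refl refl eq
    where
    cases : ∀ b c d → b ≡ even k → succMod m k l ≡ c → (r ≡ᵇ s) ≡ d →
            (b ∧ c ∧ d) ∨ (not b ∧ c) ≡ true → Edge k r l s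
    cases true  true true ek sk er _ = rung-edge (sym ek) (succMod⇒Succ k l sk) (≡ᵇ⇒≡ {r} {s} er)
    cases false true _    ek sk _  _ = next-edge (sym ek) (succMod⇒Succ k l sk)

  Edge⇒edgeX : ∀ k r l s → Edge k r l s → edgeX m k r l s ≡ true
  Edge⇒edgeX k r l s edge = cases (isEven≡even k) edge
    where
    cases : ∀ {b} → b ≡ even k → Edge k r l s → (b ∧ succMod m k l ∧ (r ≡ᵇ s)) ∨ (not b ∧ succMod m k l) ≡ true
    cases b≡ (rung-edge ek sk refl) rewrite trans b≡ ek | Succ⇒succMod k l sk | ≡ᵇ-refl r = refl
    cases b≡ (next-edge ek sk)      rewrite trans b≡ ek = Succ⇒succMod k l sk

  next-succ : ∀ k l → even k ≡ false → Succ k l → next (a k) ~ a l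
  next-succ k l odd (inj₁ refl)        = inj₁ (a-suc-odd k odd)
  next-succ k l odd (inj₂ (eq , refl)) = subst (_~ a 0) (a-suc-odd k odd) (subst (λ l → a l ~ a 0) (sym eq) (~-sym closes))

  rung-succ : ∀ k r → even k ≡ true → rung (vert k r) ≡ vert (suc k) r
  rung-succ k r ek = trans (rung-vert k r) (cong (iter mate r) (sym (a-suc-even k ek)))

  edge-sound : ∀ k r l s → Edge k r l s → X (vert k r) (vert l s) ≡ true
  edge-sound k r l s (rung-edge ek (inj₁ refl) refl) =
    subst (λ x → X (vert k r) x ≡ true) (rung-succ k r ek) (adj-rung (vert k r))
  edge-sound k r l s (rung-edge ek (inj₂ (eq , _)) _) = contradiction eq (even-clash k ek)
  edge-sound k r l s (next-edge ek sk) = adj-next (vert k r)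
    (~-trans (side-vert false k r) (~-trans (next-succ k l ek sk) (vert-~ l s)))

  adj-sound : ∀ k r l s → edgeX m k r l s ∨ edgeX m l s k r ≡ true → X (vert k r) (vert l s) ≡ true
  adj-sound k r l s eq = cases (edgeX m k r l s) refl eq
    where
    cases : ∀ b → edgeX m k r l s ≡ b → b ∨ edgeX m l s k r ≡ true → X (vert k r) (vert l s) ≡ true
    cases true  e _ = edge-sound k r l s (edgeX⇒Edge k r l s e)
    cases false _ e = trans (X-sym (vert k r) (vert l s)) (edge-sound l s k r (edgeX⇒Edge l s k r e))

  -- Coordinates for a neighbour `x` of the vertex with coordinates `k` and `r`, with the edge of
  -- X(m,2) that accounts for the adjacency.
  record Match (k r : ℕ) (x : Fin (4 * m)) : Set where
    constructor match
    field
      l    : ℕ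
      l<   : l < 2 * m
      s    : Fin 2
      eq   : vert l (toℕ s) ≡ x
      edge : Edge k r l (toℕ s) ⊎ Edge l (toℕ s) k r

  Succ-exists : ∀ k → k < 2 * m → ∃ λ l → l < 2 * m × Succ k l
  Succ-exists k k<2m with suc k ℕ.<? 2 * m
  ... | yes k+1<2m = suc k , k+1<2m , inj₁ refl
  ... | no  k+1≮2m = 0 , ℕ.≤-<-trans z≤n k<2m , inj₂ (≤-antisym k<2m (ℕ.≮⇒≥ k+1≮2m) , refl)

  odd-predecessor : ∀ k → k < 2 * m → even k ≡ true → ∃ λ j → j < 2 * m × even j ≡ false × Succ j k
  odd-predecessor (suc j) k<2m ek = j , ℕ.<-trans (ℕ.n<1+n j) k<2m , even-pred j ek , inj₁ refl
  -- The predecessor of 0 is 2m - 1, which is odd.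
  odd-predecessor zero    0<2m _  = last (2 * m) refl 0<2m
    where
    last : ∀ l → l ≡ 2 * m → 0 < l → ∃ λ j → j < 2 * m × even j ≡ false × Succ j 0
    last (suc j) eq _ = j , ℕ.≤-reflexive eq , even-pred j (trans (cong even eq) even[2m]) , inj₂ (eq , refl)

  rung-match : ∀ k (r : Fin 2) → k < 2 * m → ∀ b → even k ≡ b → Match k (toℕ r) (rung (vert k (toℕ r)))
  rung-match k r k<2m true ek = match (suc k) (ℕ.≤∧≢⇒< k<2m (even-clash k ek)) r
    (sym (rung-succ k (toℕ r) ek)) (inj₁ (rung-edge ek (inj₁ refl) refl))
  rung-match (suc j) r k<2m false ek = match j (ℕ.<-trans (ℕ.n<1+n j) k<2m) r
    (trans (sym (rung-rung (vert j (toℕ r)))) (cong rung (rung-succ j (toℕ r) (even-pred j ek))))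
    (inj₂ (rung-edge (even-pred j ek) (inj₁ refl) refl))

  next-match : ∀ k (r : Fin 2) {x} → k < 2 * m → ∀ b → even k ≡ b → next (a k) ~ x → Match k (toℕ r) x
  next-match k r {x} k<2m false ek nak~x with Succ-exists k k<2m
  ... | l , l<2m , sk = go (~⇒vert l (~-trans (~-sym (next-succ k l ek sk)) nak~x))
    where
    go : (∃ λ s → vert l (toℕ s) ≡ x) → Match k (toℕ r) x
    go (s , eq) = match l l<2m s eq (inj₁ (next-edge ek sk))
  next-match k r {x} k<2m true ek nak~x with odd-predecessor k k<2m ek
  ... | j , j<2m , ej , sj = go (~⇒vert j (~-trans (~-sym (next-next (a j)))
          (~-trans (side-cong false (next-succ j k ej sj)) nak~x)))
    where
    go : (∃ λ s → vert j (toℕ s) ≡ x) → Match k (toℕ r) x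
    go (s , eq) = match j j<2m s eq (inj₂ (next-edge ej sj))

  adj-complete : ∀ k (r : Fin 2) {x} → k < 2 * m → X (vert k (toℕ r)) x ≡ true → Match k (toℕ r) x
  adj-complete k r {x} k<2m vx = cases (adj-only (vert k (toℕ r)) vx)
    where
    cases : x ≡ rung (vert k (toℕ r)) ⊎ next (vert k (toℕ r)) ~ x → Match k (toℕ r) x
    cases (inj₁ eq)   = subst (Match k (toℕ r)) (sym eq) (rung-match k r k<2m (even k) refl)
    cases (inj₂ nv~x) = next-match k r k<2m (even k) refl (~-trans (~-sym (side-vert false k (toℕ r))) nv~x)

  Edge⇒adj : ∀ k r l s → Edge k r l s ⊎ Edge l s k r → edgeX m k r l s ∨ edgeX m l s k r ≡ true
  Edge⇒adj k r l s (inj₁ e) = cong (_∨ edgeX m l s k r) (Edge⇒edgeX k r l s e)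
  Edge⇒adj k r l s (inj₂ e) = trans (cong (edgeX m k r l s ∨_) (Edge⇒edgeX l s k r e)) (Bool.∨-zeroʳ (edgeX m k r l s))

  code-adj : ∀ u v → X[ m ,2] u v ≡ X (code u) (code v)
  code-adj u v = Bool.⇔→≡ {z = true} (mk⇔ (adj-sound kᵤ rᵤ (toℕ v / 2) (toℕ v % 2)) complete)
    where
    kᵤ rᵤ : ℕ
    kᵤ = toℕ u / 2
    rᵤ = toℕ u % 2
    r′ : Fin 2
    r′ = fromℕ< (m%n<n (toℕ u) 2)
    toℕ-r′ : toℕ r′ ≡ rᵤ
    toℕ-r′ = Fin.toℕ-fromℕ< (m%n<n (toℕ u) 2)
    kᵤ<2m : kᵤ < 2 * m
    kᵤ<2m = m<n*o⇒m/o<n (subst (toℕ u <_) 4m≡2m*2 (Fin.toℕ<n u))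
    -- Injectivity of `code` identifies the coordinates found for `code v` with those of the number
    -- `v`.
    matched : Match kᵤ (toℕ r′) (code v) → edgeX m kᵤ rᵤ (toℕ v / 2) (toℕ v % 2) ∨ edgeX m (toℕ v / 2) (toℕ v % 2) kᵤ rᵤ ≡ true
    matched (match l l<2m s eq edge) = Edge⇒adj kᵤ rᵤ (toℕ v / 2) (toℕ v % 2)
      (subst₂ (λ l s → Edge kᵤ rᵤ l s ⊎ Edge l s kᵤ rᵤ)
        (trans (sym (/-code l s)) (cong (_/ 2) w≡v)) (trans (sym (%-code l s)) (cong (_% 2) w≡v))
        (subst (λ q → Edge kᵤ q l (toℕ s) ⊎ Edge l (toℕ s) kᵤ q) toℕ-r′ edge))
      where
      w : Fin (4 * m)
      w = fromℕ< (code< s l<2m)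
      toℕ-w : toℕ w ≡ toℕ s + l * 2
      toℕ-w = Fin.toℕ-fromℕ< (code< s l<2m)
      w≡v : toℕ s + l * 2 ≡ toℕ v
      w≡v = trans (sym toℕ-w) (cong toℕ (code-injective {w} {v}
        (trans (cong (λ c → vert (c / 2) (c % 2)) toℕ-w) (trans (cong₂ vert (/-code l s) (%-code l s)) eq))))
    complete : X (code u) (code v) ≡ true → X[ m ,2] u v ≡ true
    complete uv = matched (adj-complete kᵤ r′ kᵤ<2m (subst (λ s → X (vert kᵤ s) (code v) ≡ true) (sym toℕ-r′) uv))

  isomorphism : X ≅ X[ m ,2]
  isomorphism = permutation decode code decode-code code-decode , λ u v →
    trans (code-adj (decode u) (decode v)) (cong₂ X (code-decode u) (code-decode v))
    where
    decode : Fin (4 * m) → Fin (4 * m)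
    decode x = proj₁ (code-onto x)
    code-decode : ∀ x → code (decode x) ≡ x
    code-decode x = proj₂ (code-onto x)
    decode-code : ∀ u → decode (code u) ≡ u
    decode-code u = code-injective (code-decode (code u))

-- Solvable groups of automorphisms

-- Finitely many instances of excluded middle, each available under double negation. Arbitrary
-- subgroups can thus be counted while deriving a contradiction.
¬¬-Decidable : ∀ {k} (P : Pred (Fin k) 0ℓ) → ¬ ¬ Decidable P
¬¬-Decidable {zero}  P ¬dec = ¬dec λ ()
¬¬-Decidable {suc k} P ¬dec = ¬¬-excluded-middle λ P0? → ¬¬-Decidable (P ∘ suc) λ Ps? →
  ¬dec λ { zero → P0? ; (suc i) → Ps? i }

abstract
  prime[3] : Prime 3
  prime[3] = from-yes (prime? 3)

module _ {n : ℕ} (S : CubicAction n) where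

  open CubicActionProperties S
  open ≡-Reasoning

  data Soluble : Pred (Fin N) 0ℓ → Set₁ where
    trivial : ∀ {K} → (∀ {x} → K x → x ≡ ε) → Soluble K
    extend  : ∀ {K} (H : Pred (Fin N) 0ℓ) → Subgroup H → (∀ {x y} → K x → K y → H ⟦ x , y ⟧) → Soluble H → Soluble K

  commute-⁻¹ : ∀ {x y} → Commute x y → Commute x (y ⁻¹)
  commute-⁻¹ {x} {y} xy = sym (begin
    (y ⁻¹) ∙ x                      ≡⟨ cong ((y ⁻¹) ∙_) (identityʳ x) ⟨
    (y ⁻¹) ∙ (x ∙ ε)                ≡⟨ cong (λ z → (y ⁻¹) ∙ (x ∙ z)) (inverseʳ y) ⟨
    (y ⁻¹) ∙ (x ∙ (y ∙ (y ⁻¹)))     ≡⟨ cong ((y ⁻¹) ∙_) (assoc x y (y ⁻¹)) ⟨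
    (y ⁻¹) ∙ ((x ∙ y) ∙ (y ⁻¹))     ≡⟨ cong (λ z → (y ⁻¹) ∙ (z ∙ (y ⁻¹))) xy ⟩
    (y ⁻¹) ∙ ((y ∙ x) ∙ (y ⁻¹))     ≡⟨ cong ((y ⁻¹) ∙_) (assoc y x (y ⁻¹)) ⟩
    (y ⁻¹) ∙ (y ∙ (x ∙ (y ⁻¹)))     ≡⟨ ⁻¹-∙-cancelˡ y _ ⟩
    x ∙ (y ⁻¹)                      ∎)

  commute-∙-cancelʳ : ∀ {g x y} → Commute g (x ∙ y) → Commute g y → Commute g x
  commute-∙-cancelʳ {g} {x} {y} gxy gy = subst (Commute g) (begin
    (x ∙ y) ∙ (y ⁻¹)  ≡⟨ assoc x y (y ⁻¹) ⟩
    x ∙ (y ∙ (y ⁻¹))  ≡⟨ cong (x ∙_) (inverseʳ y) ⟩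
    x ∙ ε             ≡⟨ identityʳ x ⟩
    x                 ∎) (commute-∙ gxy (commute-⁻¹ gy))

  commute-Bézout : ∀ {g x a b} u v → 1 + v * b ≡ u * a → Commute g (x ↑ a) → Commute g (x ↑ b) → Commute g x
  commute-Bézout {g} {x} {a} {b} u v eq ga gb = commute-∙-cancelʳ
    (subst (Commute g) (trans (sym (↑-* x u a)) (cong (x ↑_) (sym eq))) (commute-↑ u ga))
    (subst (Commute g) (sym (↑-* x v b)) (commute-↑ v gb))

  commute-coprime : ∀ {g x a b} → Coprime a b → Commute g (x ↑ a) → Commute g (x ↑ b) → Commute g x
  commute-coprime c ga gb with coprime-Bézout c
  ... | Bézout.+- u v eq = commute-Bézout u v eq ga gb
  ... | Bézout.-+ u v eq = commute-Bézout v u eq gb ga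

  finite-order : ∀ x → ∃ λ k → 0 < k × x ↑ k ≡ ε
  finite-order x with Fin.pigeonhole (ℕ.n<1+n N) (λ (i : Fin (suc N)) → x ↑ toℕ i)
  ... | i , j , i<j , eq = toℕ j ℕ.∸ toℕ i , ℕ.m<n⇒0<n∸m i<j , sym (begin
    ε                                                ≡⟨ inverseˡ (x ↑ toℕ i) ⟨
    ((x ↑ toℕ i) ⁻¹) ∙ (x ↑ toℕ i)                   ≡⟨ cong (((x ↑ toℕ i) ⁻¹) ∙_) eq ⟩
    ((x ↑ toℕ i) ⁻¹) ∙ (x ↑ toℕ j)                   ≡⟨ cong (λ k → ((x ↑ toℕ i) ⁻¹) ∙ (x ↑ k)) (ℕ.m+[n∸m]≡n (ℕ.<⇒≤ i<j)) ⟨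
    ((x ↑ toℕ i) ⁻¹) ∙ (x ↑ (toℕ i + (toℕ j ℕ.∸ toℕ i))) ≡⟨ cong (((x ↑ toℕ i) ⁻¹) ∙_) (↑-+ x (toℕ i) _) ⟩
    ((x ↑ toℕ i) ⁻¹) ∙ ((x ↑ toℕ i) ∙ (x ↑ (toℕ j ℕ.∸ toℕ i))) ≡⟨ ⁻¹-∙-cancelˡ (x ↑ toℕ i) _ ⟩
    x ↑ (toℕ j ℕ.∸ toℕ i)                            ∎)

  ↑-toℕ-injective : ∀ {r g} → Prime r → g ≢ ε → g ↑ r ≡ ε → ∀ {i j : Fin r} → g ↑ toℕ i ≡ g ↑ toℕ j → i ≡ j
  ↑-toℕ-injective {r} {g} pr g≢ε g↑r {i} {j} eq = iter-injective (g ∙_) (∙-cancelˡ g _ _) 1 pr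
    (trans (iter-↑ (r ^ 1)) (trans (cong (g ↑_) (ℕ.*-identityʳ r)) g↑r))
    (λ eq → g≢ε (trans (sym (identityʳ g)) eq))
    (trans (iter-↑ (toℕ i)) (trans eq (sym (iter-↑ (toℕ j)))))
    where
    open import Algebra.Properties.Group group using (∙-cancelˡ)
    iter-↑ : ∀ k → iter (g ∙_) k ε ≡ g ↑ k
    iter-↑ zero    = refl
    iter-↑ (suc k) = cong (g ∙_) (iter-↑ k)

  -- Such an element fixes no vertex, so the vertices split into its cycles of length `q`.
  large-prime-order⇒∣ : ∀ {q x} → Prime q → 3 < q → x ↑ q ≡ ε → x ≢ ε → q ∣ n
  large-prime-order⇒∣ {q} {x} pq 3<q x↑q x≢ε = subst (q ∣_) (#-all {n} (λ v → v Fin.≟ v) (λ _ → refl))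
    (fixed-point-free⇒∣ (_▹ x) pq (λ v → iter-▹-period q v x↑q) (λ v → v Fin.≟ v) (λ _ → refl)
      (λ _ fixed → x≢ε (large-prime-fixes⇒≡ε pq 3<q x↑q fixed)))

  -- The bound is 3 times 3: an orbit has at most 3 vertices, and an element of a stabiliser is
  -- determined by where it sends one neighbour, since a 3-element fixing both ends of an edge is
  -- trivial.
  normal-3-subgroup : {Q : Pred (Fin N) 0ℓ} (Q? : Decidable Q) → NormalSubgroup Q →
                      (∀ {x} → Q x → ∃ λ k → x ↑ (3 ^ k) ≡ ε) → ¬ (9 ∣ n) → Fin n → # Q? ≤ 9
  normal-3-subgroup {Q} Q? isNormal 3-group 9∤n v = ℕ.≤-trans
    (ℕ.≤-reflexive (orbit-stabiliser Q? subgroup v))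
    (ℕ.*-mono-≤ (orbit-size-bound Q? isNormal 1 prime[3] 3-group 9∤n v) stabiliser≤3)
    where
    open NormalSubgroup isNormal
    open import Algebra.Properties.Group group using (x∙y⁻¹≈ε⇒x≈y)
    u = proj₁ (neighbours v)
    vu : Adj v u
    vu = Neighbours.va (proj₂ (proj₂ (proj₂ (neighbours v))))
    stabiliser≤3 : # (stabiliser? Q? v) ≤ 3
    stabiliser≤3 = subst (# (stabiliser? Q? v) ≤_) (#-Adj v)
      (#-injection (stabiliser? Q? v) (Adj? v) (u ▹_)
        (λ {x} (_ , fixed) → subst (λ w → Adj w (u ▹ x)) fixed (Adj-▹ x vu))
        λ {x} {y} (Qx , fx) (Qy , fy) eq → x∙y⁻¹≈ε⇒x≈y x y (
          let k , x↑ = 3-group (∙-closed Qx (⁻¹-closed Qy)) in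
          odd-prime-power-fixes-edge⇒≡ε k prime[3] ℕ.≤-refl x↑ vu (fixes-⁻¹∙ (trans fx (sym fy))) (fixes-⁻¹∙ eq)))

  -- The given series is only subnormal; cores of its terms form a normal series, still with abelian factors.
  core : Pred (Fin N) 0ℓ → Pred (Fin N) 0ℓ → Pred (Fin N) 0ℓ
  core K H x = K x × ∀ a → H (conj a x)

  core-normal : ∀ {K H} → NormalSubgroup K → Subgroup H → NormalSubgroup (core K H)
  core-normal {K} {H} isNormal isSub = record
    { subgroup = record
      { ε∈        = K.ε∈ , λ a → subst H (sym (conj-ε a)) H.ε∈
      ; ∙-closed  = λ {x} {y} (Kx , Hx) (Ky , Hy) → K.∙-closed Kx Ky , λ a → subst H (sym (conj-∙ a x y)) (H.∙-closed (Hx a) (Hy a))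
      ; ⁻¹-closed = λ {x} (Kx , Hx) → K.⁻¹-closed Kx , λ a → subst H (sym (conj-⁻¹ a x)) (H.⁻¹-closed (Hx a)) }
    ; conj-closed = λ {x} b (Kx , Hx) → K.conj-closed b Kx , λ a → subst H (sym (conj-conj b a x)) (Hx (b ∙ a)) }
    where
    module K = NormalSubgroup isNormal
    module H = Subgroup isSub

  conj-⟦⟧ : ∀ a x y → conj a ⟦ x , y ⟧ ≡ ⟦ conj a x , conj a y ⟧
  conj-⟦⟧ a x y = begin
    conj a ⟦ x , y ⟧                                            ≡⟨ conj-∙ a (x ⁻¹) _ ⟩
    conj a (x ⁻¹) ∙ conj a ((y ⁻¹) ∙ (x ∙ y))                   ≡⟨ cong (conj a (x ⁻¹) ∙_) (conj-∙ a (y ⁻¹) _) ⟩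
    conj a (x ⁻¹) ∙ (conj a (y ⁻¹) ∙ conj a (x ∙ y))            ≡⟨ cong₂ (λ s t → s ∙ (t ∙ conj a (x ∙ y))) (conj-⁻¹ a x) (conj-⁻¹ a y) ⟩
    (conj a x ⁻¹) ∙ ((conj a y ⁻¹) ∙ conj a (x ∙ y))            ≡⟨ cong (λ s → (conj a x ⁻¹) ∙ ((conj a y ⁻¹) ∙ s)) (conj-∙ a x y) ⟩
    ⟦ conj a x , conj a y ⟧                                     ∎

  ⟦⟧-closed : ∀ {K} → NormalSubgroup K → ∀ g {x} → K x → K ⟦ g , x ⟧
  ⟦⟧-closed {K} isNormal g {x} Kx = subst K (sym (⟦⟧-as-conj g x)) (∙-closed (⁻¹-closed (conj-closed g Kx)) Kx)
    where open NormalSubgroup isNormal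

  -- A conjugate of a commutator is the commutator of the conjugates, which stay in `L` and hence in
  -- `K`.
  commutators-in-core : ∀ {K L H : Pred (Fin N) 0ℓ} → NormalSubgroup L → L ⊑ K → (∀ {x y} → K x → K y → H ⟦ x , y ⟧) →
                        ∀ {x y} → L x → L y → core L H ⟦ x , y ⟧
  commutators-in-core {H = H} isNormal L⊑K [K,K]⊆H {x} {y} Lx Ly = ⟦⟧-closed isNormal x Ly ,
    λ a → subst H (sym (conj-⟦⟧ a x y)) ([K,K]⊆H (L⊑K (conj-closed a Lx)) (L⊑K (conj-closed a Ly)))
    where open NormalSubgroup isNormal

  -- The centraliser of a normal subgroup is normal.
  commute-pullback : ∀ {M} → NormalSubgroup M → ∀ a {x} → (∀ {y} → M y → Commute x y) → ∀ {y} → M y → Commute (conj a x) y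
  commute-pullback isNormal a {x} comm {y} My =
    subst (Commute (conj a x)) (conj-inverse a y) (commute-conj a (comm (conj-closed (a ⁻¹) My)))
    where open NormalSubgroup isNormal

  -- For prime `p`, the powers of `g` form a normal subgroup of order `p`; bounding the exponents
  -- makes this decidable.
  GeneratesNormal : ℕ → Pred (Fin N) 0ℓ
  GeneratesNormal p g = g ≢ ε × g ↑ p ≡ ε × ∀ a → ∃ λ (i : Fin p) → g ↑ toℕ i ≡ conj a g

  module _ {p : ℕ} (pp : Prime p) (8<p : 8 < p) (8∤n : ¬ (8 ∣ n)) (9∤n : ¬ (9 ∣ n)) (p²∤n : ¬ (p ^ 2 ∣ n)) (8<n : 8 < n)
           (large-prime-divisor : ∀ {q} → Prime q → 3 < q → q ∣ n → q ≡ p)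
           (no-ladder : ¬ Ladder Adj) where

    private
      v₀ : Fin n
      v₀ = Fin.fromℕ< (ℕ.≤-<-trans z≤n 8<n)

      3<p : 3 < p
      3<p = ℕ.<-trans (ℕ.m<m+n 3 (s≤s z≤n)) 8<p

    Prime-free : Pred (Fin N) 0ℓ → Set
    Prime-free K = ∀ {x} → K x → x ↑ p ≡ ε → x ≡ ε

    -- Conjugation by `g` permutes the elements it moves in cycles of length `p`. As `ε` is not
    -- moved, at most 8 elements are, fewer than `p`.
    small-centralised : ∀ {Q : Pred (Fin N) 0ℓ} (Q? : Decidable Q) → NormalSubgroup Q → # Q? ≤ 9 →
                        ∀ {g} → g ↑ p ≡ ε → ∀ {x} → Q x → Commute g x
    small-centralised {Q} Q? isNormal #Q≤9 {g} g↑p {x} Qx = conj⇒commute (decidable-stable (conj g x Fin.≟ x) λ moved →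
      contradiction (ℕ.≤-trans (∣⇒≤ {{>-nonZero (#>0 moved? x (Qx , moved))}} p∣#moved) #moved≤8) (ℕ.<⇒≱ 8<p))
      where
      open NormalSubgroup isNormal
      moved? : Decidable (λ x → Q x × conj g x ≢ x)
      moved? x = Q? x ×-dec ¬? (conj g x Fin.≟ x)
      conj-injective : ∀ {x y} → conj g x ≡ conj g y → x ≡ y
      conj-injective {x} {y} eq = trans (sym (conj-inverse′ g x)) (trans (cong (conj (g ⁻¹)) eq) (conj-inverse′ g y))
      p∣#moved : p ∣ # moved?
      p∣#moved = fixed-point-free⇒∣ (conj g) pp (λ y → iter-conj-period p y g↑p) moved?
        (λ (Qy , moved) → conj-closed g Qy , moved ∘ conj-injective) proj₂
      #moved≤8 : # moved? ≤ 8
      #moved≤8 = ℕ.≤-pred (ℕ.≤-trans (s≤s (#-mono moved? (λ y → Q? y ×-dec ¬? (y Fin.≟ ε))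
        λ { (Qy , moved) → Qy , λ { refl → moved (conj-ε g) } }))
        (subst (_≤ 9) (#-remove Q? ε ε∈) #Q≤9))

    -- In class at most 2 the elements of 2-power order and those of 3-power order form normal
    -- subgroups, both small enough to be centralised by `g`, and together they account for every
    -- element of `T`.
    class-2-centralised : ∀ {T} → NormalSubgroup T → (∀ {x y z} → T x → T y → T z → Commute z ⟦ x , y ⟧) → Prime-free T →
                          ∀ {g} → g ↑ p ≡ ε → ∀ {x} → T x → Commute g x
    class-2-centralised {T} isNormal class-2 free {g} g↑p {x} Tx = conj⇒commute (decidable-stable (conj g x Fin.≟ x) λ moved →
      ¬¬-Decidable (Primary 2) λ T₂? → ¬¬-Decidable (Primary 3) λ T₃? → moved (commute⇒conj (centralised T₂? T₃?)))
      where
      open NormalSubgroup isNormal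
      Primary : ℕ → Pred (Fin N) 0ℓ
      Primary r x = T x × ∃ λ k → x ↑ (r ^ k) ≡ ε

      primary-normal : ∀ r → NormalSubgroup (Primary r)
      primary-normal r = record
        { subgroup = record
          { ε∈        = ε∈ , 0 , ε-↑ (r ^ 0)
          -- Both orders divide r^(j+k), and the product has an order dividing the square of that.
          ; ∙-closed  = λ {x} {y} (Tx , j , x↑) (Ty , k , y↑) → ∙-closed Tx Ty , (j + k) + (j + k) ,
              trans (cong ((x ∙ y) ↑_) (ℕ.^-distribˡ-+-* r (j + k) (j + k)))
                (product-exponent (commutator-def y x) (class-2 Ty Tx Ty) (class-2 Ty Tx Tx) {r ^ (j + k)}
                  (↑-∣ (^-∣ r (ℕ.m≤n+m k j)) y↑) (↑-∣ (^-∣ r (ℕ.m≤m+n j k)) x↑))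
          ; ⁻¹-closed = λ {x} (Tx , k , x↑) → ⁻¹-closed Tx , k ,
              trans (⁻¹-↑ x (r ^ k)) (trans (cong _⁻¹ x↑) (trans (sym (identityˡ (ε ⁻¹))) (inverseʳ ε))) }
        ; conj-closed = λ {x} a (Tx , k , x↑) → conj-closed a Tx , k ,
            trans (sym (conj-↑ a x (r ^ k))) (trans (cong (conj a) x↑) (conj-ε a)) }

      -- A non-trivial element of prime order above 3 forces that prime to divide `n`, so it is `p`,
      -- which `T` excludes.
      clear : ∀ {z q} → Prime q → q ≢ 2 → q ≢ 3 → T z → z ↑ q ≡ ε → z ≡ ε
      clear {z} {q} pq q≢2 q≢3 Tz z↑q = decidable-stable (z Fin.≟ ε) λ z≢ε → z≢ε (free Tz
        (subst (λ r → z ↑ r ≡ ε) (large-prime-divisor pq 3<q (large-prime-order⇒∣ pq 3<q z↑q z≢ε)) z↑q))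
        where
        3<q : 3 < q
        3<q = ℕ.≤∧≢⇒< (ℕ.≤∧≢⇒< (prime⇒≥2 pq) (q≢2 ∘ sym)) (q≢3 ∘ sym)

      -- Prime factors are stripped from the exponent one at a time; 2 and 3 are kept, any other is
      -- discarded by `clear`.
      2-3-exponent : ∀ as → ListAll Prime as → ∀ {x} → T x → x ↑ product as ≡ ε → ∃ λ i → ∃ λ j → x ↑ (2 ^ i * 3 ^ j) ≡ ε
      2-3-exponent [] [] Tx x↑ = 0 , 0 , x↑
      2-3-exponent (q ∷ as) (pq ∷ pas) {x} Tx x↑
        with 2-3-exponent as pas (↑-closed q Tx) (trans (sym (↑-*′ x q (product as))) x↑)
      ... | i , j , z↑ with q ℕ.≟ 2 | q ℕ.≟ 3
      ...   | yes refl | _ = suc i , j , trans (cong (x ↑_) (ℕ.*-assoc 2 (2 ^ i) (3 ^ j))) (trans (↑-*′ x 2 (2 ^ i * 3 ^ j)) z↑)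
      ...   | no _ | yes refl = i , suc j , trans (cong (x ↑_) 3*) (trans (↑-*′ x 3 (2 ^ i * 3 ^ j)) z↑)
        where
        3* : 2 ^ i * (3 * 3 ^ j) ≡ 3 * (2 ^ i * 3 ^ j)
        3* = trans (sym (ℕ.*-assoc (2 ^ i) 3 (3 ^ j))) (trans (cong (_* 3 ^ j) (ℕ.*-comm (2 ^ i) 3)) (ℕ.*-assoc 3 (2 ^ i) (3 ^ j)))
      ...   | no q≢2 | no q≢3 = i , j , clear pq q≢2 q≢3 (↑-closed (2 ^ i * 3 ^ j) Tx)
              (trans (sym (↑-* x q (2 ^ i * 3 ^ j))) (trans (↑-*′ x q (2 ^ i * 3 ^ j)) z↑))

      centralised : Decidable (Primary 2) → Decidable (Primary 3) → Commute g x
      centralised T₂? T₃? with finite-order x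
      ... | k , 0<k , x↑k with 2-3-exponent factors factorsPrime Tx (trans (cong (x ↑_) (sym isFactorisation)) x↑k)
        where open PrimeFactorisation (factorise k {{>-nonZero 0<k}})
      -- `x ↑ (2 ^ i)` is a 3-element and `x ↑ (3 ^ j)` a 2-element; `g` commutes with both, hence
      -- with `x` by Bézout.
      ... | i , j , x↑ = commute-coprime {a = 2 ^ i} {b = 3 ^ j}
        (coprime-^ j (Coprime.sym (coprime-^ i (primes-coprime prime[3] prime[2] λ ()))))
        (small-centralised T₃? (primary-normal 3) (normal-3-subgroup T₃? (primary-normal 3) proj₂ 9∤n v₀) g↑p
          (↑-closed (2 ^ i) Tx , j , trans (sym (↑-*′ x (2 ^ i) (3 ^ j))) x↑))
        (small-centralised T₂? (primary-normal 2) #T₂≤9 g↑p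
          (↑-closed (3 ^ j) Tx , i , trans (sym (↑-* x (2 ^ i) (3 ^ j))) x↑))
        where
        #T₂≤9 : # T₂? ≤ 9
        #T₂≤9 with BlockStructure.normal-2-subgroup S T₂? (primary-normal 2) proj₂ 8<n 8∤n
        ... | inj₁ ladder = contradiction ladder no-ladder
        ... | inj₂ ≤4     = ℕ.≤-trans ≤4 (ℕ.m≤m+n 4 5)

    -- Coprime action: an element of order p centralising M and C_L(M), where [L,L] ≤ M ≤ L, centralises L, because
    -- [g,x] lies in C_L(M) for x in L.  As C_L(M) is nilpotent of class at most 2, its primary parts can be treated separately.
    prime-free-centralised : ∀ {K} → Soluble K → ∀ {L} → NormalSubgroup L → L ⊑ K → Prime-free L →
                             ∀ {g} → g ↑ p ≡ ε → ∀ {x} → L x → Commute g x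
    prime-free-centralised (trivial K-trivial) isNormal L⊑K free {g} g↑p Lx
      rewrite K-trivial (L⊑K Lx) = trans (identityʳ g) (sym (identityˡ g))
    prime-free-centralised (extend {K} H isSub [K,K]⊆H soluble) {L} isNormal L⊑K free {g} g↑p {x} Lx =
      ⟦⟧≡ε⇒commute (free t∈L t↑p)
      where
      open NormalSubgroup isNormal
      M : Pred (Fin N) 0ℓ
      M = core L H
      M-normal : NormalSubgroup M
      M-normal = core-normal isNormal isSub
      M-centralised : ∀ {g} → g ↑ p ≡ ε → ∀ {y} → M y → Commute g y
      M-centralised = prime-free-centralised soluble M-normal
        (λ {y} (_ , Hy) → subst H (conj-by-ε y) (Hy ε)) (λ (Ly , _) → free Ly)
      C : Pred (Fin N) 0ℓ
      C x = L x × (∀ {y} → M y → Commute x y)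
      C-normal : NormalSubgroup C
      C-normal = record
        { subgroup = record
          { ε∈        = ε∈ , λ {y} _ → trans (identityˡ y) (sym (identityʳ y))
          ; ∙-closed  = λ (Lx , cx) (Ly , cy) → ∙-closed Lx Ly , λ Mz → sym (commute-∙ (sym (cx Mz)) (sym (cy Mz)))
          ; ⁻¹-closed = λ (Lx , cx) → ⁻¹-closed Lx , λ Mz → sym (commute-⁻¹ (sym (cx Mz))) }
        ; conj-closed = λ a (Lx , cx) → conj-closed a Lx , commute-pullback M-normal a cx }
      t = ⟦ g , x ⟧
      t∈L : L t
      t∈L = ⟦⟧-closed isNormal g Lx
      -- `t` is the product of the inverse of `g` with `conj x g`, and both factors centralise `M`.
      t∈C : C t
      t∈C = t∈L , λ {y} My → sym (subst (Commute y) (trans (cong ((g ⁻¹) ∙_) (conj-commutator g x)) (⁻¹-∙-cancelˡ g t))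
        (commute-∙ (commute-⁻¹ (sym (M-centralised g↑p My)))
                   (sym (commute-pullback M-normal x (M-centralised g↑p) My))))
      -- Commutators of elements of `C` lie in `M`, which `C` centralises, so `C` has class at most
      -- 2.
      gt : Commute g t
      gt = class-2-centralised C-normal
        (λ (Lx , _) (Ly , _) (_ , cz) → cz (commutators-in-core {K} {L} {H} isNormal L⊑K [K,K]⊆H Lx Ly)) (free ∘ proj₁) g↑p t∈C
      -- `g ∙ t` is a conjugate of `g`, and `g` commutes with `t`, so the `p`-th power of `t` is
      -- trivial as well.
      t↑p : t ↑ p ≡ ε
      t↑p = begin
        t ↑ p                  ≡⟨ identityˡ (t ↑ p) ⟨
        ε ∙ (t ↑ p)            ≡⟨ cong (_∙ (t ↑ p)) g↑p ⟨
        (g ↑ p) ∙ (t ↑ p)      ≡⟨ ∙-↑ p gt ⟨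
        (g ∙ t) ↑ p            ≡⟨ cong (_↑ p) (conj-commutator g x) ⟨
        conj x g ↑ p           ≡⟨ conj-↑ x g p ⟨
        conj x (g ↑ p)         ≡⟨ cong (conj x) g↑p ⟩
        conj x ε               ≡⟨ conj-ε x ⟩
        ε                      ∎

    -- Elements of order `p` fix no vertex, so `B` is no larger than an orbit, which has at most `p`
    -- vertices. The `p` distinct powers of `g` therefore exhaust `B`.
    normal-p-subgroup-cyclic : ∀ {B} → Decidable B → NormalSubgroup B → (∀ {x} → B x → x ↑ p ≡ ε) →
                               ∀ {g} → B g → g ≢ ε → GeneratesNormal p g
    normal-p-subgroup-cyclic {B} B? isNormal exponent {g} Bg g≢ε = g≢ε , exponent Bg , λ a → generates (conj-closed a Bg)
      where
      open NormalSubgroup isNormal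
      open import Algebra.Properties.Group group using (x∙y⁻¹≈ε⇒x≈y)
      #B≤p : # B? ≤ p
      #B≤p = ℕ.≤-trans
        (#-injection B? (orbit? B? v₀) (v₀ ▹_) (λ {h} Bh → h , Bh , refl)
          (λ {x} {y} Bx By eq → x∙y⁻¹≈ε⇒x≈y x y (large-prime-fixes⇒≡ε pp 3<p (exponent (∙-closed Bx (⁻¹-closed By))) (fixes-⁻¹∙ eq))))
        (subst (# (orbit? B? v₀) ≤_) (ℕ.*-identityʳ p)
          (orbit-size-bound B? isNormal 1 pp (λ {x} Bx → 1 , trans (cong (x ↑_) (ℕ.*-identityʳ p)) (exponent Bx)) p²∤n v₀))
      generates : ∀ {b} → B b → ∃ λ (i : Fin p) → g ↑ toℕ i ≡ b
      generates {b} Bb = decidable-stable (any? (λ i → g ↑ toℕ i Fin.≟ b)) λ ¬ex → contradiction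
        (ℕ.≤-trans (s≤s (#-family (λ y → B? y ×-dec ¬? (y Fin.≟ b)) (λ i → g ↑ toℕ i)
            (λ i → ↑-closed (toℕ i) Bg , λ eq → ¬ex (i , eq)) (↑-toℕ-injective pp g≢ε (exponent Bg))))
          (ℕ.≤-reflexive (sym (#-remove B? b Bb))))
        (ℕ.≤⇒≯ #B≤p)

    -- Descend to the first term of the normal series that contains elements of order p: there they form an abelian subgroup.
    normal-generator : ∀ {K} → Soluble K → ∀ {L} → NormalSubgroup L → L ⊑ K →
                       ∀ {x} → L x → x ↑ p ≡ ε → x ≢ ε → ¬ ¬ ∃ (GeneratesNormal p)
    normal-generator (trivial K-trivial) isNormal L⊑K Lx _ x≢ε = contradiction (K-trivial (L⊑K Lx)) x≢ε
    normal-generator (extend {K} H isSub [K,K]⊆H soluble) {L} isNormal L⊑K {x} Lx x↑p x≢ε ¬gen =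
      -- The goal is absurdity, so `M` and `L` may be taken to be decidable.
      ¬¬-Decidable M λ M? → ¬¬-Decidable L λ L? → cases L? (any? (λ y → M? y ×-dec ((y ↑ p Fin.≟ ε) ×-dec ¬? (y Fin.≟ ε))))
      where
      open NormalSubgroup isNormal
      M : Pred (Fin N) 0ℓ
      M = core L H
      M-normal : NormalSubgroup M
      M-normal = core-normal isNormal isSub
      M⊑H : M ⊑ H
      M⊑H {y} (_ , Hy) = subst H (conj-by-ε y) (Hy ε)
      cases : Decidable L → Dec (∃ λ y → M y × y ↑ p ≡ ε × y ≢ ε) → ⊥
      cases L? (yes (y , My , y↑p , y≢ε)) = normal-generator soluble M-normal M⊑H My y↑p y≢ε ¬gen
      cases L? (no ¬ex) = ¬gen (x , normal-p-subgroup-cyclic (λ y → L? y ×-dec (y ↑ p Fin.≟ ε)) B-normal proj₂ (Lx , x↑p) x≢ε)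
        where
        free : Prime-free M
        free {y} My y↑p = decidable-stable (y Fin.≟ ε) λ y≢ε → ¬ex (y , My , y↑p , y≢ε)
        centralised : ∀ {g} → g ↑ p ≡ ε → ∀ {y} → M y → Commute g y
        centralised = prime-free-centralised soluble M-normal M⊑H free
        B : Pred (Fin N) 0ℓ
        B y = L y × y ↑ p ≡ ε
        -- The commutator lies in `M`, so `y` and `z` commute with it and its `p`-th power is
        -- trivial; `M` has no elements of order `p`.
        abelian : ∀ {y z} → B y → B z → Commute y z
        abelian {y} {z} (Ly , y↑p) (Lz , z↑p) = ⟦⟧≡ε⇒commute (free c∈M
          (commutator-exponent (commutator-def y z) (centralised y↑p c∈M) (centralised z↑p c∈M) {p} y↑p))
          where
          c∈M : M ⟦ y , z ⟧
          c∈M = commutators-in-core {K} {L} {H} isNormal L⊑K [K,K]⊆H Ly Lz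
        B-normal : NormalSubgroup B
        B-normal = record
          { subgroup = record
            { ε∈        = ε∈ , ε-↑ p
            ; ∙-closed  = λ By Bz → ∙-closed (proj₁ By) (proj₁ Bz) ,
                trans (∙-↑ p (abelian By Bz)) (trans (cong₂ _∙_ (proj₂ By) (proj₂ Bz)) (identityˡ ε))
            ; ⁻¹-closed = λ {y} (Ly , y↑p) → ⁻¹-closed Ly ,
                trans (⁻¹-↑ y p) (trans (cong _⁻¹ y↑p) (trans (sym (identityˡ (ε ⁻¹))) (inverseʳ ε))) }
          ; conj-closed = λ {y} a (Ly , y↑p) → conj-closed a Ly , trans (sym (conj-↑ a y p)) (trans (cong (conj a) y↑p) (conj-ε a)) }

-- The automorphism group as a finite group

funToFin-cong : ∀ {k n} {f g : Fin k → Fin n} → (∀ i → f i ≡ g i) → funToFin f ≡ funToFin g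
funToFin-cong {zero}  f≗g = refl
funToFin-cong {suc k} f≗g = cong₂ combine (f≗g zero) (funToFin-cong (f≗g ∘ suc))

module Isomorphisms {n} (X Y : Graph n) where

  IsIso : Perm n → Set
  IsIso σ = ∀ u v → Y (σ ⟨$⟩ʳ u) (σ ⟨$⟩ʳ v) ≡ X u v

  -- A permutation is coded by its forward map alone; on a finite set surjectivity supplies the
  -- inverse.
  Code : Pred (Fin (n ^ n)) 0ℓ
  Code c = (∀ v → ∃ λ u → finToFun {n} {n} c u ≡ v) × (∀ u v → Y (finToFun {n} {n} c u) (finToFun {n} {n} c v) ≡ X u v)

  code? : Decidable Code
  code? c = all? (λ v → any? (λ u → finToFun {n} {n} c u Fin.≟ v)) ×-dec
            all? (λ u → all? (λ v → Y (finToFun {n} {n} c u) (finToFun {n} {n} c v) Bool.≟ X u v))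

  decode : ∀ c → Code c → Perm n
  decode c (onto , _) = permutation f (proj₁ ∘ onto) (proj₂ ∘ onto)
    (λ u → surjective⇒injective f onto (proj₂ (onto (f u))))
    where f = finToFun {n} {n} c

  encode : Perm n → Fin (n ^ n)
  encode σ = funToFin (σ ⟨$⟩ʳ_)

  finToFun-encode : ∀ σ u → finToFun (encode σ) u ≡ σ ⟨$⟩ʳ u
  finToFun-encode σ = Fin.finToFun-funToFin (σ ⟨$⟩ʳ_)

  encode-code : ∀ σ → IsIso σ → Code (encode σ)
  encode-code σ iso = (λ v → σ ⟨$⟩ˡ v , trans (finToFun-encode σ _) (Perm.inverseʳ σ)) ,
    λ u v → trans (cong₂ Y (finToFun-encode σ u) (finToFun-encode σ v)) (iso u v)

  isomorphic? : Dec (X ≅ Y)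
  isomorphic? = map′ (λ (c , code) → decode c code , proj₂ code) (λ (σ , iso) → encode σ , encode-code σ iso) (any? code?)

module AutomorphismGroup {n} (X : Graph n) where

  open Isomorphisms X X
  open Enumeration (enumerate code?)

  order : ℕ
  order = # code?

  abstract
    perm : Fin order → Perm n
    perm x = decode (elem x) (elem∈ x)

    perm-aut : ∀ x → Aut X (perm x)
    perm-aut x = proj₂ (elem∈ x)

    perm-injective : ∀ x y → perm x ≈ perm y → x ≡ y
    perm-injective x y eq = elem-injective (trans (sym (Fin.funToFin-finToFin {n} {n} (elem x)))
      (trans (funToFin-cong {n} {n} eq) (Fin.funToFin-finToFin {n} {n} (elem y))))

    locate : ∀ σ → Aut X σ → Fin order
    locate σ aut = index (encode σ) (encode-code σ aut)

    perm-locate : ∀ σ aut → perm (locate σ aut) ≈ σ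
    perm-locate σ aut u = trans (cong (λ c → finToFun c u) (elem-index (encode σ) (encode-code σ aut))) (finToFun-encode σ u)

  Aut-flip : ∀ {σ} → Aut X σ → Aut X (flip σ)
  Aut-flip {σ} aut u v = trans (sym (aut (σ ⟨$⟩ˡ u) (σ ⟨$⟩ˡ v))) (cong₂ X (Perm.inverseʳ σ) (Perm.inverseʳ σ))

  Aut-∘ : ∀ {σ τ} → Aut X σ → Aut X τ → Aut X (σ ∘ₚ τ)
  Aut-∘ {σ} autσ autτ u v = trans (autτ (σ ⟨$⟩ʳ u) (σ ⟨$⟩ʳ v)) (autσ u v)

  _·_ : Op₂ (Fin order)
  x · y = locate (perm x ∘ₚ perm y) (Aut-∘ {perm x} {perm y} (perm-aut x) (perm-aut y))

  unit : Fin order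
  unit = locate Perm.id (λ _ _ → refl)

  inv : Op₁ (Fin order)
  inv x = locate (flip (perm x)) (Aut-flip {perm x} (perm-aut x))

  perm-· : ∀ x y → perm (x · y) ≈ (perm x ∘ₚ perm y)
  perm-· x y = perm-locate (perm x ∘ₚ perm y) _

  perm-unit : perm unit ≈ Perm.id
  perm-unit = perm-locate Perm.id _

  perm-inv : ∀ x → perm (inv x) ≈ flip (perm x)
  perm-inv x = perm-locate (flip (perm x)) _

  ·-isGroup : IsGroup _≡_ _·_ unit inv
  ·-isGroup = record
    { isMonoid = record
      { isSemigroup = record
        { isMagma = record { isEquivalence = isEquivalence ; ∙-cong = cong₂ _·_ }
        ; assoc   = λ x y z → perm-injective ((x · y) · z) (x · (y · z)) λ u →
            trans (perm-· (x · y) z u) (trans (cong (perm z ⟨$⟩ʳ_) (perm-· x y u))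
              (sym (trans (perm-· x (y · z) u) (perm-· y z (perm x ⟨$⟩ʳ u))))) }
      ; identity = (λ x → perm-injective (unit · x) x λ u → trans (perm-· unit x u) (cong (perm x ⟨$⟩ʳ_) (perm-unit u)))
                 , (λ x → perm-injective (x · unit) x λ u → trans (perm-· x unit u) (perm-unit (perm x ⟨$⟩ʳ u))) }
    ; inverse = (λ x → perm-injective (inv x · x) unit λ u → trans (perm-· (inv x) x u)
                  (trans (cong (perm x ⟨$⟩ʳ_) (perm-inv x u)) (trans (Perm.inverseʳ (perm x)) (sym (perm-unit u)))))
              , (λ x → perm-injective (x · inv x) unit λ u → trans (perm-· x (inv x) u)
                  (trans (perm-inv x (perm x ⟨$⟩ʳ u)) (trans (Perm.inverseˡ (perm x)) (sym (perm-unit u)))))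
    ; ⁻¹-cong = cong inv }

  cubicAction : IsSimple X → Connected X → Cubic X → VertexTransitive X → CubicAction n
  cubicAction (X-sym , _) connected cubic vt = record
    { N = order ; _∙_ = _·_ ; ε = unit ; _⁻¹ = inv ; isGroup = ·-isGroup
    ; _▹_ = λ v x → perm x ⟨$⟩ʳ v
    ; ▹-ε = perm-unit
    ; ▹-∙ = λ v x y → perm-· x y v
    ; faithful = λ {x} fixed → perm-injective x unit λ u → trans (fixed u) (sym (perm-unit u))
    ; transitive = λ u v → let σ , aut , eq = vt u v in locate σ aut , trans (perm-locate σ aut u) eq
    ; X = X
    ; X-▹ = λ u v x → perm-aut x u v
    ; X-sym = X-sym ; connected = connected ; cubic = cubic }

  module _ (simple : IsSimple X) (connected : Connected X) (cubic : Cubic X) (vt : VertexTransitive X) where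

    private
      S : CubicAction n
      S = cubicAction simple connected cubic vt
    open CubicActionProperties S hiding (X; connected; cubic)

    perm-conj : ∀ a x → perm (conj a x) ≈ (flip (perm a) ∘ₚ (perm x ∘ₚ perm a))
    perm-conj a x u = trans (perm-· (inv a) (x · a) u)
      (trans (perm-· x a (perm (inv a) ⟨$⟩ʳ u)) (cong (λ v → perm a ⟨$⟩ʳ (perm x ⟨$⟩ʳ v)) (perm-inv a u)))

    perm-⟦⟧ : ∀ x y → perm ⟦ x , y ⟧ ≈ commutator (perm x) (perm y)
    perm-⟦⟧ x y u = begin
      perm ⟦ x , y ⟧ ⟨$⟩ʳ u                                                ≡⟨ perm-· (inv x) (inv y · (x · y)) u ⟩
      perm (inv y · (x · y)) ⟨$⟩ʳ (perm (inv x) ⟨$⟩ʳ u)                    ≡⟨ cong (perm (inv y · (x · y)) ⟨$⟩ʳ_) (perm-inv x u) ⟩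
      perm (inv y · (x · y)) ⟨$⟩ʳ (perm x ⟨$⟩ˡ u)                          ≡⟨ perm-· (inv y) (x · y) _ ⟩
      perm (x · y) ⟨$⟩ʳ (perm (inv y) ⟨$⟩ʳ (perm x ⟨$⟩ˡ u))                ≡⟨ cong (perm (x · y) ⟨$⟩ʳ_) (perm-inv y _) ⟩
      perm (x · y) ⟨$⟩ʳ (perm y ⟨$⟩ˡ (perm x ⟨$⟩ˡ u))                      ≡⟨ perm-· x y _ ⟩
      commutator (perm x) (perm y) ⟨$⟩ʳ u                                  ∎
      where open ≡-Reasoning

    soluble : ∀ {K : PermSet n} → Solvable K → Soluble S (λ x → K (perm x))
    soluble (trivial K-trivial) = trivial λ {x} Kx → perm-injective x unit λ u → trans (K-trivial (perm x) Kx u) (sym (perm-unit u))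
    soluble (extend H ((H-≈ , H-id , H-∘ , H-flip) , _) [K,K]⊆H solvable) = extend (λ x → H (perm x))
      (record
        { ε∈ = H-≈ Perm.id (perm unit) (λ u → sym (perm-unit u)) H-id
        ; ∙-closed = λ {x} {y} Hx Hy → H-≈ (perm x ∘ₚ perm y) (perm (x · y)) (λ u → sym (perm-· x y u)) (H-∘ (perm x) (perm y) Hx Hy)
        ; ⁻¹-closed = λ {x} Hx → H-≈ (flip (perm x)) (perm (inv x)) (λ u → sym (perm-inv x u)) (H-flip (perm x) Hx) })
      (λ {x} {y} Kx Ky → H-≈ (commutator (perm x) (perm y)) (perm ⟦ x , y ⟧) (λ u → sym (perm-⟦⟧ x y u)) ([K,K]⊆H (perm x) (perm y) Kx Ky))
      (soluble solvable)

    module _ {p} (pp : Prime p) {g} (generator : GeneratesNormal S p g) where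

      private
        instance _ = prime⇒nonZero pp
        g≢ε = proj₁ generator
        g↑p = proj₁ (proj₂ generator)
        conj-g = proj₂ (proj₂ generator)

      -- Exponents range over all natural numbers, so products need no reduction modulo `p`; the
      -- inverse of the `i`-th power has exponent `i * (p ∸ 1)`.
      Powers : PermSet n
      Powers σ = ∃ λ i → perm (g ↑ i) ≈ σ

      Powers-intro : ∀ {x} σ i → g ↑ i ≡ x → perm x ≈ σ → Powers σ
      Powers-intro σ i refl eq = i , eq

      Powers-normal : Powers ⊴ Aut X
      Powers-normal =
        ( (λ σ τ σ≈τ (i , eq) → i , λ u → trans (eq u) (σ≈τ u))
        , (0 , perm-unit)
        , (λ σ τ (i , eqσ) (j , eqτ) → Powers-intro (σ ∘ₚ τ) (i + j) (↑-+ g i j)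
            λ u → trans (perm-· (g ↑ i) (g ↑ j) u) (trans (cong (perm (g ↑ j) ⟨$⟩ʳ_) (eqσ u)) (eqτ (σ ⟨$⟩ʳ u))))
        , λ σ (i , eq) → Powers-intro (flip σ) (i * (p ℕ.∸ 1)) (inverse-power i)
            λ u → trans (perm-inv (g ↑ i) u) (flip-cong {perm (g ↑ i)} {σ} eq u) )
        , (λ σ (i , eq) u v → trans (sym (cong₂ X (eq u) (eq v))) (perm-aut (g ↑ i) u v))
        , λ a h aut-a (i , eq) → let α = locate a aut-a ; j , g↑j = conj-g α in
            Powers-intro (flip a ∘ₚ (h ∘ₚ a)) (i * toℕ j)
              (trans (↑-* g i (toℕ j)) (trans (cong (_↑ i) g↑j) (sym (conj-↑ α g i))))
              λ u → trans (perm-conj α (g ↑ i) u) (trans (perm-locate a aut-a _) (cong (a ⟨$⟩ʳ_)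
                (trans (eq _) (cong (h ⟨$⟩ʳ_) (flip-cong {perm α} {a} (perm-locate a aut-a) u)))))
        where
        flip-cong : ∀ {σ τ : Perm n} → σ ≈ τ → flip σ ≈ flip τ
        flip-cong {σ} {τ} eq u = trans (sym (Perm.inverseˡ τ)) (cong (τ ⟨$⟩ˡ_) (trans (sym (eq (σ ⟨$⟩ˡ u))) (Perm.inverseʳ σ)))
        inverse-power : ∀ i → g ↑ (i * (p ℕ.∸ 1)) ≡ inv (g ↑ i)
        inverse-power i = inverseʳ-unique (g ↑ i) (g ↑ (i * (p ℕ.∸ 1))) (trans (sym (↑-+ g i (i * (p ℕ.∸ 1))))
          (trans (cong (g ↑_) (trans (sym (ℕ.*-suc i (p ℕ.∸ 1))) (cong (i *_) (ℕ.m+[n∸m]≡n (prime>0 pp)))))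
            (↑-∣ (divides i refl) g↑p)))
          where open import Algebra.Properties.Group group using (inverseʳ-unique)

      Powers-order : HasOrder Powers (p ^ 1)
      Powers-order = subst (HasOrder Powers) (sym (ℕ.*-identityʳ p))
        ( (λ i → perm (g ↑ toℕ i))
        , (λ i → toℕ i , λ _ → refl)
        , (λ i j eq → ↑-toℕ-injective S pp g≢ε g↑p (perm-injective (g ↑ toℕ i) (g ↑ toℕ j) eq))
        , λ σ (i , eq) → fromℕ< (m%n<n i p) , λ u → trans (sym (eq u)) (cong (λ x → perm x ⟨$⟩ʳ u)
            (trans (reduce i) (cong (g ↑_) (sym (Fin.toℕ-fromℕ< (m%n<n i p)))))) )
        where
        reduce : ∀ i → g ↑ i ≡ g ↑ (i % p)
        reduce i = trans (cong (g ↑_) (m≡m%n+[m/n]*n i p)) (trans (↑-+ g (i % p) (i / p * p))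
          (trans (cong ((g ↑ (i % p)) ·_) (↑-∣ (divides (i / p) refl) g↑p)) (identityʳ (g ↑ (i % p)))))

      Aut-order : HasOrder (Aut X) order
      Aut-order = perm , perm-aut , perm-injective , λ σ aut → locate σ aut , λ u → sym (perm-locate σ aut u)

      -- By orbit-stabiliser the group has order `n * s` with `s` the order of a vertex stabiliser.
      -- A factor `p` of `s` would, by Cauchy, give an element of order `p` fixing a vertex.
      hasNormalSylow : ∀ {k} → n ≡ p * k → ¬ (p ∣ k) → 3 < p → Fin n → HasNormalSylow p (Aut X)
      hasNormalSylow {k} n≡pk p∤k 3<p v = Powers , Powers-normal , 1 , k * s ,
        Powers-order , subst (HasOrder (Aut X)) order≡ Aut-order , p∤ks
        where
        whole : Pred (Fin order) 0ℓ
        whole x = x ≡ x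
        whole? : Decidable whole
        whole? x = yes refl
        whole-subgroup : Subgroup whole
        whole-subgroup = record { ε∈ = refl ; ∙-closed = λ _ _ → refl ; ⁻¹-closed = λ _ → refl }
        s = # (stabiliser? whole? v)
        order≡ : order ≡ p ^ 1 * (k * s)
        order≡ = begin
          order                       ≡⟨ #-all whole? (λ _ → refl) ⟨
          # whole?                    ≡⟨ orbit-stabiliser whole? whole-subgroup v ⟩
          # (orbit? whole? v) * s     ≡⟨ cong (_* s) (#-all (orbit? whole? v) λ u → let a , eq = transitive v u in a , refl , eq) ⟩
          n * s                       ≡⟨ cong (_* s) n≡pk ⟩
          p * k * s                   ≡⟨ ℕ.*-assoc p k s ⟩
          p * (k * s)                 ≡⟨ cong (_* (k * s)) (ℕ.*-identityʳ p) ⟨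
          p ^ 1 * (k * s)             ∎
          where
          open ≡-Reasoning
        stabiliser-subgroup : Subgroup (λ x → whole x × perm x ⟨$⟩ʳ v ≡ v)
        stabiliser-subgroup = record
          { ε∈ = refl , perm-unit v
          ; ∙-closed = λ {x} {y} (_ , fx) (_ , fy) → refl , trans (perm-· x y v) (trans (cong (perm y ⟨$⟩ʳ_) fx) fy)
          ; ⁻¹-closed = λ {x} (_ , fx) → refl , trans (cong (perm (inv x) ⟨$⟩ʳ_) (sym fx)) (▹-⁻¹ v x) }
        p∤ks : ¬ (p ∣ k * s)
        p∤ks p∣ks with euclidsLemma k s pp p∣ks
        ... | inj₁ p∣k = p∤k p∣k
        ... | inj₂ p∣s with cauchy stabiliser-subgroup (stabiliser? whole? v) pp p∣s
        ...   | x , (_ , fixed) , x≢ε , x↑p = x≢ε (large-prime-fixes⇒≡ε pp 3<p x↑p fixed)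

    -- Being a normal generator is decidable, so its doubly negated existence suffices. The element
    -- of order `p` to start from exists by Cauchy, as transitivity makes `n` divide the group
    -- order.
    no-ladder⇒hasNormalSylow : ∀ {p k} → Prime p → 8 < p → n ≡ p * k → ¬ (p ∣ k) →
      ¬ (8 ∣ n) → ¬ (9 ∣ n) → ¬ (p ^ 2 ∣ n) → 8 < n → (∀ {q} → Prime q → 3 < q → q ∣ n → q ≡ p) →
      ¬ Ladder Adj → Solvable (Aut X) → HasNormalSylow p (Aut X)
    no-ladder⇒hasNormalSylow {p} {k} pp 8<p n≡pk p∤k 8∤n 9∤n p²∤n 8<n large no-ladder solvable = cases (any? generator?)
      where
      v₀ : Fin n
      v₀ = fromℕ< (ℕ.≤-<-trans z≤n 8<n)
      3<p : 3 < p
      3<p = ℕ.<-trans (ℕ.m<m+n 3 (s≤s z≤n)) 8<p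
      generator? : Decidable (GeneratesNormal S p)
      generator? g = ¬? (g Fin.≟ ε) ×-dec ((g ↑ p Fin.≟ ε) ×-dec all? (λ a → any? (λ i → g ↑ toℕ i Fin.≟ conj a g)))
      whole : Pred (Fin order) 0ℓ
      whole x = Aut X (perm x)
      whole? : Decidable whole
      whole? x = yes (perm-aut x)
      whole-normal : NormalSubgroup whole
      whole-normal = record
        { subgroup = record { ε∈ = perm-aut ε ; ∙-closed = λ {x} {y} _ _ → perm-aut (x · y) ; ⁻¹-closed = λ {x} _ → perm-aut (inv x) }
        ; conj-closed = λ {x} a _ → perm-aut (conj a x) }
      p∣order : p ∣ # whole?
      p∣order = ∣-trans (subst (p ∣_) (sym n≡pk) (m∣m*n k))
        (subst₂ _∣_ (#-all (orbit? whole? v₀) λ u → let a , eq = transitive v₀ u in a , perm-aut a , eq)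
          (sym (orbit-stabiliser whole? (NormalSubgroup.subgroup whole-normal) v₀)) (m∣m*n _))
      cases : Dec (∃ (GeneratesNormal S p)) → HasNormalSylow p (Aut X)
      cases (yes (g , generator)) = hasNormalSylow pp generator n≡pk p∤k 3<p v₀
      cases (no ¬generator) = let x , wx , x≢ε , x↑p = cauchy (NormalSubgroup.subgroup whole-normal) whole? pp p∣order in
        ⊥-elim (normal-generator S pp 8<p 8∤n 9∤n p²∤n 8<n large no-ladder
          (soluble solvable) whole-normal (λ {x} _ → perm-aut x) wx x↑p x≢ε ¬generator)

-- Arithmetic of 12p and the conclusion.

module _ {p : ℕ} (pp : Prime p) (7<p : 7 < p) where

  -- 8 is not prime. The sharper bound is what `small-centralised` compares with its 8 movable
  -- elements.
  8<p : 8 < p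
  8<p = ℕ.≤∧≢⇒< 7<p λ { refl → from-no (prime? 8) pp }

  prime≢p : ∀ {q} → q < 8 → q ≢ p
  prime≢p q<8 refl = ℕ.<-asym q<8 8<p

  prime∣12p : ∀ {q} → Prime q → q ∣ 4 * (3 * p) → q ≡ 2 ⊎ q ≡ 3 ⊎ q ≡ p
  prime∣12p pq q∣ = Sum.map
    (λ q∣4 → prime∣prime⇒≡ pq prime[2] (∣^⇒∣ {m = 2} 2 pq q∣4))
    (λ q∣3p → Sum.map (prime∣prime⇒≡ pq prime[3]) (prime∣prime⇒≡ pq pp) (euclidsLemma 3 p pq q∣3p))
    (euclidsLemma 4 (3 * p) pq q∣)

  8∤12p : ¬ (8 ∣ 4 * (3 * p))
  8∤12p 8∣ = [ (λ 2∣3 → contradiction (prime∣prime⇒≡ prime[2] prime[3] 2∣3) λ ())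
             , (λ 2∣p → prime≢p (s≤s (s≤s (s≤s z≤n))) (prime∣prime⇒≡ prime[2] pp 2∣p))
             ]′ (euclidsLemma 3 p prime[2] (*-cancelˡ-∣ {2} {3 * p} 4 8∣))

  4*3p≡3*4p : 4 * (3 * p) ≡ 3 * (4 * p)
  4*3p≡3*4p = trans (sym (ℕ.*-assoc 4 3 p)) (ℕ.*-assoc 3 4 p)

  9∤12p : ¬ (9 ∣ 4 * (3 * p))
  9∤12p 9∣ = [ (λ 3∣4 → contradiction (prime∣prime⇒≡ prime[3] prime[2] (∣^⇒∣ {m = 2} 2 prime[3] 3∣4)) λ ())
             , (λ 3∣p → prime≢p (s≤s (s≤s (s≤s (s≤s z≤n)))) (prime∣prime⇒≡ prime[3] pp 3∣p))
             ]′ (euclidsLemma 4 p prime[3] (*-cancelˡ-∣ {3} {4 * p} 3 (subst (9 ∣_) 4*3p≡3*4p 9∣)))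

  p∤12 : ¬ (p ∣ 12)
  p∤12 p∣12 = [ (λ p∣4 → ℕ.<⇒≱ (ℕ.<-trans (ℕ.m<m+n 4 (s≤s z≤n)) 8<p) (∣⇒≤ p∣4))
              , (λ p∣3 → ℕ.<⇒≱ (ℕ.<-trans (ℕ.m<m+n 3 (s≤s z≤n)) 8<p) (∣⇒≤ p∣3))
              ]′ (euclidsLemma 4 3 pp p∣12)

  12p≡p*12 : 4 * (3 * p) ≡ p * 12
  12p≡p*12 = trans (sym (ℕ.*-assoc 4 3 p)) (ℕ.*-comm 12 p)

  p²∤12p : ¬ (p ^ 2 ∣ 4 * (3 * p))
  p²∤12p p²∣ = p∤12 (subst (_∣ 12) (ℕ.*-identityʳ p)
    (*-cancelˡ-∣ p {{prime⇒nonZero pp}} (subst (p ^ 2 ∣_) 12p≡p*12 p²∣)))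

  large-prime-divisor : ∀ {q} → Prime q → 3 < q → q ∣ 4 * (3 * p) → q ≡ p
  large-prime-divisor pq 3<q q∣ with prime∣12p pq q∣
  ... | inj₁ refl        = contradiction 3<q λ { (s≤s (s≤s ())) }
  ... | inj₂ (inj₁ refl) = contradiction 3<q λ { (s≤s (s≤s (s≤s ()))) }
  ... | inj₂ (inj₂ q≡p)  = q≡p

  8<12p : 8 < 4 * (3 * p)
  8<12p = ℕ.<-≤-trans 8<p (ℕ.≤-trans (ℕ.m≤n*m p 12) (ℕ.≤-reflexive (ℕ.*-assoc 4 3 p)))

  -- Deciding isomorphism with X(3p,2) first means that in the remaining case any ladder is
  -- contradictory.
  normal-Sylow-or-X[3p,2] : (X : Graph (4 * (3 * p))) → IsSimple X → Connected X → Cubic X → VertexTransitive X →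
                            Solvable (Aut X) → HasNormalSylow p (Aut X) ⊎ (X ≅ X[ 3 * p ,2])
  normal-Sylow-or-X[3p,2] X simple connected cubic vt solvable = cases (Isomorphisms.isomorphic? X X[ 3 * p ,2])
    where
    cases : Dec (X ≅ X[ 3 * p ,2]) → HasNormalSylow p (Aut X) ⊎ (X ≅ X[ 3 * p ,2])
    cases (yes iso) = inj₂ iso
    cases (no ¬iso) = inj₁ (AutomorphismGroup.no-ladder⇒hasNormalSylow X simple connected cubic vt pp 8<p
      12p≡p*12 p∤12 8∤12p 9∤12p p²∤12p 8<12p large-prime-divisor
      (λ ladder → ¬iso (LadderCycle.isomorphism {3 * p} X (proj₁ simple) connected ladder (fromℕ< 8<12p))) solvable)

theorem4p2 : (p : ℕ) → Prime p → 7 < p →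
    (X : Graph (12 * p)) → IsSimple X → Connected X → Cubic X → VertexTransitive X →
    Solvable (Aut X) →
    HasNormalSylow p (Aut X) ⊎ (X ≅ X[ 3 * p ,2])
-- `12 * p` is `4 * 3 * p` by computation, and associativity brings it to the order `4 * (3 * p)` of
-- X(3p,2).
theorem4p2 p pp 7<p = subst
  (λ n → (X : Graph n) → IsSimple X → Connected X → Cubic X → VertexTransitive X →
         Solvable (Aut X) → HasNormalSylow p (Aut X) ⊎ (X ≅ X[ 3 * p ,2]))
  (sym (ℕ.*-assoc 4 3 p)) (normal-Sylow-or-X[3p,2] pp 7<p)
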